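{- There exist constants $M,m>1$ such that the following hold. For every integer $d\ge 2$: (i) for every real $x\ge 1$, $\displaystyle\sup_{G\in\mathcal A_d(1,x)}\frac{\chi(G)}{\omega(G)}\le M^d$; (ii) for every real $x\ge 1.2$, $\displaystyle m^d\le\sup_{G\in\mathcal A_d(1,x)}\frac{\chi(G)}{\omega(G)}$. Both bounds hold for unit disc graphs as well, that is, for every integer $d\ge 2$, $\displaystyle m^d\le\sup_{G\in\mathcal A_d(0,1)}\frac{\chi(G)}{\omega(G)}\le M^d$. Moreover, for $d=1$ and every real $x>1$, $\displaystyle\frac32\le\sup_{G\in\mathcal A_1(1,x)}\frac{\chi(G)}{\omega(G)}\le M$.
   Context: For real numbers $R_2\ge R_1\ge 0$ and an integer $d\ge 1$, $\mathcal A_d(R_1,R_2)$ denotes the family of finite simple graphs $G$ that admit an $(R_1,R_2)$-annulus embedding in $\mathbb R^d$, that is, an injective map from $V(G)$ to $\mathbb R^d$ such that for all pairs of different vertices $u,v$, $uv$ is an edge of $G$ if and only if the Euclidean distance between the images of $u$ and $v$ is in $[R_1,R_2]$. The $d$-dimensional unit disc graphs are the graphs in $\mathcal A_d(0,1)$. $\chi(G)$ denotes the chromatic number and $\omega(G)$ the size of the largest clique of $G$; suprema of the ratio $\chi(G)/\omega(G)$ are taken over graphs with at least one vertex. -}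

module Defs where

open import Level using (0ℓ) renaming (suc to lsuc)
open import Algebra.Bundles using (CommutativeRing; Semiring)
import Algebra.Definitions.RawSemiring as RawSemiringDefinitions
open import Data.Bool.Base using (Bool; T)
open import Data.Fin.Base using (Fin)
open import Data.Fin.Subset using (Subset; _∈_; ∣_∣)
open import Data.Nat.Base as ℕ using (ℕ; NonZero)
open import Data.Product.Base using (Σ-syntax; ∃-syntax; _×_)
open import Data.Vec.Functional using (Vector)
open import Data.Vec.Functional.Relation.Binary.Pointwise using (Pointwise)
open import Function.Bundles using (_⇔_)
open import Function.Definitions using (Injective)
open import Relation.Binary.PropositionalEquality.Core using (_≡_; _≢_)
open import Relation.Binary.Structures using (IsTotalOrder)
open import Relation.Nullary.Negation.Core using (¬_)

-- The real numbers, given axiomatically as a Dedekind-complete ordered field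
-- (classically unique up to isomorphism).  The equality is a setoid equality,
-- so that cuts or Cauchy sequences form a model without quotients.
record CompleteOrderedField : Set (lsuc 0ℓ) where
  infix  8 _⁻¹
  infixl 7 _/_
  infix  4 _≤_ _<_
  field
    commutativeRing : CommutativeRing 0ℓ 0ℓ

  open CommutativeRing commutativeRing public
    using (_≈_; _+_; _*_; _-_; -_; 0#; 1#; semiring)
    renaming (Carrier to ℝ)

  field
    _≤_          : ℝ → ℝ → Set
    _⁻¹          : ℝ → ℝ
    0≉1          : ¬ 0# ≈ 1#
    -- The value of 0# ⁻¹ is left unspecified.
    *-inverseʳ   : ∀ x → ¬ x ≈ 0# → x * x ⁻¹ ≈ 1#
    isTotalOrder : IsTotalOrder _≈_ _≤_
    +-monoˡ-≤    : ∀ {x y} z → x ≤ y → x + z ≤ y + z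
    *-nonNeg     : ∀ {x y} → 0# ≤ x → 0# ≤ y → 0# ≤ x * y

  _<_ : ℝ → ℝ → Set
  x < y = x ≤ y × ¬ x ≈ y

  _/_ : ℝ → ℝ → ℝ
  x / y = x * y ⁻¹

  open RawSemiringDefinitions (Semiring.rawSemiring semiring) public
    using (_^_; sum)

  fromℕ : ℕ → ℝ
  fromℕ n = RawSemiringDefinitions._×_ (Semiring.rawSemiring semiring) n 1#

  IsUpperBound : (ℝ → Set) → ℝ → Set
  IsUpperBound P b = ∀ r → P r → r ≤ b

  IsSupremum : (ℝ → Set) → ℝ → Set
  IsSupremum P s = IsUpperBound P s × (∀ b → IsUpperBound P b → s ≤ b)

  field
    complete : ∀ (P : ℝ → Set) → (∃[ r ] P r) → (∃[ b ] IsUpperBound P b) →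
               ∃[ s ] IsSupremum P s

-- Adjacency is Bool-valued so that graphs form a small type; classically this
-- is no restriction.
record FiniteSimpleGraph : Set where
  field
    order       : ℕ
    adjacent    : Fin order → Fin order → Bool
    symmetric   : ∀ u v → adjacent u v ≡ adjacent v u
    irreflexive : ∀ v → ¬ T (adjacent v v)

  Vertex : Set
  Vertex = Fin order

  Edge : Vertex → Vertex → Set
  Edge u v = T (adjacent u v)

  Colorable : ℕ → Set
  Colorable k = Σ[ c ∈ (Vertex → Fin k) ] (∀ u v → Edge u v → c u ≢ c v)

  IsChromaticNumber : ℕ → Set
  IsChromaticNumber k = Colorable k × (∀ j → Colorable j → k ℕ.≤ j)

  IsClique : Subset order → Set
  IsClique S = ∀ u v → u ∈ S → v ∈ S → u ≢ v → Edge u v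

  IsCliqueNumber : ℕ → Set
  IsCliqueNumber k =
    (Σ[ S ∈ Subset order ] (IsClique S × ∣ S ∣ ≡ k)) ×
    (∀ S → IsClique S → ∣ S ∣ ℕ.≤ k)

module AnnulusGraphs (R : CompleteOrderedField) where
  open CompleteOrderedField R
  open FiniteSimpleGraph

  sumOfSquares : ∀ {d} → Vector ℝ d → ℝ
  sumOfSquares p = sum (λ i → p i * p i)

  -- r is the Euclidean distance between p and q, that is, the nonnegative
  -- square root of the sum of the squared coordinate differences.
  IsDistance : ∀ {d} → Vector ℝ d → Vector ℝ d → ℝ → Set
  IsDistance p q r = 0# ≤ r × r * r ≈ sumOfSquares (λ i → p i - q i)

  DistanceIn[_,_] : ℝ → ℝ → ∀ {d} → Vector ℝ d → Vector ℝ d → Set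
  DistanceIn[ R₁ , R₂ ] p q = ∃[ r ] (IsDistance p q r × R₁ ≤ r × r ≤ R₂)

  𝒜 : ℕ → ℝ → ℝ → FiniteSimpleGraph → Set
  𝒜 d R₁ R₂ G =
    Σ[ f ∈ (Vertex G → Vector ℝ d) ]
      (Injective _≡_ (Pointwise _≈_) f ×
       (∀ u v → u ≢ v → Edge G u v ⇔ DistanceIn[ R₁ , R₂ ] (f u) (f v)))

  -- The set of values χ(G)/ω(G) for G in 𝒢 with at least one vertex (so that
  -- ω(G) is nonzero).
  χ/ω-Ratios : (FiniteSimpleGraph → Set) → ℝ → Set
  χ/ω-Ratios 𝒢 r =
    Σ[ G ∈ FiniteSimpleGraph ] (𝒢 G × NonZero (order G) ×
      (∃[ χ ] ∃[ ω ] (IsChromaticNumber G χ × IsCliqueNumber G ω ×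
                      r ≈ fromℕ χ / fromℕ ω)))

  IsSup-χ/ω : (FiniteSimpleGraph → Set) → ℝ → Set
  IsSup-χ/ω 𝒢 s = IsSupremum (χ/ω-Ratios 𝒢) s

{-# OPTIONS --safe #-}
-- Upper bounds.  Cut ℝᵈ into cubes of diameter less than a.  The cubes that meet the ball of radius
-- 3 a around a point differ from its own cube by integer vectors of ℓ¹-norm O(d), so there are at
-- most Kᵈ of them.  In a unit disc graph the cubes with a = 1 are cliques, hence degrees are less
-- than Kᵈ ω and greedy colouring applies.  In an annulus graph the cubes with a = 1 are independent,
-- so that one representative of each has to be coloured; colouring the representatives greedily with
-- Kᵈ colours so that those at distance < 1 differ splits every cube with a = x into Kᵈ cliques, hence
-- a representative has at most K²ᵈ ω others within distance 3 x.
--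
-- Lower bounds.  Join two words of {0,1}ᵈ when their Hamming distance is at least 3 d / 4.  No three
-- words are pairwise joined, and a set of pairwise unjoined words is exponentially smaller than the
-- cube, so χ ≥ 2ᵈ / α is exponential in d while ω ≤ 2; the same inequality for the complement has
-- α = 2 and ω exponentially smaller than 2ᵈ.  The cube scaled to diameter 2 / √3 < 6 / 5 puts the
-- graph in 𝒜 d 1 x; scaled slightly more its complement is a unit disc graph.  For small d, and for
-- d = 1, odd cycles and other triangle-free graphs with an odd closed walk give 3 / 2.
module Submission where

open import Defs
open import Level using (0ℓ)
open import Axiom.ExcludedMiddle using (ExcludedMiddle)
open import Algebra.Bundles using (CommutativeRing; RawRing)
import Algebra.Properties.Ring as RingProperties
import Algebra.Properties.Semiring.Mult as MultProperties
import Algebra.Properties.Semiring.Sum as SumProperties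
import Algebra.Solver.Ring as RingSolver
open import Algebra.Solver.Ring.AlmostCommutativeRing using (fromCommutativeRing; _-Raw-AlmostCommutative⟶_)
open import Data.Bool.Base using (Bool; true; false; T; _∧_; _∨_; if_then_else_)
open import Data.Bool.Properties using (T?; T-∧)
open import Data.Empty using (⊥; ⊥-elim)
open import Data.Fin.Base using (Fin; zero; suc; toℕ; fromℕ<; inject≤; splitAt; _↑ˡ_; _↑ʳ_)
open import Data.Fin.Patterns
import Data.Fin.Properties as Fin
open import Data.Fin.Subset using (Subset; ∣_∣; ⁅_⁆)
import Data.Fin.Subset as Subset
import Data.Fin.Subset.Properties as Subset
open import Data.Maybe.Base using (Maybe; just; nothing)
open import Data.Nat.Base as ℕ using (ℕ; zero; suc; NonZero) renaming (_≤_ to _≤ℕ_)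
import Data.Nat.Properties as ℕ
open import Data.Product.Base using (∃-syntax; Σ-syntax; _×_; _,_; proj₁; proj₂)
open import Data.Sum.Base using (_⊎_; inj₁; inj₂; [_,_]′)
open import Data.Unit.Base using (⊤; tt)
open import Data.Vec.Functional using (Vector)
open import Function.Base using (_∘_; id)
open import Function.Bundles using (_⇔_; mk⇔; Equivalence)
open import Relation.Binary.Bundles using (Poset)
open import Relation.Binary.PropositionalEquality as ≡ using (_≡_; _≢_; _≗_)
open import Relation.Binary.Structures using (module IsTotalOrder)
open import Relation.Nullary using (¬_; Dec; yes; no; does; contradiction)
open import Relation.Nullary.Decidable using (decidable-stable; toWitness; ¬?; _×-dec_; _⊎-dec_)

-- The threshold 3 / 4 lies in a narrow window. Three words have distances of total at most 2 d, so
-- excluding triangles takes a threshold above 2 / 3, and fitting the cube into `x` = 6 / 5 takes at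
-- least 25 / 36. On the other side, the estimate for sets of words without distant pairs comes from
-- an induction that halves the cube, and it stops beating 2ᵈ at a threshold of about 0.83. The
-- induction has to treat two sets at once, because the halves of a single set are already two
-- different sets. At 3 / 4 it replaces the base 2 by the eighth root of 6561 / 32, which is less
-- than 1.946.
--
-- The base 101 / 100 and the dimension 40 are fitted to each other: the cube gives the ratio (101 /
-- 100)ᵈ from d = 40 on, and the ratio 3 / 2 of the five-cycle exceeds (101 / 100)⁴⁰ but no longer
-- the next power.
--
-- The existence of each supremum is part of the claim, so the lower bounds also rest on the
-- colourings that prove the upper bounds.

-- Counting members of predicates on finite sets, and greedy colouring.

module Counting (em : ExcludedMiddle 0ℓ) where
  open import Data.Nat.Base
  open import Data.Nat.Properties
  open import Data.Fin.Subset using (_∈_)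
  open import Data.Vec.Base using ([]; _∷_; tabulate; here; there)
  open import Data.Vec.Properties using (lookup∘tabulate; []=⇒lookup; lookup⇒[]=)
  open import Relation.Binary.PropositionalEquality using (refl; sym; trans; cong; cong₂; subst; ≢-sym)

  bit : Set → ℕ
  bit P = if does (em {P}) then 1 else 0

  bit-yes : ∀ {P} → P → bit P ≡ 1
  bit-yes {P} p with em {P}
  ... | yes _ = refl
  ... | no ¬p = contradiction p ¬p

  bit-no : ∀ {P} → ¬ P → bit P ≡ 0
  bit-no {P} ¬p with em {P}
  ... | yes p = contradiction p ¬p
  ... | no _  = refl

  bit-∪ : ∀ {P Q R} → (P → Q ⊎ R) → bit P ≤ bit Q + bit R
  bit-∪ {P} {Q} {R} f with em {P}
  ... | no _ = z≤n
  ... | yes p with f p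
  ...   | inj₁ q = subst (λ b → 1 ≤ b + bit R) (sym (bit-yes q)) (s≤s z≤n)
  ...   | inj₂ r = subst (λ b → 1 ≤ bit Q + b) (sym (bit-yes r)) (m≤n+m 1 (bit Q))

  bit-mono : ∀ {P Q} → (P → Q) → bit P ≤ bit Q
  bit-mono {P} {Q} f with em {P}
  ... | no _  = z≤n
  ... | yes p = ≤-reflexive (sym (bit-yes (f p)))

  -- Opaque, so that unification can read P off # P.
  opaque
    # : ∀ {n} → (Fin n → Set) → ℕ
    # {zero}  P = 0
    # {suc n} P = bit (P zero) + # (P ∘ suc)

    #-mono : ∀ {n} {P Q : Fin n → Set} → (∀ u → P u → Q u) → # P ≤ # Q
    #-mono {zero}  f = z≤n
    #-mono {suc n} f = +-mono-≤ (bit-mono (f zero)) (#-mono (f ∘ suc))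

    #-∪ : ∀ {n} {P Q R : Fin n → Set} → (∀ u → P u → Q u ⊎ R u) → # P ≤ # Q + # R
    #-∪ {zero} f = z≤n
    #-∪ {suc n} {P} {Q} {R} f = begin
      bit (P zero) + # (P ∘ suc)                               ≤⟨ +-mono-≤ (bit-∪ (f zero)) (#-∪ (f ∘ suc)) ⟩
      (bit (Q zero) + bit (R zero)) + (# (Q ∘ suc) + # (R ∘ suc)) ≡⟨ +-assoc-middle (bit (Q zero)) _ _ _ ⟩
      # Q + # R ∎
      where
      open ≤-Reasoning
      +-assoc-middle : ∀ a b c d → (a + b) + (c + d) ≡ (a + c) + (b + d)
      +-assoc-middle a b c d = trans (+-assoc a b _) (trans (cong (a +_) (trans (sym (+-assoc b c d))
        (trans (cong (_+ d) (+-comm b c)) (+-assoc c b d)))) (sym (+-assoc a c _)))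

    #-∅ : ∀ {n} {P : Fin n → Set} → (∀ u → ¬ P u) → # P ≡ 0
    #-∅ {zero}  ¬P = refl
    #-∅ {suc n} ¬P = cong₂ _+_ (bit-no (¬P zero)) (#-∅ (¬P ∘ suc))

    #-full : ∀ {n} {P : Fin n → Set} → (∀ u → P u) → # P ≡ n
    #-full {zero}  P = refl
    #-full {suc n} P = cong₂ _+_ (bit-yes (P zero)) (#-full (P ∘ suc))

    #-unique : ∀ {n} {P : Fin n → Set} → (∀ u v → P u → P v → u ≡ v) → # P ≤ 1
    #-unique {zero} f = z≤n
    #-unique {suc n} {P} f with em {P zero}
    ... | yes p = ≤-reflexive (cong suc (#-∅ λ u q → Fin.0≢1+n (f zero (suc u) p q)))
    ... | no _  = #-unique λ u v p q → Fin.suc-injective (f (suc u) (suc v) p q)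

    #-suc : ∀ {n} (P : Fin (suc n) → Set) → # P ≡ bit (P zero) + # (P ∘ suc)
    #-suc P = refl

  #-remove : ∀ {n} {P : Fin n → Set} v → # P ≤ suc (# (λ u → P u × u ≢ v))
  #-remove {P = P} v = ≤-trans (#-∪ {Q = _≡ v} split) (+-monoˡ-≤ _ (#-unique λ { _ _ refl refl → refl }))
    where
    split : ∀ u → P u → u ≡ v ⊎ P u × u ≢ v
    split u p with u Fin.≟ v
    ... | yes e = inj₁ e
    ... | no ne = inj₂ (p , ne)

  #≤2 : ∀ {n} {P : Fin n → Set} →
        (∀ u v w → P u → P v → P w → u ≢ v → u ≢ w → v ≢ w → ⊥) → # P ≤ 2
  #≤2 {P = P} noTriple with em {∃[ u ] P u}
  ... | no ¬P = subst (_≤ 2) (sym (#-∅ λ u p → ¬P (u , p))) z≤n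
  ... | yes (u , p) = ≤-trans (#-remove u) (s≤s (#-unique unique))
    where
    unique : ∀ v w → P v × v ≢ u → P w × w ≢ u → v ≡ w
    unique v w (q , v≢u) (r , w≢u) with v Fin.≟ w
    ... | yes e = e
    ... | no v≢w = ⊥-elim (noTriple u v w p q r (≢-sym v≢u) (≢-sym w≢u) v≢w)

  #-fibres : ∀ {n} {P : Fin n → Set} (c : Fin n → ℕ) K α →
             (∀ u → P u → c u < K) → (∀ j → # (λ u → P u × c u ≡ j) ≤ α) → # P ≤ K * α
  #-fibres c zero    α bound fibre = ≤-reflexive (#-∅ λ u p → n≮0 (bound u p))
  #-fibres {P = P} c (suc K) α bound fibre =
    ≤-trans (#-∪ split) (+-mono-≤ (fibre K)
      (#-fibres c K α (λ _ → proj₂) λ j → ≤-trans (#-mono λ { u ((p , _) , e) → p , e }) (fibre j)))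
    where
    split : ∀ u → P u → P u × c u ≡ K ⊎ P u × c u < K
    split u p with m≤n⇒m<n∨m≡n (≤-pred (bound u p))
    ... | inj₁ lt = inj₂ (p , lt)
    ... | inj₂ e  = inj₁ (p , e)

  #-image : ∀ {n k} (c : Fin n → ℕ) {P : Fin n → Set} {Q : Fin k → Set} →
            (∀ j → Q j → ∃[ u ] (P u × c u ≡ toℕ j)) → # Q ≤ # P
  #-image {zero} c {P} onto = subst (_≤ # P) (sym (#-∅ λ j q → Fin.¬Fin0 (proj₁ (onto j q)))) z≤n
  #-image {suc n} c {P} {Q} onto =
    ≤-trans (#-∪ split) (≤-trans (+-mono-≤ hd (#-image (c ∘ suc) λ _ → id)) (≤-reflexive (sym (#-suc P))))
    where
    Tail : _ → Set
    Tail j = ∃[ u ] (P (suc u) × c (suc u) ≡ toℕ j)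
    split : ∀ j → Q j → (P zero × c zero ≡ toℕ j) ⊎ Tail j
    split j q with onto j q
    ... | zero  , pe = inj₁ pe
    ... | suc u , pe = inj₂ (u , pe)
    hd : # (λ j → P zero × c zero ≡ toℕ j) ≤ bit (P zero)
    hd with em {P zero}
    ... | yes _ = #-unique λ { u v (_ , e) (_ , e′) → Fin.toℕ-injective (trans (sym e) e′) }
    ... | no ¬p = ≤-reflexive (#-∅ λ { _ (p , _) → ¬p p })

  opaque
    unfolding #

    #-there : ∀ {n b} (S : Subset n) → # (_∈ S) ≡ # (λ u → suc u ∈ b ∷ S)
    #-there S = ≤-antisym (#-mono {P = _∈ S} λ _ → there)
                          (#-mono {Q = _∈ S} λ { _ (there p) → p })

    #-subset : ∀ {n} (S : Subset n) → ∣ S ∣ ≡ # (_∈ S)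
    #-subset []          = refl
    #-subset (true ∷ S)  = cong₂ _+_ (sym (bit-yes here)) (trans (#-subset S) (#-there S))
    #-subset (false ∷ S) = cong₂ _+_ (sym (bit-no λ ())) (trans (#-subset S) (#-there S))

  toSubset : ∀ {n} → (Fin n → Set) → Subset n
  toSubset P = tabulate λ u → does (em {P u})

  ∈-toSubset⁻ : ∀ {n} (P : Fin n → Set) u → u ∈ toSubset P → P u
  ∈-toSubset⁻ P u u∈ with em {P u} | trans (sym (lookup∘tabulate (λ u → does (em {P u})) u)) ([]=⇒lookup u∈)
  ... | yes p | _ = p
  ... | no _  | ()

  ∈-toSubset⁺ : ∀ {n} (P : Fin n → Set) u → P u → u ∈ toSubset P
  ∈-toSubset⁺ P u p = lookup⇒[]= u _ (trans (lookup∘tabulate _ u) eq)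
    where
    eq : does (em {P u}) ≡ true
    eq with em {P u}
    ... | yes _ = refl
    ... | no ¬p = contradiction p ¬p

  ∣toSubset∣ : ∀ {n} (P : Fin n → Set) → # P ≡ ∣ toSubset P ∣
  ∣toSubset∣ P = trans (≤-antisym (#-mono (∈-toSubset⁺ P)) (#-mono (∈-toSubset⁻ P))) (sym (#-subset (toSubset P)))

  -- If every colour below k occurred on P, then `c` would map members of P onto all k colours, and
  -- P would have at least k members.
  freeColour : ∀ {n} (c : Fin n → ℕ) (P : Fin n → Set) k → # P < k →
               ∃[ j ] (j < k × (∀ u → P u → c u ≢ j))
  freeColour c P k few with em {∃[ j ] (j < k × (∀ u → P u → c u ≢ j))}
  ... | yes free = free
  ... | no ¬free = contradiction few (≤⇒≯ (subst (_≤ # P) (#-full {k} {λ _ → ⊤} (λ _ → tt)) (#-image c onto)))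
    where
    onto : ∀ (j : Fin k) → ⊤ → ∃[ u ] (P u × c u ≡ toℕ j)
    onto j _ with em {∃[ u ] (P u × c u ≡ toℕ j)}
    ... | yes used  = used
    ... | no unused = ⊥-elim (¬free (toℕ j , Fin.toℕ<n j , λ u p e → unused (u , p , e)))

  -- E is reflexive, so that the degrees count the vertex itself; colours outside Q are junk.
  greedyColouring : ∀ {n} (Q : Fin n → Set) (E : Fin n → Fin n → Set) k →
    (∀ v → E v v) → (∀ u v → E u v → E v u) →
    (∀ v → Q v → # (λ u → Q u × E v u) ≤ k) →
    Σ[ c ∈ (Fin n → ℕ) ] ((∀ v → Q v → c v < k) ×
      (∀ u v → Q u → Q v → u ≢ v → E u v → c u ≢ c v))
  greedyColouring {zero} Q E k _ _ _ = (λ ()) , (λ ()) , λ ()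
  greedyColouring {suc n} Q E k E-refl E-sym degree
    with c , bound , proper ← greedyColouring (Q ∘ suc) (λ u v → E (suc u) (suc v)) k (E-refl ∘ suc)
           (λ u v → E-sym (suc u) (suc v)) (λ v q → ≤-trans (m≤n+m _ _) (subst (_≤ k) (#-suc _) (degree (suc v) q)))
    with em {Q zero}
  ... | no ¬q = (λ { zero → 0 ; (suc u) → c u })
              , (λ { zero q → contradiction q ¬q ; (suc u) → bound u })
              , λ { zero v q → contradiction q ¬q
                  ; (suc u) zero _ q → contradiction q ¬q
                  ; (suc u) (suc v) p q u≢v → proper u v p q (u≢v ∘ cong suc) }
  ... | yes q
    with j , j<k , free ← freeColour c (λ u → Q (suc u) × E zero (suc u)) k
           (subst (_≤ k) (trans (#-suc _) (cong (_+ # (λ u → Q (suc u) × E zero (suc u))) (bit-yes (q , E-refl zero)))) (degree zero q))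
    = (λ { zero → j ; (suc u) → c u })
    , (λ { zero _ → j<k ; (suc u) → bound u })
    , λ { zero zero _ _ u≢v → ⊥-elim (u≢v refl)
        ; zero (suc v) _ qv _ e → ≢-sym (free v (qv , e))
        ; (suc u) zero qu _ _ e → free u (qu , E-sym _ _ e)
        ; (suc u) (suc v) p q u≢v → proper u v p q (u≢v ∘ cong suc) }

  -- The first vertex of each cell is chosen. As `rep` then depends on the cell only, it is
  -- idempotent, and different representatives lie in different cells.
  representatives : ∀ {n} (cell : Fin n → ℕ) →
    Σ[ rep ∈ (Fin n → Fin n) ] ((∀ u → cell (rep u) ≡ cell u) × (∀ u v → cell u ≡ cell v → rep u ≡ rep v))
  representatives {zero}  cell = (λ ()) , (λ ()) , λ ()
  representatives {suc n} cell with rep , rep-cell , rep-cong ← representatives (cell ∘ suc) = rep′ , rep′-cell , rep′-cong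
    where
    rep′ : Fin (suc n) → Fin (suc n)
    rep′ zero = zero
    rep′ (suc u) with cell zero ≟ cell (suc u)
    ... | yes _ = zero
    ... | no _  = suc (rep u)
    rep′-cell : ∀ u → cell (rep′ u) ≡ cell u
    rep′-cell zero = refl
    rep′-cell (suc u) with cell zero ≟ cell (suc u)
    ... | yes e = e
    ... | no _  = rep-cell u
    rep′-cong : ∀ u v → cell u ≡ cell v → rep′ u ≡ rep′ v
    rep′-cong zero    zero    e = refl
    rep′-cong zero    (suc v) e with cell zero ≟ cell (suc v)
    ... | yes _ = refl
    ... | no ne = contradiction e ne
    rep′-cong (suc u) zero    e with cell zero ≟ cell (suc u)
    ... | yes _ = refl
    ... | no ne = contradiction (sym e) ne
    rep′-cong (suc u) (suc v) e with cell zero ≟ cell (suc u) | cell zero ≟ cell (suc v)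
    ... | yes _ | yes _  = refl
    ... | yes a | no b   = contradiction (trans a e) b
    ... | no a  | yes b  = contradiction (trans b (sym e)) a
    ... | no _  | no _   = cong suc (rep-cong u v e)

-- Chromatic number, clique number and their elementary bounds.

module Graphs (em : ExcludedMiddle 0ℓ) where
  open import Data.Nat.Base
  open import Data.Nat.Properties
  open import Relation.Binary.PropositionalEquality using (refl; sym; trans; cong; subst)
  open Counting em
  open FiniteSimpleGraph

  least : ∀ (P : ℕ → Set) n → P n → ∃[ k ] (P k × (∀ j → P j → k ≤ j))
  least P zero    p = 0 , p , λ _ _ → z≤n
  least P (suc n) p with em {P 0}
  ... | yes p₀ = 0 , p₀ , λ _ _ → z≤n
  ... | no ¬p₀ with k , pk , minimal ← least (P ∘ suc) n p =
    suc k , pk , λ { zero p₀ → contradiction p₀ ¬p₀ ; (suc j) pj → s≤s (minimal j pj) }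

  edge⇒≢ : ∀ G u v → Edge G u v → u ≢ v
  edge⇒≢ G u .u e refl = irreflexive G u e

  chromaticNumber : ∀ G → ∃[ χ ] IsChromaticNumber G χ
  chromaticNumber G = least (Colorable G) (order G) (id , edge⇒≢ G)

  -- The least upper bound on the sizes of cliques is attained: otherwise every clique would be
  -- smaller and the bound could be lowered by one. A bound of 0 is attained by the empty set.
  cliqueNumber : ∀ G → ∃[ ω ] IsCliqueNumber G ω
  cliqueNumber G
    with ω , upper , minimal ← least (λ k → ∀ S → IsClique G S → ∣ S ∣ ≤ k) (order G) (λ S _ → Subset.∣p∣≤n S)
    with em {Σ[ S ∈ Subset (order G) ] (IsClique G S × ∣ S ∣ ≡ ω)}
  ... | yes attained = ω , attained , upper
  ... | no ¬attained = ⊥-elim (smaller ω upper minimal ¬attained)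
    where
    smaller : ∀ ω → (∀ S → IsClique G S → ∣ S ∣ ≤ ω) →
              (∀ j → (∀ S → IsClique G S → ∣ S ∣ ≤ j) → ω ≤ j) →
              ¬ (Σ[ S ∈ Subset (order G) ] (IsClique G S × ∣ S ∣ ≡ ω)) → ⊥
    smaller zero    upper minimal ¬attained =
      ¬attained (Subset.⊥ , (λ u v u∈ → ⊥-elim (Subset.∉⊥ u∈)) , Subset.∣⊥∣≡0 (order G))
    smaller (suc ω) upper minimal ¬attained =
      1+n≰n (minimal ω λ S clique → ≤-pred (≤∧≢⇒< (upper S clique) λ e → ¬attained (S , clique , e)))

  0<cliqueNumber : ∀ G {ω} → NonZero (order G) → IsCliqueNumber G ω → NonZero ω
  0<cliqueNumber G {ω} nz (_ , upper) = >-nonZero (subst (_≤ ω) (Subset.∣⁅x⁆∣≡1 v) (upper ⁅ v ⁆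
    λ u w u∈ w∈ u≢w → ⊥-elim (u≢w (trans (Subset.x∈⁅y⁆⇒x≡y v u∈) (sym (Subset.x∈⁅y⁆⇒x≡y v w∈))))))
    where
    v : Fin (order G)
    v = fromℕ< (>-nonZero⁻¹ (order G) {{nz}})

  clique≤ω : ∀ G {ω} → IsCliqueNumber G ω → (P : Vertex G → Set) →
             (∀ u v → P u → P v → u ≢ v → Edge G u v) → # P ≤ ω
  clique≤ω G {ω} (_ , upper) P clique = subst (_≤ ω) (sym (∣toSubset∣ P)) (upper (toSubset P)
    λ u v u∈ v∈ → clique u v (∈-toSubset⁻ P u u∈) (∈-toSubset⁻ P v v∈))

  colorable : ∀ G {k} (c : Vertex G → ℕ) → (∀ v → c v < k) → (∀ u v → Edge G u v → c u ≢ c v) → Colorable G k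
  colorable G c bound proper = (λ v → fromℕ< (bound v)) , λ u v e eq →
    proper u v e (trans (sym (Fin.toℕ-fromℕ< (bound u))) (trans (cong toℕ eq) (Fin.toℕ-fromℕ< (bound v))))

  -- Colour classes are independent, so each of the χ classes has at most α members.
  independent-bound : ∀ G {χ α} → Colorable G χ →
    (∀ (P : Vertex G → Set) → (∀ u v → P u → P v → ¬ Edge G u v) → # P ≤ α) → order G ≤ χ * α
  independent-bound G {χ} {α} (c , proper) indep = subst (_≤ χ * α) (#-full {P = λ _ → ⊤} λ _ → tt)
    (#-fibres (toℕ ∘ c) χ α (λ u _ → Fin.toℕ<n (c u)) λ j → indep (λ u → ⊤ × toℕ (c u) ≡ j)
      λ { u v (_ , e) (_ , e′) uv → proper u v uv (Fin.toℕ-injective (trans e (sym e′))) })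

  ω≤2 : ∀ G {ω} → IsCliqueNumber G ω →
        (∀ u v w → Edge G u v → Edge G u w → Edge G v w → ⊥) → ω ≤ 2
  ω≤2 G ((S , clique , refl) , _) triangleFree = subst (_≤ 2) (sym (#-subset S)) (#≤2
    λ u v w u∈ v∈ w∈ u≢v u≢w v≢w →
      triangleFree u v w (clique u v u∈ v∈ u≢v) (clique u w u∈ w∈ u≢w) (clique v w v∈ w∈ v≢w))

  3≤χ : ∀ G {χ} → Colorable G χ → ¬ Colorable G 2 → 3 ≤ χ
  3≤χ G {χ} (c , proper) ¬2 with 3 ≤? χ
  ... | yes 3≤χ = 3≤χ
  ... | no 3≰χ = contradiction ((λ v → inject≤ (c v) χ≤2) , λ u v e eq → proper u v e (Fin.inject≤-injective χ≤2 χ≤2 _ _ eq)) ¬2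
    where
    χ≤2 : χ ≤ 2
    χ≤2 = ≤-pred (≰⇒> 3≰χ)

-- Coding integer vectors by numbers of controlled size.

module Code where
  open import Data.Nat.Base
  open import Data.Nat.Properties
  open import Data.Nat.Solver using (module +-*-Solver)
  open import Relation.Binary.PropositionalEquality using (refl; sym; trans; cong; module ≡-Reasoning)
  open import Algebra.Properties.CommutativeMonoid.Sum +-0-commutativeMonoid public using (sum; sum-cong-≗)

  m∸n+n≡m+[n∸m] : ∀ m n → m ∸ n + n ≡ m + (n ∸ m)
  m∸n+n≡m+[n∸m] zero    zero    = refl
  m∸n+n≡m+[n∸m] zero    (suc n) = refl
  m∸n+n≡m+[n∸m] (suc m) zero    = refl
  m∸n+n≡m+[n∸m] (suc m) (suc n) = trans (+-suc _ n) (cong suc (m∸n+n≡m+[n∸m] m n))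

  ∣m-n∣≡[m∸n]+[n∸m] : ∀ m n → ∣ m - n ∣ ≡ (m ∸ n) + (n ∸ m)
  ∣m-n∣≡[m∸n]+[n∸m] zero    zero    = refl
  ∣m-n∣≡[m∸n]+[n∸m] zero    (suc n) = refl
  ∣m-n∣≡[m∸n]+[n∸m] (suc m) zero    = sym (+-identityʳ _)
  ∣m-n∣≡[m∸n]+[n∸m] (suc m) (suc n) = ∣m-n∣≡[m∸n]+[n∸m] m n

  -- In binary this is r followed by a one and a zeros, so it lengthens r by `a + 1` digits. Coding
  -- a vector coordinate by coordinate thus takes as many digits as its ℓ¹-norm, up to a term linear
  -- in d, which turns a bound on norms into an exponential bound on the number of cubes.
  pair : ℕ → ℕ → ℕ
  pair a r = 2 ^ a * suc (2 * r)

  pair-injective : ∀ a b {r s} → pair a r ≡ pair b s → a ≡ b × r ≡ s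
  pair-injective zero zero {r} {s} e = refl , *-cancelˡ-≡ r s 2 (suc-injective (begin
    suc (2 * r)      ≡⟨ *-identityˡ _ ⟨
    1 * suc (2 * r)  ≡⟨ e ⟩
    1 * suc (2 * s)  ≡⟨ *-identityˡ _ ⟩
    suc (2 * s)      ∎))
    where
    open ≡-Reasoning
  pair-injective (suc a) zero {r} {s} e = contradiction
    (trans (sym (*-assoc 2 (2 ^ a) _)) (trans e (*-identityˡ _))) (even≢odd (2 ^ a * suc (2 * r)) s)
  pair-injective zero (suc b) {r} {s} e = contradiction
    (trans (sym (*-assoc 2 (2 ^ b) _)) (trans (sym e) (*-identityˡ _))) (even≢odd (2 ^ b * suc (2 * s)) r)
  pair-injective (suc a) (suc b) {r} {s} e with pair-injective a b {r} {s}
    (*-cancelˡ-≡ _ _ 2 (trans (sym (*-assoc 2 (2 ^ a) _)) (trans e (*-assoc 2 (2 ^ b) _))))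
  ... | refl , r≡s = refl , r≡s

  pair-bound : ∀ a {r} s → r < 2 ^ s → pair a r < 2 ^ (suc a + s)
  pair-bound a {r} s r<2^s = begin-strict
    2 ^ a * suc (2 * r)      <⟨ *-monoʳ-< (2 ^ a) {{m^n≢0 2 a}} ≤-refl ⟩
    2 ^ a * suc (suc (2 * r)) ≡⟨ solve 2 (λ p r → p :* (con 2 :+ con 2 :* r) := con 2 :* p :* (con 1 :+ r)) refl (2 ^ a) r ⟩
    2 ^ suc a * suc r        ≤⟨ *-monoʳ-≤ (2 ^ suc a) r<2^s ⟩
    2 ^ suc a * 2 ^ s        ≡⟨ ^-distribˡ-+-* 2 (suc a) s ⟨
    2 ^ (suc a + s)          ∎
    where
    open ≤-Reasoning
    open +-*-Solver

  -- z relative to c, each difference being split into its positive and negative parts.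
  code : ∀ {d} → (Fin d → ℕ) → (Fin d → ℕ) → ℕ
  code {zero}  c z = 0
  code {suc d} c z = pair (z zero ∸ c zero) (pair (c zero ∸ z zero) (code (c ∘ suc) (z ∘ suc)))

  code-injective : ∀ {d} (c z w : Fin d → ℕ) → code c z ≡ code c w → z ≗ w
  code-injective {suc d} c z w e
    with e₁ , e′ ← pair-injective (z zero ∸ c zero) (w zero ∸ c zero) e
    with e₂ , e″ ← pair-injective (c zero ∸ z zero) (c zero ∸ w zero) e′
    -- The truncated differences in both directions determine `z zero`, although neither does so
    -- alone.
    = λ { zero → +-cancelʳ-≡ (c zero ∸ z zero) (z zero) (w zero) (begin
            z zero + (c zero ∸ z zero)   ≡⟨ m∸n+n≡m+[n∸m] (z zero) (c zero) ⟨
            z zero ∸ c zero + c zero     ≡⟨ cong (_+ c zero) e₁ ⟩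
            w zero ∸ c zero + c zero     ≡⟨ m∸n+n≡m+[n∸m] (w zero) (c zero) ⟩
            w zero + (c zero ∸ w zero)   ≡⟨ cong (w zero +_) e₂ ⟨
            w zero + (c zero ∸ z zero)   ∎)
        ; (suc i) → code-injective (c ∘ suc) (z ∘ suc) (w ∘ suc) e″ i }
    where
    open ≡-Reasoning

  code-cong : ∀ {d} (c : Fin d → ℕ) {z w : Fin d → ℕ} → z ≗ w → code c z ≡ code c w
  code-cong {zero}  c z≗w = refl
  code-cong {suc d} c {w = w} z≗w rewrite z≗w zero =
    cong (λ r → pair (w zero ∸ c zero) (pair (c zero ∸ w zero) r)) (code-cong (c ∘ suc) (z≗w ∘ suc))

  -- Each coordinate passes through two `pair`s, and the marker digit of each accounts for the
  -- summand `2 * d`.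
  code-bound : ∀ {d} (c z : Fin d → ℕ) → code c z < 2 ^ (sum (λ i → ∣ z i - c i ∣) + 2 * d)
  code-bound {zero} c z = ≤-refl
  code-bound {suc d} c z = <-≤-trans
    (pair-bound a (suc b + t) (pair-bound b t (code-bound (c ∘ suc) (z ∘ suc))))
    (≤-reflexive (cong (2 ^_) (begin
      suc a + (suc b + (s + 2 * d))        ≡⟨ solve 4 (λ a b s d → con 1 :+ a :+ (con 1 :+ b :+ (s :+ con 2 :* d)) := a :+ b :+ s :+ con 2 :* (con 1 :+ d)) refl a b s d ⟩
      a + b + s + 2 * suc d                ≡⟨ cong (λ x → x + s + 2 * suc d) (∣m-n∣≡[m∸n]+[n∸m] (z zero) (c zero)) ⟨
      ∣ z zero - c zero ∣ + s + 2 * suc d  ∎)))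
    where
    open ≡-Reasoning
    open +-*-Solver
    a b s t : ℕ
    a = z zero ∸ c zero
    b = c zero ∸ z zero
    s = sum (λ i → ∣ z (suc i) - c (suc i) ∣)
    t = s + 2 * d

  -- An integer substitute for √d. Strictly above √d, it makes a cube of side a / k have diameter
  -- strictly below a; at most 2 √d, it keeps the number of nearby cubes exponential in d.
  squareBetween : ∀ d → 1 ≤ d → ∃[ k ] (d < k * k × k * k ≤ 4 * d)
  squareBetween (suc zero) _ = 2 , s≤s (s≤s z≤n) , ≤-refl
  squareBetween (suc (suc d)) _ with squareBetween (suc d) (s≤s z≤n)
  ... | suc k , lt , le with m≤n⇒m<n∨m≡n lt
  ...   | inj₁ lt′ = suc k , lt′ , ≤-trans le (*-monoʳ-≤ 4 (n≤1+n (suc d)))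
  -- The new dimension has reached the square exactly, so the next square is taken; it is at most
  -- four times the old one.
  ...   | inj₂ eq = suc (suc k)
        , ≤-trans (≤-reflexive (cong suc eq)) (≤-trans (m≤m+n _ (2 * k + 2)) (≤-reflexive (solve 1 (λ k → con 1 :+ (con 1 :+ k) :* (con 1 :+ k) :+ (con 2 :* k :+ con 2) := (con 2 :+ k) :* (con 2 :+ k)) refl k)))
        , ≤-trans (m≤m+n _ (3 * k * k + 4 * k)) (≤-reflexive (trans (solve 1 (λ k → (con 2 :+ k) :* (con 2 :+ k) :+ (con 3 :* k :* k :+ con 4 :* k) := con 4 :* ((con 1 :+ k) :* (con 1 :+ k))) refl k) (cong (4 *_) (sym eq))))
        where
        open +-*-Solver

  -- Any common upper bound will do, so the sum of the values is taken.
  max : ∀ {n} (f : Fin n → ℕ) → ∃[ B ] (∀ i → f i ≤ B)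
  max {zero}  f = 0 , λ ()
  max {suc n} f with max (f ∘ suc)
  ... | B , below = f zero + B , λ { zero → m≤m+n _ B ; (suc i) → ≤-trans (below i) (m≤n+m B _) }

-- Exponential inequalities with explicit constants.

module Exponential where
  open import Data.Nat.Base
  open import Data.Nat.Properties
  open import Data.Nat.Solver using (module +-*-Solver)
  open import Relation.Binary.PropositionalEquality using (refl; sym; trans; cong; cong₂)

  ^-cancelˡ-≤ : ∀ k {a b} → a ^ suc k ≤ b ^ suc k → a ≤ b
  ^-cancelˡ-≤ k {a} {b} le with a ≤? b
  ... | yes a≤b = a≤b
  ... | no a≰b  = contradiction (^-monoˡ-< (suc k) (≰⇒> a≰b)) (≤⇒≯ le)

  ^-distribʳ-* : ∀ n a b → (a * b) ^ n ≡ a ^ n * b ^ n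
  ^-distribʳ-* zero    a b = refl
  ^-distribʳ-* (suc n) a b = trans (cong (a * b *_) (^-distribʳ-* n a b))
    (solve 4 (λ a b x y → (a :* b) :* (x :* y) := (a :* x) :* (b :* y)) refl a b (a ^ n) (b ^ n))
    where
    open +-*-Solver

  ^-comm : ∀ a m n → (a ^ m) ^ n ≡ (a ^ n) ^ m
  ^-comm a m n = trans (^-*-assoc a m n) (trans (cong (a ^_) (*-comm m n)) (sym (^-*-assoc a n m)))

  -- As (Y / X)ᵈ does not decrease with d, the factor c need only be absorbed at one exponent n,
  -- where this can be checked by evaluation.
  gap-from : ∀ c X Y n {d} → c * X ^ n ≤ Y ^ n → X ≤ Y → n ≤ d → c * X ^ d ≤ Y ^ d
  gap-from c X Y n {d} base X≤Y n≤d = begin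
    c * X ^ d                  ≡⟨ cong (λ d → c * X ^ d) (m+[n∸m]≡n n≤d) ⟨
    c * X ^ (n + e)            ≡⟨ cong (c *_) (^-distribˡ-+-* X n e) ⟩
    c * (X ^ n * X ^ e)        ≡⟨ *-assoc c (X ^ n) (X ^ e) ⟨
    c * X ^ n * X ^ e          ≤⟨ *-mono-≤ base (^-monoˡ-≤ e X≤Y) ⟩
    Y ^ n * Y ^ e              ≡⟨ ^-distribˡ-+-* Y n e ⟨
    Y ^ (n + e)                ≡⟨ cong (Y ^_) (m+[n∸m]≡n n≤d) ⟩
    Y ^ d                      ∎
    where
    open ≤-Reasoning
    e = d ∸ n

  -- T is controlled only through its eighth power, so the claim is raised to that power instead of
  -- extracting a root; the factor 2 then turns into 2⁸.
  eighth-root : ∀ p q a b d T → .{{NonZero a}} → T ^ 8 * a ^ d ≤ b ^ d →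
                2 ^ 8 * (p ^ 8 * b) ^ d ≤ (q ^ 8 * a) ^ d → p ^ d * (2 * T) ≤ q ^ d
  eighth-root p q a b d T T-bound gap = ^-cancelˡ-≤ 7 (*-cancelʳ-≤ _ _ (a ^ d) {{m^n≢0 a d}} (begin
    (p ^ d * (2 * T)) ^ 8 * a ^ d            ≡⟨ cong (_* a ^ d) (trans (^-distribʳ-* 8 (p ^ d) (2 * T)) (cong₂ _*_ (^-comm p d 8) (^-distribʳ-* 8 2 T))) ⟩
    (p ^ 8) ^ d * (2 ^ 8 * T ^ 8) * a ^ d    ≡⟨ rearrange ((p ^ 8) ^ d) (2 ^ 8) (T ^ 8) (a ^ d) ⟩
    2 ^ 8 * ((p ^ 8) ^ d * (T ^ 8 * a ^ d))  ≤⟨ *-monoʳ-≤ (2 ^ 8) (*-monoʳ-≤ ((p ^ 8) ^ d) T-bound) ⟩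
    2 ^ 8 * ((p ^ 8) ^ d * b ^ d)            ≡⟨ cong (2 ^ 8 *_) (^-distribʳ-* d (p ^ 8) b) ⟨
    2 ^ 8 * (p ^ 8 * b) ^ d                  ≤⟨ gap ⟩
    (q ^ 8 * a) ^ d                          ≡⟨ ^-distribʳ-* d (q ^ 8) a ⟩
    (q ^ 8) ^ d * a ^ d                      ≡⟨ cong (_* a ^ d) (^-comm q 8 d) ⟩
    (q ^ d) ^ 8 * a ^ d                      ∎))
    where
    open ≤-Reasoning
    open +-*-Solver
    rearrange : ∀ x c t y → x * (c * t) * y ≡ c * (x * (t * y))
    rearrange = solve 4 (λ x c t y → x :* (c :* t) :* y := c :* (x :* (t :* y))) refl

  -- 6561 / 32 < (200 / 101)⁸, and from d = 40 on the gap also absorbs the factor 2⁸.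
  anticode-ratio : ∀ {d} T → 40 ≤ d → T ^ 8 * 32 ^ d ≤ 6561 ^ d → 101 ^ d * (2 * T) ≤ 200 ^ d
  anticode-ratio {d} T 40≤d T-bound = eighth-root 101 200 32 6561 d T T-bound
    (gap-from (2 ^ 8) (101 ^ 8 * 6561) (200 ^ 8 * 32) 40 (≤ᵇ⇒≤ _ _ tt) (≤ᵇ⇒≤ _ _ tt) 40≤d)

  -- χ / ω ≥ 2ᵈ / (α ω) ≥ 2ᵈ / (2 T) ≥ (101 / 100)ᵈ. Only the product α ω enters, so the same
  -- estimate serves a graph and its complement.
  ratio-bound : ∀ {d χ ω α} T → 40 ≤ d → T ^ 8 * 32 ^ d ≤ 6561 ^ d → 2 ^ d ≤ χ * α → α * ω ≤ 2 * T →
                101 ^ d * ω ≤ 100 ^ d * χ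
  ratio-bound {d} {χ} {ω} {α} T 40≤d T-bound N≤χα αω≤2T = *-cancelʳ-≤ _ _ (2 ^ d) {{m^n≢0 2 d}} (begin
    101 ^ d * ω * 2 ^ d        ≤⟨ *-monoʳ-≤ (101 ^ d * ω) N≤χα ⟩
    101 ^ d * ω * (χ * α)      ≡⟨ solve 4 (λ x ω χ α → x :* ω :* (χ :* α) := x :* (α :* ω) :* χ) refl (101 ^ d) ω χ α ⟩
    101 ^ d * (α * ω) * χ      ≤⟨ *-monoˡ-≤ χ (*-monoʳ-≤ (101 ^ d) αω≤2T) ⟩
    101 ^ d * (2 * T) * χ      ≤⟨ *-monoˡ-≤ χ (anticode-ratio T 40≤d T-bound) ⟩
    200 ^ d * χ                ≡⟨ cong (_* χ) (^-distribʳ-* d 100 2) ⟩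
    100 ^ d * 2 ^ d * χ        ≡⟨ solve 3 (λ x y χ → x :* y :* χ := x :* χ :* y) refl (100 ^ d) (2 ^ d) χ ⟩
    100 ^ d * χ * 2 ^ d        ∎)
    where
    open ≤-Reasoning
    open +-*-Solver

  -- Since (101 / 100)⁴⁰ < 3 / 2, a ratio of 3 / 2 suffices up to dimension 40. Multiplying by
  -- `100 ^ e` with d + e = 40 leaves a single numerical check.
  small-dimension : ∀ {d χ ω} → d ≤ 40 → 3 ≤ χ → ω ≤ 2 → 101 ^ d * ω ≤ 100 ^ d * χ
  small-dimension {d} {χ} {ω} d≤40 3≤χ ω≤2 = ≤-trans (*-monoʳ-≤ (101 ^ d) ω≤2)
    (≤-trans (*-cancelʳ-≤ _ _ (100 ^ e) {{m^n≢0 100 e}} scaled) (*-monoʳ-≤ (100 ^ d) 3≤χ))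
    where
    open ≤-Reasoning
    open +-*-Solver
    e = 40 ∸ d
    rearrange : ∀ x c y → x * c * y ≡ c * (x * y)
    rearrange = solve 3 (λ x c y → x :* c :* y := c :* (x :* y)) refl
    d+e≡40 : d + e ≡ 40
    d+e≡40 = m+[n∸m]≡n d≤40
    scaled : 101 ^ d * 2 * 100 ^ e ≤ 100 ^ d * 3 * 100 ^ e
    scaled = begin
      101 ^ d * 2 * 100 ^ e     ≤⟨ *-monoʳ-≤ (101 ^ d * 2) (^-monoˡ-≤ e (n≤1+n 100)) ⟩
      101 ^ d * 2 * 101 ^ e     ≡⟨ rearrange (101 ^ d) 2 (101 ^ e) ⟩
      2 * (101 ^ d * 101 ^ e)   ≡⟨ cong (2 *_) (trans (sym (^-distribˡ-+-* 101 d e)) (cong (101 ^_) d+e≡40)) ⟩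
      2 * 101 ^ 40              ≤⟨ ≤ᵇ⇒≤ (2 * 101 ^ 40) (3 * 100 ^ 40) tt ⟩
      3 * 100 ^ 40              ≡⟨ cong (3 *_) (trans (cong (100 ^_) (sym d+e≡40)) (^-distribˡ-+-* 100 d e)) ⟩
      3 * (100 ^ d * 100 ^ e)   ≡⟨ rearrange (100 ^ d) 3 (100 ^ e) ⟨
      100 ^ d * 3 * 100 ^ e     ∎

-- Graphs on integer points.

module PointGraphs where
  open import Data.Nat.Base
  open import Data.Nat.Properties
  open import Relation.Binary.PropositionalEquality using (refl; cong; cong₂; subst)
  open Code using (sum; sum-cong-≗)

  sqDist : ∀ {d} → (Fin d → ℕ) → (Fin d → ℕ) → ℕ
  sqDist p q = sum λ i → ∣ p i - q i ∣ * ∣ p i - q i ∣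

  sqDist-refl : ∀ {d} (p : Fin d → ℕ) → sqDist p p ≡ 0
  sqDist-refl {zero}  p = refl
  sqDist-refl {suc d} p = cong₂ _+_ (cong₂ _*_ (∣n-n∣≡0 (p zero)) (∣n-n∣≡0 (p zero))) (sqDist-refl (p ∘ suc))

  sqDist-sym : ∀ {d} (p q : Fin d → ℕ) → sqDist p q ≡ sqDist q p
  sqDist-sym {d} p q = sum-cong-≗ {d} λ i → cong (λ x → x * x) (∣-∣-comm (p i) (q i))

  -- Adjacency has to be Bool-valued. Testing squared distances of integer points makes it
  -- computable; real coordinates appear only when the points are scaled in `Realisation`.
  pointGraph : ∀ {n d} (p : Fin n → Fin d → ℕ) (test : ℕ → Bool) → ¬ T (test 0) → FiniteSimpleGraph
  pointGraph {n} p test ¬test0 = record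
    { order       = n
    ; adjacent    = λ u v → test (sqDist (p u) (p v))
    ; symmetric   = λ u v → cong test (sqDist-sym (p u) (p v))
    ; irreflexive = λ v → ¬test0 ∘ subst (T ∘ test) (sqDist-refl (p v))
    }

  -- Doubling by n + n, so that splitAt halves Fin (2^′ suc d).

module Hypercube where
  open import Data.Nat.Base
  open import Data.Nat.Properties
  open import Data.Nat.Solver using (module +-*-Solver)
  open import Data.Vec.Functional using (_∷_)
  open import Relation.Binary.PropositionalEquality using (refl; sym; trans; cong; cong₂; subst; subst₂)
  open Exponential
  open PointGraphs

  2^′_ : ℕ → ℕ
  2^′ zero  = 1
  2^′ suc d = 2^′ d + 2^′ d

  word : ∀ d → Fin (2^′ d) → Fin d → ℕ
  word (suc d) u = [ (λ u → 0 ∷ word d u) , (λ u → 1 ∷ word d u) ]′ (splitAt (2^′ d) u)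

  2^′≡2^ : ∀ d → 2^′ d ≡ 2 ^ d
  2^′≡2^ zero    = refl
  2^′≡2^ (suc d) = cong₂ _+_ (2^′≡2^ d) (trans (2^′≡2^ d) (sym (+-identityʳ _)))

  -- For 0/1 words the squared Euclidean distance is the Hamming distance, so one number serves both
  -- the combinatorics and the embedding.
  hamming : ∀ {d} → Fin (2^′ d) → Fin (2^′ d) → ℕ
  hamming {d} u v = sqDist (word d u) (word d v)

  hamming≤d : ∀ d (u v : Fin (2^′ d)) → hamming {d} u v ≤ d
  hamming≤d zero u v = z≤n
  hamming≤d (suc d) u v with splitAt (2^′ d) u | splitAt (2^′ d) v
  ... | inj₁ u′ | inj₁ v′ = m≤n⇒m≤1+n (hamming≤d d u′ v′)
  ... | inj₁ u′ | inj₂ v′ = s≤s (hamming≤d d u′ v′)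
  ... | inj₂ u′ | inj₁ v′ = s≤s (hamming≤d d u′ v′)
  ... | inj₂ u′ | inj₂ v′ = m≤n⇒m≤1+n (hamming≤d d u′ v′)

  hamming-pos : ∀ d (u v : Fin (2^′ d)) → u ≢ v → 0 < hamming {d} u v
  hamming-pos zero zero zero u≢v = ⊥-elim (u≢v refl)
  hamming-pos (suc d) u v u≢v with splitAt (2^′ d) u in eu | splitAt (2^′ d) v in ev
  ... | inj₁ u′ | inj₁ v′ = hamming-pos d u′ v′ λ { refl → u≢v
        (trans (sym (Fin.splitAt⁻¹-↑ˡ eu)) (Fin.splitAt⁻¹-↑ˡ ev)) }
  ... | inj₁ u′ | inj₂ v′ = s≤s z≤n
  ... | inj₂ u′ | inj₁ v′ = s≤s z≤n
  ... | inj₂ u′ | inj₂ v′ = hamming-pos d u′ v′ λ { refl → u≢v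
        (trans (sym (Fin.splitAt⁻¹-↑ʳ {m = 2^′ d} eu)) (Fin.splitAt⁻¹-↑ʳ {m = 2^′ d} ev)) }

  -- Among three bits, either none or exactly two of the three pairs differ, so each coordinate
  -- contributes at most 2.
  three-words : ∀ d (u v w : Fin (2^′ d)) → hamming {d} u v + hamming {d} u w + hamming {d} v w ≤ 2 * d
  three-words zero u v w = z≤n
  three-words (suc d) u v w with splitAt (2^′ d) u | splitAt (2^′ d) v | splitAt (2^′ d) w
  ... | x | y | z = bound x y z
    where
    open +-*-Solver
    h : Fin (2^′ d) → Fin (2^′ d) → ℕ
    h = hamming {d}
    H : Fin (2^′ d) ⊎ Fin (2^′ d) → Fin (2^′ d) ⊎ Fin (2^′ d) → ℕ
    H x y = sqDist ([ (λ u → 0 ∷ word d u) , (λ u → 1 ∷ word d u) ]′ x) ([ (λ u → 0 ∷ word d u) , (λ u → 1 ∷ word d u) ]′ y)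
    weaken : ∀ {a b c} → a + b + c ≤ 2 * d → a + b + c ≤ 2 * suc d
    weaken le = ≤-trans le (*-monoʳ-≤ 2 (n≤1+n d))
    step : ∀ {n m} → n ≤ 2 * d → m ≡ 2 + n → m ≤ 2 * suc d
    step le refl = ≤-trans (+-monoʳ-≤ 2 le) (≤-reflexive (sym (*-suc 2 d)))
    apart₁ : ∀ a b c → suc a + suc b + c ≡ 2 + (a + b + c)
    apart₁ = solve 3 (λ a b c → (con 1 :+ a) :+ (con 1 :+ b) :+ c := con 2 :+ (a :+ b :+ c)) refl
    apart₂ : ∀ a b c → suc a + b + suc c ≡ 2 + (a + b + c)
    apart₂ = solve 3 (λ a b c → (con 1 :+ a) :+ b :+ (con 1 :+ c) := con 2 :+ (a :+ b :+ c)) refl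
    apart₃ : ∀ a b c → a + suc b + suc c ≡ 2 + (a + b + c)
    apart₃ = solve 3 (λ a b c → a :+ (con 1 :+ b) :+ (con 1 :+ c) := con 2 :+ (a :+ b :+ c)) refl
    bound : ∀ x y z → H x y + H x z + H y z ≤ 2 * suc d
    bound (inj₁ u) (inj₁ v) (inj₁ w) = weaken {h u v} (three-words d u v w)
    bound (inj₂ u) (inj₂ v) (inj₂ w) = weaken {h u v} (three-words d u v w)
    bound (inj₁ u) (inj₁ v) (inj₂ w) = step (three-words d u v w) (apart₃ (h u v) (h u w) (h v w))
    bound (inj₂ u) (inj₂ v) (inj₁ w) = step (three-words d u v w) (apart₃ (h u v) (h u w) (h v w))
    bound (inj₁ u) (inj₂ v) (inj₁ w) = step (three-words d u v w) (apart₂ (h u v) (h u w) (h v w))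
    bound (inj₂ u) (inj₁ v) (inj₂ w) = step (three-words d u v w) (apart₂ (h u v) (h u w) (h v w))
    bound (inj₁ u) (inj₂ v) (inj₂ w) = step (three-words d u v w) (apart₁ (h u v) (h u w) (h v w))
    bound (inj₂ u) (inj₁ v) (inj₁ w) = step (three-words d u v w) (apart₁ (h u v) (h u w) (h v w))

  -- p and q with p q ≤ Q² and p , q ≤ 2 Q have the largest sum at (2 Q , Q / 2): (2Q - p)(2Q - q) ≥ 0.
  product-bound : ∀ p q Q → .{{NonZero Q}} → p ≤ 2 * Q → q ≤ 2 * Q → p * q ≤ Q * Q → 2 * (p + q) ≤ 5 * Q
  product-bound p q Q p≤ q≤ pq≤ = *-cancelˡ-≤ Q (begin
    Q * (2 * (p + q))                          ≡⟨ solve 3 (λ p q Q → Q :* (con 2 :* (p :+ q)) := (con 2 :* Q) :* p :+ (con 2 :* Q) :* q) refl p q Q ⟩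
    (2 * Q) * p + (2 * Q) * q                  ≡⟨ cong₂ (λ x y → x * p + y * q) (sym q+q′) (sym p+p′) ⟩
    (q + q′) * p + (p + p′) * q                ≤⟨ m≤m+n _ (p′ * q′) ⟩
    (q + q′) * p + (p + p′) * q + p′ * q′      ≡⟨ solve 4 (λ p p′ q q′ → (q :+ q′) :* p :+ (p :+ p′) :* q :+ p′ :* q′ := p :* q :+ (p :+ p′) :* (q :+ q′)) refl p p′ q q′ ⟩
    p * q + (p + p′) * (q + q′)                ≡⟨ cong₂ (λ x y → p * q + x * y) p+p′ q+q′ ⟩
    p * q + (2 * Q) * (2 * Q)                  ≤⟨ +-monoˡ-≤ _ pq≤ ⟩
    Q * Q + (2 * Q) * (2 * Q)                  ≡⟨ solve 1 (λ Q → Q :* Q :+ (con 2 :* Q) :* (con 2 :* Q) := Q :* (con 5 :* Q)) refl Q ⟩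
    Q * (5 * Q) ∎)
    where
    open ≤-Reasoning
    open +-*-Solver
    p′ = 2 * Q ∸ p
    q′ = 2 * Q ∸ q
    p+p′ : p + p′ ≡ 2 * Q
    p+p′ = m+[n∸m]≡n p≤
    q+q′ : q + q′ ≡ 2 * Q
    q+q′ = m+[n∸m]≡n q≤

  -- The origin of the base 9. Of the four products in the expansion, the two within halves
  -- contribute 5 Q by `product-bound` and the two across halves 2 (Q + Q), the factor 2 in `2 * w`
  -- being included.
  two-set-step : ∀ a₀ a₁ b₀ b₁ w Q → .{{NonZero Q}} →
    a₀ * b₀ * w ≤ 2 * Q → a₁ * b₁ * w ≤ 2 * Q → a₀ * b₁ * w ≤ Q → a₁ * b₀ * w ≤ Q →
    (a₀ + a₁) * (b₀ + b₁) * (2 * w) ≤ 9 * Q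
  two-set-step a₀ a₁ b₀ b₁ w Q p≤ q≤ r≤ s≤ = begin
    (a₀ + a₁) * (b₀ + b₁) * (2 * w)
      ≡⟨ solve 5 (λ a₀ a₁ b₀ b₁ w → (a₀ :+ a₁) :* (b₀ :+ b₁) :* (con 2 :* w) :=
           con 2 :* (a₀ :* b₀ :* w :+ a₁ :* b₁ :* w) :+ con 2 :* (a₀ :* b₁ :* w :+ a₁ :* b₀ :* w)) refl a₀ a₁ b₀ b₁ w ⟩
    2 * (a₀ * b₀ * w + a₁ * b₁ * w) + 2 * (a₀ * b₁ * w + a₁ * b₀ * w)
      ≤⟨ +-mono-≤ (product-bound (a₀ * b₀ * w) (a₁ * b₁ * w) Q p≤ q≤ pq≤) (*-monoʳ-≤ 2 (+-mono-≤ r≤ s≤)) ⟩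
    5 * Q + 2 * (Q + Q)
      ≡⟨ solve 1 (λ Q → con 5 :* Q :+ con 2 :* (Q :+ Q) := con 9 :* Q) refl Q ⟩
    9 * Q ∎
    where
    open ≤-Reasoning
    open +-*-Solver
    pq≤ : (a₀ * b₀ * w) * (a₁ * b₁ * w) ≤ Q * Q
    pq≤ = begin
      (a₀ * b₀ * w) * (a₁ * b₁ * w) ≡⟨ solve 5 (λ a₀ a₁ b₀ b₁ w → (a₀ :* b₀ :* w) :* (a₁ :* b₁ :* w) := (a₀ :* b₁ :* w) :* (a₁ :* b₀ :* w)) refl a₀ a₁ b₀ b₁ w ⟩
      (a₀ * b₁ * w) * (a₁ * b₀ * w) ≤⟨ *-mono-≤ r≤ s≤ ⟩
      Q * Q ∎

  -- D is d / 4 rounded up. Rounding up keeps the exponent D + d at least 5 d / 4, and an excess of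
  -- at most 3 quarters is still absorbed by integrality when 4 h < 3 d is turned into D + h ≤ d.
  quarter : ∀ d → ∃[ D ] (d ≤ 4 * D × 4 * D ≤ 3 + d)
  quarter 0 = 0 , z≤n , z≤n
  quarter 1 = 1 , s≤s z≤n , ≤-refl
  quarter 2 = 1 , s≤s (s≤s z≤n) , n≤1+n _
  quarter 3 = 1 , s≤s (s≤s (s≤s z≤n)) , m≤n+m 4 2
  quarter (suc (suc (suc (suc d)))) with D , le , ge ← quarter d =
    suc D , subst (4 + d ≤_) (sym (*-suc 4 D)) (+-monoʳ-≤ 4 le) , subst (_≤ 7 + d) (sym (*-suc 4 D)) (+-monoʳ-≤ 4 ge)

  module Cube (em : ExcludedMiddle 0ℓ) where
    open Counting em
    open Graphs em

    opaque
      unfolding #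

      #-split : ∀ m {n} (P : Fin (m + n) → Set) → # P ≡ # (λ u → P (u ↑ˡ n)) + # (λ u → P (m ↑ʳ u))
      #-split zero    P = refl
      #-split (suc m) P = trans (cong (bit (P zero) +_) (#-split m (P ∘ suc))) (sym (+-assoc (bit (P zero)) _ _))

    -- The two halves of the cube contribute four products a₀ b₀ , a₁ b₁ , a₀ b₁ , a₁ b₀ with
    -- (a₀ b₀) (a₁ b₁) = (a₀ b₁) (a₁ b₀), which caps the sum of the first two.
    two-sets : ∀ d D (A B : Fin (2^′ d) → Set) → (∀ u v → A u → B v → D + hamming {d} u v ≤ d) →
               # A * # B * 2 ^ (D + d) ≤ 9 ^ d
    two-sets zero zero A B _ = ≤-trans (≤-reflexive (*-identityʳ (# A * # B)))
      (*-mono-≤ (#-unique {P = A} λ { zero zero _ _ → refl }) (#-unique {P = B} λ { zero zero _ _ → refl }))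
    two-sets zero (suc D) A B agree with em {∃[ u ] A u}
    ... | yes (u , a) = subst (λ b → # A * b * 2 ^ suc (D + 0) ≤ 1) (sym (#-∅ λ v b → n≮0 (agree u v a b)))
                          (subst (λ x → x * 2 ^ suc (D + 0) ≤ 1) (sym (*-zeroʳ (# A))) z≤n)
    ... | no ¬A = subst (λ a → a * # B * 2 ^ suc (D + 0) ≤ 1) (sym (#-∅ λ u a → ¬A (u , a))) z≤n
    two-sets (suc d) D A B agree = begin
      # A * # B * 2 ^ (D + suc d)
        ≡⟨ cong₂ (λ x y → x * y * 2 ^ (D + suc d)) (#-split (2^′ d) A) (#-split (2^′ d) B) ⟩
      (# A₀ + # A₁) * (# B₀ + # B₁) * 2 ^ (D + suc d)
        ≡⟨ cong (λ x → (# A₀ + # A₁) * (# B₀ + # B₁) * 2 ^ x) (+-suc D d) ⟩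
      (# A₀ + # A₁) * (# B₀ + # B₁) * (2 * 2 ^ (D + d))
        ≤⟨ two-set-step (# A₀) (# A₁) (# B₀) (# B₁) (2 ^ (D + d)) (9 ^ d) {{m^n≢0 9 d}}
             -- Within a half, the dimension drops by one and the distance does not, so D drops by
             -- one at the cost of a factor 2. Across the halves the differing first letter pays for
             -- the drop in dimension, and D is kept.
             (same A₀ B₀ λ u v a b → ∸1 (subst₂ (λ x y → D + sqDist x y ≤ suc d) (word-↑ˡ u) (word-↑ˡ v) (agree _ _ a b)) (hamming≤d d u v))
             (same A₁ B₁ λ u v a b → ∸1 (subst₂ (λ x y → D + sqDist x y ≤ suc d) (word-↑ʳ u) (word-↑ʳ v) (agree _ _ a b)) (hamming≤d d u v))
             (two-sets d D A₀ B₁ λ u v a b → cross (subst₂ (λ x y → D + sqDist x y ≤ suc d) (word-↑ˡ u) (word-↑ʳ v) (agree _ _ a b)))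
             (two-sets d D A₁ B₀ λ u v a b → cross (subst₂ (λ x y → D + sqDist x y ≤ suc d) (word-↑ʳ u) (word-↑ˡ v) (agree _ _ a b))) ⟩
      9 ^ suc d ∎
      where
      open ≤-Reasoning
      A₀ A₁ B₀ B₁ : Fin (2^′ d) → Set
      A₀ u = A (u ↑ˡ 2^′ d)
      A₁ u = A (2^′ d ↑ʳ u)
      B₀ u = B (u ↑ˡ 2^′ d)
      B₁ u = B (2^′ d ↑ʳ u)
      word-↑ˡ : ∀ u → word (suc d) (u ↑ˡ 2^′ d) ≡ 0 ∷ word d u
      word-↑ˡ u rewrite Fin.splitAt-↑ˡ (2^′ d) u (2^′ d) = refl
      word-↑ʳ : ∀ u → word (suc d) (2^′ d ↑ʳ u) ≡ 1 ∷ word d u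
      word-↑ʳ u rewrite Fin.splitAt-↑ʳ (2^′ d) (2^′ d) u = refl
      cross : ∀ {h} → D + suc h ≤ suc d → D + h ≤ d
      cross {h} le = ≤-pred (subst (_≤ suc d) (+-suc D h) le)
      -- At D = 0 the truncation leaves D unchanged, and the condition holds because no distance
      -- exceeds d.
      ∸1 : ∀ {D h} → D + h ≤ suc d → h ≤ d → D ∸ 1 + h ≤ d
      ∸1 {zero}  le h≤d = h≤d
      ∸1 {suc D} le h≤d = ≤-pred le
      double : ∀ D → 2 ^ (D + d) ≤ 2 * 2 ^ (D ∸ 1 + d)
      double zero    = m≤n*m _ 2
      double (suc D) = ≤-refl
      same : ∀ (A B : Fin (2^′ d) → Set) → (∀ u v → A u → B v → D ∸ 1 + hamming {d} u v ≤ d) →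
             # A * # B * 2 ^ (D + d) ≤ 2 * 9 ^ d
      same A B agree′ = begin
        # A * # B * 2 ^ (D + d)             ≤⟨ *-monoʳ-≤ (# A * # B) (double D) ⟩
        # A * # B * (2 * 2 ^ (D ∸ 1 + d))   ≡⟨ solve 2 (λ x y → x :* (con 2 :* y) := con 2 :* (x :* y)) refl (# A * # B) (2 ^ (D ∸ 1 + d)) ⟩
        2 * (# A * # B * 2 ^ (D ∸ 1 + d))   ≤⟨ *-monoʳ-≤ 2 (two-sets d (D ∸ 1) A B agree′) ⟩
        2 * 9 ^ d                           ∎
        where
        open +-*-Solver

    -- Words of P agree in more than a quarter of the coordinates, so `two-sets` applied to P twice
    -- bounds t² 2^(5d/4) by 9ᵈ. The fourth power clears the fraction: 32 = 2⁵ and 6561 = 9⁴.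
    anticode-bound : ∀ d (P : Fin (2^′ d) → Set) → (∀ u v → P u → P v → 4 * hamming {d} u v < 3 * d) →
                     # P ^ 8 * 32 ^ d ≤ 6561 ^ d
    anticode-bound d P near with D , d≤4D , 4D≤3+d ← quarter d = begin
      t ^ 8 * 32 ^ d                    ≡⟨ cong (t ^ 8 *_) (^-*-assoc 2 5 d) ⟩
      t ^ 8 * 2 ^ (5 * d)               ≤⟨ *-monoʳ-≤ (t ^ 8) (^-monoʳ-≤ 2 5d≤) ⟩
      t ^ 8 * 2 ^ ((D + d) * 4)         ≡⟨ cong (t ^ 8 *_) (^-*-assoc 2 (D + d) 4) ⟨
      t ^ 8 * (2 ^ (D + d)) ^ 4         ≡⟨ solve 2 (λ t x → t :^ 8 :* x :^ 4 := (t :* t :* x) :^ 4) refl t (2 ^ (D + d)) ⟩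
      (t * t * 2 ^ (D + d)) ^ 4         ≤⟨ ^-monoˡ-≤ 4 (two-sets d D P P λ u v p q → ≤-pred (*-cancelˡ-< 4 _ _ (agree u v p q))) ⟩
      (9 ^ d) ^ 4                       ≡⟨ ^-*-assoc 9 d 4 ⟩
      9 ^ (d * 4)                       ≡⟨ cong (9 ^_) (*-comm d 4) ⟩
      9 ^ (4 * d)                       ≡⟨ ^-*-assoc 9 4 d ⟨
      6561 ^ d                          ∎
      where
      open ≤-Reasoning
      open +-*-Solver
      t = # P
      5d≤ : 5 * d ≤ (D + d) * 4
      5d≤ = ≤-trans (+-monoˡ-≤ (4 * d) d≤4D) (≤-reflexive (solve 2 (λ D d → con 4 :* D :+ con 4 :* d := (D :+ d) :* con 4) refl D d))
      agree : ∀ u v → P u → P v → 4 * (D + hamming {d} u v) < 4 * suc d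
      agree u v p q = begin-strict
        4 * (D + hamming {d} u v)        ≡⟨ *-distribˡ-+ 4 D _ ⟩
        4 * D + 4 * hamming {d} u v      <⟨ +-mono-≤-< 4D≤3+d (near u v p q) ⟩
        3 + d + 3 * d                    ≤⟨ n≤1+n _ ⟩
        1 + (3 + d + 3 * d)              ≡⟨ solve 1 (λ d → con 1 :+ (con 3 :+ d :+ con 3 :* d) := con 4 :* (con 1 :+ d)) refl d ⟩
        4 * suc d                        ∎

    -- The tests are complementary except at s = 0, where `0 <ᵇ s` excludes loops.
    annulusTest discTest : ℕ → ℕ → Bool
    annulusTest d s = 3 * d ≤ᵇ 4 * s
    discTest d s = (0 <ᵇ s) ∧ (4 * s <ᵇ 3 * d)

    annulusCube : ∀ d → 1 ≤ d → FiniteSimpleGraph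
    annulusCube d 1≤d = pointGraph (word d) (annulusTest d) λ t → <⇒≱ (*-monoʳ-≤ 3 1≤d) (≤-trans (≤ᵇ⇒≤ (3 * d) 0 t) z≤n)

    discCube : ℕ → FiniteSimpleGraph
    discCube d = pointGraph (word d) (discTest d) id

    open FiniteSimpleGraph

    module _ {d} (1≤d : 1 ≤ d) where
      private
        A = annulusCube d 1≤d
        B = discCube d

      annulus-far : ∀ u v → Edge A u v → 3 * d ≤ 4 * hamming {d} u v
      annulus-far u v = ≤ᵇ⇒≤ (3 * d) (4 * hamming {d} u v)

      -- The distances along a triangle would add up to at least 9 d / 4, more than the 2 d that
      -- `three-words` allows.
      annulusCube-triangleFree : ∀ u v w → Edge A u v → Edge A u w → Edge A v w → ⊥
      annulusCube-triangleFree u v w uv uw vw = <⇒≱ (*-monoˡ-< d {{>-nonZero 1≤d}} {8} {9} ≤-refl) (begin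
        9 * d                                                   ≡⟨ solve 1 (λ d → con 9 :* d := con 3 :* d :+ con 3 :* d :+ con 3 :* d) refl d ⟩
        3 * d + 3 * d + 3 * d                                   ≤⟨ +-mono-≤ (+-mono-≤ (annulus-far u v uv) (annulus-far u w uw)) (annulus-far v w vw) ⟩
        4 * h u v + 4 * h u w + 4 * h v w                       ≡⟨ solve 3 (λ a b c → con 4 :* a :+ con 4 :* b :+ con 4 :* c := con 4 :* (a :+ b :+ c)) refl (h u v) (h u w) (h v w) ⟩
        4 * (h u v + h u w + h v w)                             ≤⟨ *-monoʳ-≤ 4 (three-words d u v w) ⟩
        4 * (2 * d)                                             ≡⟨ *-assoc 4 2 d ⟨
        8 * d                                                   ∎)
        where
        open ≤-Reasoning
        open +-*-Solver
        h : Fin (2^′ d) → Fin (2^′ d) → ℕ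
        h = hamming {d}

      complementary : ∀ u v → u ≢ v → Edge A u v ⊎ Edge B u v
      complementary u v u≢v with 3 * d ≤? 4 * hamming {d} u v
      ... | yes le = inj₁ (≤⇒≤ᵇ le)
      ... | no nle with hamming {d} u v | hamming-pos d u v u≢v
      ...   | suc h | _ = inj₂ (<⇒<ᵇ (≰⇒> nle))

      disc-near : ∀ u v → Edge B u v → 4 * hamming {d} u v < 3 * d
      disc-near u v e with hamming {d} u v
      ... | suc h = <ᵇ⇒< _ _ e

      discCube-ω : ∀ {ω} → IsCliqueNumber B ω → ω ^ 8 * 32 ^ d ≤ 6561 ^ d
      discCube-ω {ω} ((S , clique , refl) , _) =
        subst (λ ω → ω ^ 8 * 32 ^ d ≤ 6561 ^ d) (sym (#-subset S)) (anticode-bound d _ near)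
        where
        near : ∀ u v → _ → _ → 4 * hamming {d} u v < 3 * d
        near u v u∈ v∈ with u Fin.≟ v
        ... | yes refl = subst (λ h → 4 * h < 3 * d) (sym (sqDist-refl (word d u))) (≤-trans (s≤s z≤n) (*-monoʳ-≤ 3 1≤d))
        ... | no u≢v   = disc-near u v (clique u v u∈ v∈ u≢v)

      -- Independent sets are cliques of `discCube`, whose clique number T therefore serves as α,
      -- against ω ≤ 2.
      annulusCube-ratio : 40 ≤ d → ∀ {χ ω} → Colorable A χ → IsCliqueNumber A ω → 101 ^ d * ω ≤ 100 ^ d * χ
      annulusCube-ratio 40≤d {χ} {ω} colour isω with T , isT ← cliqueNumber B =
        ratio-bound {d} {χ} {ω} {T} T 40≤d (discCube-ω isT)
          (subst (_≤ χ * T) (2^′≡2^ d) (independent-bound A colour λ P indep → clique≤ω B isT P λ u v p q u≢v →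
            [ (λ a → contradiction a (indep u v p q)) , id ]′ (complementary u v u≢v)))
          (≤-trans (*-monoʳ-≤ T (ω≤2 A isω annulusCube-triangleFree)) (≤-reflexive (*-comm T 2)))

      -- The roles are exchanged: an independent triple would be a triangle of `annulusCube`, so α =
      -- 2, and ω itself is the T of the estimate.
      discCube-ratio : 40 ≤ d → ∀ {χ ω} → Colorable B χ → IsCliqueNumber B ω → 101 ^ d * ω ≤ 100 ^ d * χ
      discCube-ratio 40≤d {χ} {ω} colour isω =
        ratio-bound {d} {χ} {ω} {2} ω 40≤d (discCube-ω isω)
          (subst (_≤ χ * 2) (2^′≡2^ d) (independent-bound B colour λ P indep → #≤2 λ u v w p q r u≢v u≢w v≢w →
            annulusCube-triangleFree u v w (edge P indep p q u≢v) (edge P indep p r u≢w) (edge P indep q r v≢w)))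
          ≤-refl
        where
        edge : ∀ P → (∀ u v → P u → P v → ¬ Edge B u v) → ∀ {u v} → P u → P v → u ≢ v → Edge A u v
        edge P indep p q u≢v = [ id , (λ b → contradiction b (indep _ _ p q)) ]′ (complementary _ _ u≢v)

-- Triangle-free graphs with odd cycles, in the plane and on the line.

module OddCycles where
  open import Data.Nat.Base
  open import Data.Nat.Properties
  open import Data.Nat.Solver using (module +-*-Solver)
  open import Relation.Binary.PropositionalEquality using (refl; sym; trans; cong; cong₂; subst; ≢-sym)
  open FiniteSimpleGraph
  open PointGraphs

  bicoloured : {a b c : Fin 2} → a ≢ b → b ≢ c → a ≡ c
  bicoloured {0F} {0F} a≢b b≢c = ⊥-elim (a≢b refl)
  bicoloured {0F} {1F} {0F} a≢b b≢c = refl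
  bicoloured {0F} {1F} {1F} a≢b b≢c = ⊥-elim (b≢c refl)
  bicoloured {1F} {0F} {0F} a≢b b≢c = ⊥-elim (b≢c refl)
  bicoloured {1F} {0F} {1F} a≢b b≢c = refl
  bicoloured {1F} {1F} a≢b b≢c = ⊥-elim (a≢b refl)

  C₅ : FiniteSimpleGraph
  C₅ = record
    { order       = 5
    ; adjacent    = λ u v → cyclic ∣ toℕ u - toℕ v ∣
    ; symmetric   = λ u v → cong cyclic (∣-∣-comm (toℕ u) (toℕ v))
    ; irreflexive = λ v → subst (T ∘ cyclic) (∣n-n∣≡0 (toℕ v))
    }
    where
    cyclic : ℕ → Bool
    cyclic n = (n ≡ᵇ 1) ∨ (n ≡ᵇ 4)

  C₅-triangleFree : ∀ u v w → Edge C₅ u v → Edge C₅ u w → Edge C₅ v w → ⊥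
  C₅-triangleFree u v w uv uw vw = toWitness
    {a? = Fin.all? λ u → Fin.all? λ v → Fin.all? λ w → ¬? (edge? u v ×-dec edge? u w ×-dec edge? v w)} tt u v w (uv , uw , vw)
    where
    edge? : ∀ u v → Dec (Edge C₅ u v)
    edge? u v = T? (adjacent C₅ u v)

  -- With two colours, vertices two steps apart agree: 0, 2 and 4 share a colour, yet 4 and 0 are
  -- adjacent.
  C₅-¬2-colorable : ¬ Colorable C₅ 2
  C₅-¬2-colorable (c , proper) = proper 4F 0F tt (trans
    (sym (bicoloured (proper 2F 3F tt) (proper 3F 4F tt)))
    (sym (bicoloured (proper 0F 1F tt) (proper 1F 2F tt))))

  next : Fin 5 → Fin 5
  next 0F = 1F
  next 1F = 2F
  next 2F = 3F
  next 3F = 4F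
  next 4F = 0F

  next-edge : ∀ u → Edge C₅ u (next u)
  next-edge = toWitness {a? = Fin.all? λ u → T? (adjacent C₅ u (next u))} tt

  next²-¬edge : ∀ u → ¬ Edge C₅ u (next (next u))
  next²-¬edge = toWitness {a? = Fin.all? λ u → ¬? (T? (adjacent C₅ u (next (next u))))} tt

  -- Any two vertices form a side or a diagonal of the pentagon, so a symmetric relation need only
  -- be checked on five sides and five diagonals.
  C₅-pairs : ∀ (Q : Fin 5 → Fin 5 → Set) → (∀ u v → Q u v → Q v u) →
             (∀ u → Q u (next u)) → (∀ u → Q u (next (next u))) → ∀ u v → u ≢ v → Q u v
  C₅-pairs Q Q-sym near far u v u≢v with toWitness {a? = Fin.all? λ u → Fin.all? λ v →
      u Fin.≟ v ⊎-dec (v Fin.≟ next u ⊎-dec u Fin.≟ next v ⊎-dec v Fin.≟ next (next u) ⊎-dec u Fin.≟ next (next v))} tt u v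
  ... | inj₁ u≡v                             = contradiction u≡v u≢v
  ... | inj₂ (inj₁ refl)                     = near u
  ... | inj₂ (inj₂ (inj₁ refl))              = Q-sym v u (near v)
  ... | inj₂ (inj₂ (inj₂ (inj₁ refl)))       = far u
  ... | inj₂ (inj₂ (inj₂ (inj₂ refl)))       = Q-sym v u (far v)

  C₅-edges : (Q : Fin 5 → Fin 5 → Set) → (∀ u v → Q u v → Q v u) →
             (∀ u → Q u (next u)) → (∀ u → ¬ Q u (next (next u))) → ∀ u v → u ≢ v → Edge C₅ u v ⇔ Q u v
  C₅-edges Q Q-sym near far = C₅-pairs (λ u v → Edge C₅ u v ⇔ Q u v)
    (λ u v uv → mk⇔ (Q-sym u v ∘ Equivalence.to uv ∘ edge-sym v u) (edge-sym u v ∘ Equivalence.from uv ∘ Q-sym v u))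
    (λ u → mk⇔ (λ _ → near u) (λ _ → next-edge u))
    (λ u → mk⇔ (⊥-elim ∘ next²-¬edge u) (⊥-elim ∘ far u))
    where
    edge-sym : ∀ u v → Edge C₅ u v → Edge C₅ v u
    edge-sym u v = subst T (symmetric C₅ u v)

  -- On the scale 1 / 5 the sides are shorter than 1 and the diagonals between 1 and 6 / 5.
  pentagon : Fin 5 → Fin 2 → ℕ
  pentagon 0F = λ { 0F → 3 ; 1F → 5 }
  pentagon 1F = λ { 0F → 6 ; 1F → 3 }
  pentagon 2F = λ { 0F → 5 ; 1F → 0 }
  pentagon 3F = λ { 0F → 1 ; 1F → 0 }
  pentagon 4F = λ { 0F → 0 ; 1F → 3 }

  square-cancel-≤ : ∀ {a b} → a * a ≤ b * b → a ≤ b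
  square-cancel-≤ {a} {b} le with a ≤? b
  ... | yes a≤b = a≤b
  ... | no a≰b  = contradiction (*-mono-< (≰⇒> a≰b) (≰⇒> a≰b)) (≤⇒≯ le)

  distance-+ : ∀ {m n e} → m ≡ n + e → ∣ n - m ∣ ≡ e
  distance-+ {n = n} {e} refl = ∣m-m+n∣≡n n e

  distance-+′ : ∀ {m n e} → m ≡ n + e → ∣ m - n ∣ ≡ e
  distance-+′ {m} {n} m≡n+e = trans (∣-∣-comm m n) (distance-+ m≡n+e)

  linePoint : ∀ {n} → (Fin n → ℕ) → Fin n → Fin 1 → ℕ
  linePoint p u _ = p u

  -- The points 0, ..., 2k on the scale 1 / k, with N the integer part of x k. `k<N` makes steps of
  -- both k and k + 1 available; `N<2k` excludes triangles, since the longest of three distances is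
  -- the sum of the other two and so at least 2k.
  module Line (k N : ℕ) (1≤k : 1 ≤ k) (k<N : k < N) (N<2k : N < k + k) where

    lineTest : ℕ → Bool
    lineTest s = (k * k ≤ᵇ s) ∧ (s ≤ᵇ N * N)

    lineTest-0 : ¬ T (lineTest 0)
    lineTest-0 t = <⇒≱ (*-mono-≤ 1≤k 1≤k) (≤ᵇ⇒≤ (k * k) 0 (proj₁ (Equivalence.to T-∧ t)))

    line : FiniteSimpleGraph
    line = pointGraph {suc (k + k)} (linePoint toℕ) lineTest lineTest-0

    Range : ℕ → Set
    Range t = k ≤ t × t ≤ N

    edge⇔ : ∀ u v → Edge line u v ⇔ Range ∣ toℕ u - toℕ v ∣
    edge⇔ u v rewrite +-identityʳ (∣ toℕ u - toℕ v ∣ * ∣ toℕ u - toℕ v ∣) = mk⇔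
      (λ e → let lower , upper = Equivalence.to T-∧ e in
        square-cancel-≤ (≤ᵇ⇒≤ (k * k) _ lower) , square-cancel-≤ (≤ᵇ⇒≤ _ (N * N) upper))
      λ { (lower , upper) → Equivalence.from T-∧ (≤⇒≤ᵇ (*-mono-≤ lower lower) , ≤⇒≤ᵇ (*-mono-≤ upper upper)) }

    increasing-⊥ : ∀ {a b c} → a ≤ b → b ≤ c → Range ∣ a - b ∣ → Range ∣ b - c ∣ → Range ∣ a - c ∣ → ⊥
    increasing-⊥ {a} {b} {c} a≤b b≤c (k≤ab , _) (k≤bc , _) (_ , ac≤N) = <⇒≱ N<2k (begin
      k + k                         ≤⟨ +-mono-≤ k≤ab k≤bc ⟩
      ∣ a - b ∣ + ∣ b - c ∣         ≡⟨ distance-+ {n = a} (begin-equality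
          c                                   ≡⟨ m+[n∸m]≡n b≤c ⟨
          b + (c ∸ b)                         ≡⟨ cong (_+ (c ∸ b)) (m+[n∸m]≡n a≤b) ⟨
          a + (b ∸ a) + (c ∸ b)               ≡⟨ +-assoc a _ _ ⟩
          a + ((b ∸ a) + (c ∸ b))             ≡⟨ cong₂ (λ x y → a + (x + y)) (m≤n⇒∣m-n∣≡n∸m a≤b) (m≤n⇒∣m-n∣≡n∸m b≤c) ⟨
          a + (∣ a - b ∣ + ∣ b - c ∣)         ∎) ⟨
      ∣ a - c ∣                     ≤⟨ ac≤N ⟩
      N                             ∎)
      where
      open ≤-Reasoning

    flip : ∀ x y → Range ∣ x - y ∣ → Range ∣ y - x ∣
    flip x y = subst Range (∣-∣-comm x y)

    three-in-range-⊥ : ∀ a b c → Range ∣ a - b ∣ → Range ∣ a - c ∣ → Range ∣ b - c ∣ → ⊥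
    three-in-range-⊥ a b c ab ac bc with ≤-total a b | ≤-total b c | ≤-total a c
    ... | inj₁ a≤b | inj₁ b≤c | _        = increasing-⊥ a≤b b≤c ab bc ac
    ... | inj₁ a≤b | inj₂ c≤b | inj₁ a≤c = increasing-⊥ a≤c c≤b ac (flip b c bc) ab
    ... | inj₁ a≤b | inj₂ c≤b | inj₂ c≤a = increasing-⊥ c≤a a≤b (flip a c ac) ab (flip b c bc)
    ... | inj₂ b≤a | inj₁ b≤c | inj₁ a≤c = increasing-⊥ b≤a a≤c (flip a b ab) ac bc
    ... | inj₂ b≤a | inj₁ b≤c | inj₂ c≤a = increasing-⊥ b≤c c≤a bc (flip a c ac) (flip a b ab)
    ... | inj₂ b≤a | inj₂ c≤b | _        = increasing-⊥ c≤b b≤a (flip b c bc) (flip a b ab) (flip a c ac)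

    line-triangleFree : ∀ u v w → Edge line u v → Edge line u w → Edge line v w → ⊥
    line-triangleFree u v w uv uw vw = three-in-range-⊥ (toℕ u) (toℕ v) (toℕ w)
      (Equivalence.to (edge⇔ u v) uv) (Equivalence.to (edge⇔ u w) uw) (Equivalence.to (edge⇔ v w) vw)

    -- Steps of k + 1 up and k down visit all points in one odd cycle.
    line-¬2-colorable : ¬ Colorable line 2
    line-¬2-colorable (c , proper) = apart k (k + k) {k} refl ≤-refl (<⇒≤ k<N) ≤-refl
      (trans (cong (c ∘ point) (sym (+-identityʳ k))) (constant k ≤-refl))
      where
      point : ℕ → Vertex line
      point j = fromℕ< (s≤s (m⊓n≤n j (k + k)))
      toℕ-point : ∀ {j} → j ≤ k + k → toℕ (point j) ≡ j
      toℕ-point {j} j≤ = trans (Fin.toℕ-fromℕ< _) (m≤n⇒m⊓n≡m j≤)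
      apart : ∀ i j {e} → j ≡ i + e → k ≤ e → e ≤ N → j ≤ k + k → c (point i) ≢ c (point j)
      apart i j {e} j≡i+e k≤e e≤N j≤ = proper (point i) (point j) (Equivalence.from (edge⇔ (point i) (point j))
        (subst Range (sym distance) (k≤e , e≤N)))
        where
        distance : ∣ toℕ (point i) - toℕ (point j) ∣ ≡ e
        distance = trans (cong₂ ∣_-_∣ (toℕ-point (≤-trans (m≤m+n i e) (≤-trans (≤-reflexive (sym j≡i+e)) j≤))) (toℕ-point j≤))
                         (distance-+ j≡i+e)
      -- The walk goes from k + j through j to k + (j + 1), two edges at a time, so k and 2k receive
      -- the same colour although they are k apart.
      constant : ∀ j → j ≤ k → c (point (k + 0)) ≡ c (point (k + j))
      constant zero    _   = refl
      constant (suc j) j<k = trans (constant j (<⇒≤ j<k)) (bicoloured {b = c (point j)}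
        (≢-sym (apart j (k + j) (+-comm k j) ≤-refl (<⇒≤ k<N) (+-monoʳ-≤ k (<⇒≤ j<k))))
        (apart j (k + suc j) (trans (+-suc k j) (trans (cong suc (+-comm k j)) (sym (+-suc j k)))) (n≤1+n k) k<N (+-monoʳ-≤ k j<k)))

  -- `Line` cannot reach x ≥ 2. With N = 3 + n and the scale 1 / 2, the five points 0, N, 2N, N + 1,
  -- N - 1 have sides of lengths N, N, N - 1, 2, N - 1, all in [2, N], and diagonals of lengths 1, N
  -- + 1 or 2N, all outside.
  module WideLine (n : ℕ) where
    open +-*-Solver

    wide : Fin 5 → ℕ
    wide 0F = 0
    wide 1F = 3 + n
    wide 2F = (3 + n) + (3 + n)
    wide 3F = 4 + n
    wide 4F = 2 + n

    wide-near : ∀ u → 2 ≤ ∣ wide u - wide (next u) ∣ × ∣ wide u - wide (next u) ∣ ≤ 3 + n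
    wide-near 0F = s≤s (s≤s z≤n) , ≤-refl
    wide-near 1F rewrite ∣m-m+n∣≡n (3 + n) (3 + n) = s≤s (s≤s z≤n) , ≤-refl
    wide-near 2F rewrite distance-+′ {wide 2F} {wide 3F} {2 + n} (solve 1 (λ n → (con 3 :+ n) :+ (con 3 :+ n) := (con 4 :+ n) :+ (con 2 :+ n)) refl n)
      = s≤s (s≤s z≤n) , n≤1+n _
    wide-near 3F rewrite distance-+′ {wide 3F} {wide 4F} {2} (solve 1 (λ n → con 4 :+ n := con 2 :+ n :+ con 2) refl n) = ≤-refl , s≤s (s≤s z≤n)
    wide-near 4F = s≤s (s≤s z≤n) , n≤1+n _

    wide-far : ∀ u → 0 < ∣ wide u - wide (next (next u)) ∣ ×
                     (∣ wide u - wide (next (next u)) ∣ < 2 ⊎ 3 + n < ∣ wide u - wide (next (next u)) ∣)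
    wide-far 0F = s≤s z≤n , inj₂ (m<m+n (3 + n) (s≤s z≤n))
    wide-far 1F rewrite distance-+ {wide 3F} {wide 1F} {1} (solve 1 (λ n → con 4 :+ n := con 3 :+ n :+ con 1) refl n) = ≤-refl , inj₁ ≤-refl
    wide-far 2F rewrite distance-+′ {wide 2F} {wide 4F} {4 + n} (solve 1 (λ n → (con 3 :+ n) :+ (con 3 :+ n) := (con 2 :+ n) :+ (con 4 :+ n)) refl n)
      = s≤s z≤n , inj₂ ≤-refl
    wide-far 3F = s≤s z≤n , inj₂ ≤-refl
    wide-far 4F rewrite distance-+ {wide 1F} {wide 4F} {1} (solve 1 (λ n → con 3 :+ n := con 2 :+ n :+ con 1) refl n) = ≤-refl , inj₁ ≤-refl

-- Integer coefficients for the ring solver, as pairs (positive part , negative part).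
module Solver (C : CommutativeRing 0ℓ 0ℓ) where
  open CommutativeRing C
  open MultProperties semiring using (×-homo-+; ×1-homo-*) renaming (_×_ to _∙_)
  open import Algebra.Solver.Ring.NaturalCoefficients.Default commutativeSemiring as N using ()
  open import Relation.Binary.Reasoning.Setoid setoid
  open RingProperties ring

  private
    Coeff : Set
    Coeff = ℕ × ℕ

    -- A normal form in which one part is 0. It lets `decide`, which compares componentwise,
    -- recognise equal integers and in particular cancelled coefficients.
    reduce : ℕ → ℕ → Coeff
    reduce a b = a ℕ.∸ b , b ℕ.∸ a

    coeffs : RawRing 0ℓ 0ℓ
    coeffs = record
      { Carrier = Coeff
      ; _≈_ = _≡_
      ; _+_ = λ { (a , b) (c , d) → reduce (a ℕ.+ c) (b ℕ.+ d) }
      ; _*_ = λ { (a , b) (c , d) → reduce (a ℕ.* c ℕ.+ b ℕ.* d) (a ℕ.* d ℕ.+ b ℕ.* c) }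
      ; -_  = λ { (a , b) → b , a }
      ; 0#  = 0 , 0
      ; 1#  = 1 , 0
      }

    ι : ℕ → Carrier
    ι n = n ∙ 1#

    ⟦_⟧ : Coeff → Carrier
    ⟦ a , b ⟧ = ι a - ι b

    move : ∀ {x y z w} → x + w ≈ z + y → x - y ≈ z - w
    move {x} {y} {z} {w} e = begin
      x - y                      ≈⟨ +-identityʳ _ ⟨
      x - y + 0#                 ≈⟨ +-congˡ (-‿inverseʳ w) ⟨
      x - y + (w - w)            ≈⟨ N.solve 4 (λ x y w v → (x N.:+ y) N.:+ (w N.:+ v) N.:= ((x N.:+ w) N.:+ y) N.:+ v) refl x (- y) w (- w) ⟩
      x + w - y - w              ≈⟨ +-congʳ (+-congʳ e) ⟩
      z + y - y - w              ≈⟨ N.solve 4 (λ z y v u → ((z N.:+ y) N.:+ v) N.:+ u N.:= (z N.:+ u) N.:+ (y N.:+ v)) refl z y (- y) (- w) ⟩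
      z - w + (y - y)            ≈⟨ +-congˡ (-‿inverseʳ y) ⟩
      z - w + 0#                 ≈⟨ +-identityʳ _ ⟩
      z - w ∎

    ⟦reduce⟧ : ∀ a b → ⟦ reduce a b ⟧ ≈ ι a - ι b
    ⟦reduce⟧ a b = move (begin
      ι (a ℕ.∸ b) + ι b   ≈⟨ ×-homo-+ 1# (a ℕ.∸ b) b ⟨
      ι (a ℕ.∸ b ℕ.+ b)   ≡⟨ ≡.cong ι (lemma a b) ⟩
      ι (a ℕ.+ (b ℕ.∸ a)) ≈⟨ ×-homo-+ 1# a (b ℕ.∸ a) ⟩
      ι a + ι (b ℕ.∸ a)   ∎)
      where
      lemma : ∀ a b → a ℕ.∸ b ℕ.+ b ≡ a ℕ.+ (b ℕ.∸ a)
      lemma zero zero = ≡.refl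
      lemma zero (suc b) = ≡.refl
      lemma (suc a) zero = ≡.refl
      lemma (suc a) (suc b) = ≡.trans (ℕ.+-suc _ b) (≡.cong suc (lemma a b))

    ι-+ : ∀ a b → ι (a ℕ.+ b) ≈ ι a + ι b
    ι-+ = ×-homo-+ 1#

    -+- : ∀ x y z w → (x + z) - (y + w) ≈ (x - y) + (z - w)
    -+- x y z w = begin
      (x + z) - (y + w)     ≈⟨ +-congˡ (-‿+-comm y w) ⟨
      (x + z) + (- y - w)   ≈⟨ N.solve 4 (λ x y z w → (x N.:+ z) N.:+ (y N.:+ w) N.:= (x N.:+ y) N.:+ (z N.:+ w)) refl x (- y) z (- w) ⟩
      (x - y) + (z - w) ∎

    -*- : ∀ x y z w → (x * z + y * w) - (x * w + y * z) ≈ (x - y) * (z - w)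
    -*- x y z w = begin
      (x * z + y * w) - (x * w + y * z)                  ≈⟨ +-congˡ (-‿+-comm _ _) ⟨
      (x * z + y * w) + (- (x * w) - (y * z))            ≈⟨ +-cong (+-congˡ neg-neg) (+-cong (-‿distribʳ-* x w) (-‿distribˡ-* y z)) ⟩
      (x * z + (- y) * (- w)) + (x * (- w) + (- y) * z)  ≈⟨ N.solve 4 (λ x y z w → (x N.:* z N.:+ y N.:* w) N.:+ (x N.:* w N.:+ y N.:* z) N.:= (x N.:+ y) N.:* (z N.:+ w)) refl x (- y) z (- w) ⟩
      (x - y) * (z - w) ∎
      where
      neg-neg : y * w ≈ (- y) * (- w)
      neg-neg = begin
        y * w           ≈⟨ -‿involutive _ ⟨
        - (- (y * w))   ≈⟨ -‿cong (-‿distribʳ-* y w) ⟩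
        - (y * (- w))   ≈⟨ -‿distribˡ-* y (- w) ⟩
        (- y) * (- w)   ∎

    ι-** : ∀ a b c d → ι (a ℕ.* c ℕ.+ b ℕ.* d) ≈ ι a * ι c + ι b * ι d
    ι-** a b c d = trans (ι-+ (a ℕ.* c) (b ℕ.* d)) (+-cong (×1-homo-* a c) (×1-homo-* b d))

    morphism : coeffs -Raw-AlmostCommutative⟶ fromCommutativeRing C
    morphism = record
      { ⟦_⟧    = ⟦_⟧
      ; +-homo = λ { (a , b) (c , d) → trans (⟦reduce⟧ (a ℕ.+ c) (b ℕ.+ d))
                   (trans (+-cong (ι-+ a c) (-‿cong (ι-+ b d))) (-+- _ _ _ _)) }
      ; *-homo = λ { (a , b) (c , d) → trans (⟦reduce⟧ (a ℕ.* c ℕ.+ b ℕ.* d) (a ℕ.* d ℕ.+ b ℕ.* c))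
                   (trans (+-cong (ι-** a b c d) (-‿cong (ι-** a b d c))) (-*- _ _ _ _)) }
      ; -‿homo = λ { (a , b) → swap (ι a) (ι b) }
      ; 0-homo = -‿inverseʳ 0#
      ; 1-homo = trans (+-cong (+-identityʳ 1#) -0#≈0#) (+-identityʳ 1#)
      }
      where
      swap : ∀ x y → y - x ≈ - (x - y)
      swap x y = sym (⁻¹-anti-homo‿- x y)

    decide : ∀ p q → Maybe (⟦ p ⟧ ≈ ⟦ q ⟧)
    decide (a , b) (c , d) with a ℕ.≟ c | b ℕ.≟ d
    ... | yes ≡.refl | yes ≡.refl = just refl
    ... | _          | _          = nothing

  open RingSolver coeffs (fromCommutativeRing C) morphism decide public
    using (solve; _:=_; _:+_; _:*_; _:-_; :-_)

-- Order, integer parts and square roots in a complete ordered field.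

module Field (em : ExcludedMiddle 0ℓ) (R : CompleteOrderedField) where
  open CompleteOrderedField R
  open CommutativeRing commutativeRing
    using (refl; sym; trans; *-cong; +-congˡ; *-congˡ; *-congʳ; -‿cong; +-comm; *-comm; +-identityˡ; +-identityʳ; *-identityˡ; *-identityʳ; -‿inverseʳ; zeroˡ; *-assoc)
  open Solver commutativeRing
  open MultProperties semiring using (×-homo-+; ×1-homo-*)
  private module O = IsTotalOrder isTotalOrder
  open O public using (antisym; total) renaming (refl to ≤-refl; reflexive to ≤-reflexive; trans to ≤-trans)

  ≤-poset : Poset 0ℓ 0ℓ 0ℓ
  ≤-poset = record { isPartialOrder = O.isPartialOrder }

  open import Relation.Binary.Reasoning.PartialOrder ≤-poset

  ≰⇒≥ : ∀ {x y} → ¬ x ≤ y → y ≤ x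
  ≰⇒≥ {x} {y} ¬x≤y with total x y
  ... | inj₁ x≤y = contradiction x≤y ¬x≤y
  ... | inj₂ y≤x = y≤x

  ≰⇒< : ∀ {x y} → ¬ x ≤ y → y < x
  ≰⇒< ¬x≤y = ≰⇒≥ ¬x≤y , λ y≈x → ¬x≤y (≤-reflexive (sym y≈x))

  ≮⇒≥ : ∀ {x y} → ¬ x < y → y ≤ x
  ≮⇒≥ {x} {y} ¬x<y with em {y ≤ x}
  ... | yes y≤x = y≤x
  ... | no y≰x  = contradiction (≰⇒< y≰x) ¬x<y

  <⇒≰ : ∀ {x y} → x < y → ¬ y ≤ x
  <⇒≰ (x≤y , x≉y) y≤x = x≉y (antisym x≤y y≤x)

  <-≤-trans : ∀ {x y z} → x < y → y ≤ z → x < z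
  <-≤-trans x<y y≤z = ≰⇒< λ z≤x → <⇒≰ x<y (≤-trans y≤z z≤x)

  ≤-<-trans : ∀ {x y z} → x ≤ y → y < z → x < z
  ≤-<-trans x≤y y<z = ≰⇒< λ z≤x → <⇒≰ y<z (≤-trans z≤x x≤y)

  +-monoʳ-≤ : ∀ {x y} z → x ≤ y → z + x ≤ z + y
  +-monoʳ-≤ {x} {y} z x≤y = begin
    z + x ≈⟨ +-comm z x ⟩
    x + z ≤⟨ +-monoˡ-≤ z x≤y ⟩
    y + z ≈⟨ +-comm y z ⟩
    z + y ∎

  +-mono-≤ : ∀ {x y z w} → x ≤ y → z ≤ w → x + z ≤ y + w
  +-mono-≤ x≤y z≤w = ≤-trans (+-monoˡ-≤ _ x≤y) (+-monoʳ-≤ _ z≤w)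

  x≤y⇒0≤y-x : ∀ {x y} → x ≤ y → 0# ≤ y - x
  x≤y⇒0≤y-x {x} {y} x≤y = begin
    0#    ≈⟨ -‿inverseʳ x ⟨
    x - x ≤⟨ +-monoˡ-≤ (- x) x≤y ⟩
    y - x ∎

  0≤y-x⇒x≤y : ∀ {x y} → 0# ≤ y - x → x ≤ y
  0≤y-x⇒x≤y {x} {y} 0≤ = begin
    x           ≈⟨ +-identityˡ x ⟨
    0# + x      ≤⟨ +-monoˡ-≤ x 0≤ ⟩
    y - x + x   ≈⟨ solve 2 (λ x y → (y :- x) :+ x := y) refl x y ⟩
    y           ∎

  *-monoˡ-≤ : ∀ {x y z} → 0# ≤ z → x ≤ y → x * z ≤ y * z
  *-monoˡ-≤ {x} {y} {z} 0≤z x≤y = 0≤y-x⇒x≤y (begin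
    0#              ≤⟨ *-nonNeg (x≤y⇒0≤y-x x≤y) 0≤z ⟩
    (y - x) * z     ≈⟨ solve 3 (λ x y z → (y :- x) :* z := y :* z :- x :* z) refl x y z ⟩
    y * z - x * z   ∎)

  *-monoʳ-≤ : ∀ {x y z} → 0# ≤ z → x ≤ y → z * x ≤ z * y
  *-monoʳ-≤ {x} {y} {z} 0≤z x≤y = begin
    z * x ≈⟨ *-comm z x ⟩
    x * z ≤⟨ *-monoˡ-≤ 0≤z x≤y ⟩
    y * z ≈⟨ *-comm y z ⟩
    z * y ∎

  *-mono-≤ : ∀ {x y z w} → 0# ≤ x → 0# ≤ w → x ≤ y → z ≤ w → x * z ≤ y * w
  *-mono-≤ 0≤x 0≤w x≤y z≤w = ≤-trans (*-monoʳ-≤ 0≤x z≤w) (*-monoˡ-≤ 0≤w x≤y)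

  0≤x² : ∀ x → 0# ≤ x * x
  0≤x² x with total 0# x
  ... | inj₁ 0≤x = *-nonNeg 0≤x 0≤x
  ... | inj₂ x≤0 = begin
    0#                      ≤⟨ *-nonNeg (x≤y⇒0≤y-x x≤0) (x≤y⇒0≤y-x x≤0) ⟩
    (0# - x) * (0# - x)     ≈⟨ *-cong (+-identityˡ _) (+-identityˡ _) ⟩
    (- x) * (- x)           ≈⟨ solve 1 (λ x → (:- x) :* (:- x) := x :* x) refl x ⟩
    x * x                   ∎

  0≤1 : 0# ≤ 1#
  0≤1 = ≤-trans (0≤x² 1#) (≤-reflexive (*-identityˡ 1#))

  0<1 : 0# < 1#
  0<1 = 0≤1 , 0≉1

  0≤+ : ∀ {x y} → 0# ≤ x → 0# ≤ y → 0# ≤ x + y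
  0≤+ 0≤x 0≤y = ≤-trans (≤-reflexive (sym (+-identityˡ 0#))) (+-mono-≤ 0≤x 0≤y)

  x≤x+y : ∀ x {y} → 0# ≤ y → x ≤ x + y
  x≤x+y x 0≤y = ≤-trans (≤-reflexive (sym (+-identityʳ x))) (+-monoʳ-≤ x 0≤y)

  0<x⇒x≉0 : ∀ {x} → 0# < x → ¬ x ≈ 0#
  0<x⇒x≉0 (_ , 0≉x) x≈0 = 0≉x (sym x≈0)

  x*x⁻¹ : ∀ {x} → 0# < x → x * x ⁻¹ ≈ 1#
  x*x⁻¹ 0<x = *-inverseʳ _ (0<x⇒x≉0 0<x)

  -- The inverse is x times the square of the inverse, a product of nonnegative factors.
  0≤x⁻¹ : ∀ {x} → 0# < x → 0# ≤ x ⁻¹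
  0≤x⁻¹ {x} 0<x = begin
    0#                    ≤⟨ *-nonNeg (proj₁ 0<x) (0≤x² (x ⁻¹)) ⟩
    x * (x ⁻¹ * x ⁻¹)     ≈⟨ *-assoc _ _ _ ⟨
    x * x ⁻¹ * x ⁻¹       ≈⟨ *-congʳ (x*x⁻¹ 0<x) ⟩
    1# * x ⁻¹             ≈⟨ *-identityˡ _ ⟩
    x ⁻¹                  ∎

  *-cancelʳ-≤ : ∀ {x y z} → 0# < z → x * z ≤ y * z → x ≤ y
  *-cancelʳ-≤ {x} {y} {z} 0<z xz≤yz = begin
    x                ≈⟨ lemma x ⟩
    x * z * z ⁻¹     ≤⟨ *-monoˡ-≤ (0≤x⁻¹ 0<z) xz≤yz ⟩
    y * z * z ⁻¹     ≈⟨ lemma y ⟨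
    y                ∎
    where
    lemma : ∀ x → x ≈ x * z * z ⁻¹
    lemma x = sym (trans (*-assoc _ _ _) (trans (*-congˡ (x*x⁻¹ 0<z)) (*-identityʳ x)))

  *-pos : ∀ {x y} → 0# < x → 0# < y → 0# < x * y
  *-pos {x} {y} 0<x 0<y = ≰⇒< λ xy≤0 → <⇒≰ 0<x (*-cancelʳ-≤ 0<y (≤-trans xy≤0 (≤-reflexive (sym (zeroˡ y)))))

  x/y*y : ∀ x {y} → 0# < y → x / y * y ≈ x
  x/y*y x {y} 0<y = trans (*-assoc _ _ _) (trans (*-congˡ (trans (*-comm _ _) (x*x⁻¹ 0<y))) (*-identityʳ x))

  /-≤ : ∀ {x y z} → 0# < y → x ≤ z * y → x / y ≤ z
  /-≤ 0<y x≤zy = *-cancelʳ-≤ 0<y (≤-trans (≤-reflexive (x/y*y _ 0<y)) x≤zy)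

  ≤-/ : ∀ {x y z} → 0# < y → z * y ≤ x → z ≤ x / y
  ≤-/ 0<y zy≤x = *-cancelʳ-≤ 0<y (≤-trans zy≤x (≤-reflexive (sym (x/y*y _ 0<y))))

  0</ : ∀ {x y} → 0# < x → 0# < y → 0# < x / y
  0</ {x} {y} 0<x 0<y = ≰⇒< λ q≤0 → <⇒≰ 0<x (begin
    x         ≈⟨ x/y*y x 0<y ⟨
    x / y * y ≤⟨ *-monoˡ-≤ (proj₁ 0<y) q≤0 ⟩
    0# * y    ≈⟨ zeroˡ y ⟩
    0#        ∎)

  square-mono : ∀ {x y} → 0# ≤ x → x ≤ y → x * x ≤ y * y
  square-mono 0≤x x≤y = *-mono-≤ 0≤x (≤-trans 0≤x x≤y) x≤y x≤y

  square-cancel : ∀ {x y} → 0# ≤ y → x * x ≤ y * y → x ≤ y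
  square-cancel {x} {y} 0≤y x²≤y² with em {x ≤ y}
  ... | yes x≤y = x≤y
  ... | no x≰y = contradiction (*-cancelʳ-≤ 0<x+y (begin
    x * (x + y)        ≈⟨ solve 2 (λ x y → x :* (x :+ y) := x :* x :+ x :* y) refl x y ⟩
    x * x + x * y      ≤⟨ +-monoˡ-≤ _ x²≤y² ⟩
    y * y + x * y      ≈⟨ solve 2 (λ x y → y :* y :+ x :* y := y :* (x :+ y)) refl x y ⟩
    y * (x + y)        ∎)) x≰y
    where
    0<x+y : 0# < x + y
    0<x+y = <-≤-trans (≤-<-trans 0≤y (≰⇒< x≰y)) (x≤x+y x 0≤y)

  fromℕ-+ : ∀ m n → fromℕ (m ℕ.+ n) ≈ fromℕ m + fromℕ n
  fromℕ-+ = ×-homo-+ 1#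

  fromℕ-* : ∀ m n → fromℕ (m ℕ.* n) ≈ fromℕ m * fromℕ n
  fromℕ-* = ×1-homo-*

  fromℕ-1 : fromℕ 1 ≈ 1#
  fromℕ-1 = +-identityʳ 1#

  0≤fromℕ : ∀ n → 0# ≤ fromℕ n
  0≤fromℕ zero    = ≤-refl
  0≤fromℕ (suc n) = 0≤+ 0≤1 (0≤fromℕ n)

  fromℕ-mono : ∀ {m n} → m ℕ.≤ n → fromℕ m ≤ fromℕ n
  fromℕ-mono {n = n} ℕ.z≤n = 0≤fromℕ n
  fromℕ-mono (ℕ.s≤s m≤n) = +-monoʳ-≤ 1# (fromℕ-mono m≤n)

  0<fromℕ : ∀ n → .{{ℕ.NonZero n}} → 0# < fromℕ n
  0<fromℕ (suc n) = <-≤-trans 0<1 (x≤x+y 1# (0≤fromℕ n))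

  +-cancelˡ-≤ : ∀ z {x y} → z + x ≤ z + y → x ≤ y
  +-cancelˡ-≤ z {x} {y} le = begin
    x             ≈⟨ solve 2 (λ x z → x := :- z :+ (z :+ x)) refl x z ⟩
    - z + (z + x) ≤⟨ +-monoʳ-≤ (- z) le ⟩
    - z + (z + y) ≈⟨ solve 2 (λ x z → :- z :+ (z :+ x) := x) refl y z ⟩
    y             ∎

  fromℕ-cancel : ∀ m n → fromℕ m ≤ fromℕ n → m ℕ.≤ n
  fromℕ-cancel zero    n       le = ℕ.z≤n
  fromℕ-cancel (suc m) zero    le = contradiction le (<⇒≰ (0<fromℕ (suc m)))
  fromℕ-cancel (suc m) (suc n) le = ℕ.s≤s (fromℕ-cancel m n (+-cancelˡ-≤ 1# le))

  fromℕ-<-cancel : ∀ m n → fromℕ m < fromℕ n → m ℕ.< n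
  fromℕ-<-cancel m n lt = ℕ.≰⇒> λ n≤m → <⇒≰ lt (fromℕ-mono n≤m)

  fromℕ-<-mono : ∀ {m n} → m ℕ.< n → fromℕ m < fromℕ n
  fromℕ-<-mono {m} {n} m<n = ≰⇒< λ le → ℕ.<⇒≱ m<n (fromℕ-cancel n m le)

  -- Otherwise the naturals would have a supremum s, and s - 1 would be an upper bound as well,
  -- because the successor of a natural number is again below s.
  archimedean : ∀ x → ∃[ n ] x ≤ fromℕ n
  archimedean x with em {∃[ n ] x ≤ fromℕ n}
  ... | yes found = found
  ... | no none = contradiction (s-least (s - 1#) λ { r (n , r≈n) → 0≤y-x⇒x≤y (begin
      0#                        ≤⟨ x≤y⇒0≤y-x (s-upper (fromℕ (suc n)) (suc n , refl)) ⟩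
      s - (1# + fromℕ n)        ≈⟨ solve 3 (λ s o n → s :- (o :+ n) := s :- o :- n) refl s 1# (fromℕ n) ⟩
      s - 1# - fromℕ n          ≈⟨ +-congˡ (-‿cong r≈n) ⟨
      s - 1# - r ∎) })
      (<⇒≰ (≰⇒< λ s≤s-1 → <⇒≰ 0<1 (+-cancelˡ-≤ (s - 1#) (begin
        s - 1# + 1#  ≈⟨ solve 2 (λ s o → s :- o :+ o := s) refl s 1# ⟩
        s            ≤⟨ s≤s-1 ⟩
        s - 1#       ≈⟨ +-identityʳ _ ⟨
        s - 1# + 0#  ∎))))
    where
    IsNatural : ℝ → Set
    IsNatural r = ∃[ n ] r ≈ fromℕ n
    supremum : ∃[ s ] IsSupremum IsNatural s
    supremum = complete IsNatural (0# , 0 , refl)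
      (x , λ { r (n , r≈n) → ≰⇒≥ λ x≤r → none (n , ≤-trans x≤r (≤-reflexive r≈n)) })
    s = proj₁ supremum
    s-upper = proj₁ (proj₂ supremum)
    s-least = proj₂ (proj₂ supremum)

  floor : ∀ x → 0# ≤ x → ∃[ n ] (fromℕ n ≤ x × x < fromℕ (suc n))
  floor x 0≤x = descend (proj₁ (archimedean x)) (proj₂ (archimedean x))
    where
    descend : ∀ n → x ≤ fromℕ n → ∃[ n ] (fromℕ n ≤ x × x < fromℕ (suc n))
    descend zero x≤0 = 0 , 0≤x , ≤-<-trans x≤0 (0<fromℕ 1)
    descend (suc n) x≤1+n with em {x ≤ fromℕ n}
    ... | yes x≤n = descend n x≤n
    ... | no x≰n with em {fromℕ (suc n) ≤ x}
    ...   | yes 1+n≤x = suc n , 1+n≤x , ≤-<-trans x≤1+n (fromℕ-<-mono (ℕ.n<1+n (suc n)))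
    ...   | no 1+n≰x  = n , ≰⇒≥ x≰n , ≰⇒< 1+n≰x

  /-nonNeg : ∀ {x y} → 0# ≤ x → 0# < y → 0# ≤ x / y
  /-nonNeg 0≤x 0<y = *-nonNeg 0≤x (0≤x⁻¹ 0<y)

  -- x² is compared with a through the product with y², as x y is given.
  ≤-square : ∀ {x y z a} → 0# < y → x * y ≈ z → a * (y * y) ≤ z * z → a ≤ x * x
  ≤-square {x} {y} {z} {a} 0<y xy≈z le = *-cancelʳ-≤ (*-pos 0<y 0<y) (begin
    a * (y * y)         ≤⟨ le ⟩
    z * z               ≈⟨ *-cong xy≈z xy≈z ⟨
    (x * y) * (x * y)   ≈⟨ solve 2 (λ x y → (x :* y) :* (x :* y) := (x :* x) :* (y :* y)) refl x y ⟩
    (x * x) * (y * y)   ∎)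

  square-≤ : ∀ {x y z a} → 0# < y → x * y ≈ z → z * z ≤ a * (y * y) → x * x ≤ a
  square-≤ {x} {y} {z} {a} 0<y xy≈z le = *-cancelʳ-≤ (*-pos 0<y 0<y) (begin
    (x * x) * (y * y)   ≈⟨ solve 2 (λ x y → (x :* y) :* (x :* y) := (x :* x) :* (y :* y)) refl x y ⟨
    (x * y) * (x * y)   ≈⟨ *-cong xy≈z xy≈z ⟩
    z * z               ≤⟨ le ⟩
    a * (y * y)         ∎)

  x≤y⇐y≈x+z : ∀ {x y} z → 0# ≤ z → y ≈ x + z → x ≤ y
  x≤y⇐y≈x+z {x} z 0≤z y≈x+z = ≤-trans (x≤x+y x 0≤z) (≤-reflexive (sym y≈x+z))

  -- The supremum s of the r with r² ≤ a is compared with the arithmetic mean of s and a / s,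
  -- which is at least √a, and with their harmonic mean, which is at most √a.
  sqrt : ∀ a → 0# ≤ a → ∃[ r ] (0# ≤ r × r * r ≈ a)
  sqrt a 0≤a = s , 0≤s , antisym s²≤a a≤s²
    where
    Below : ℝ → Set
    Below r = 0# ≤ r × r * r ≤ a
    below-0 : Below 0#
    below-0 = ≤-refl , ≤-trans (≤-reflexive (zeroˡ 0#)) 0≤a
    0<1+a : 0# < 1# + a
    0<1+a = <-≤-trans 0<1 (x≤x+y 1# 0≤a)
    a≤[1+a]² : a ≤ (1# + a) * (1# + a)
    a≤[1+a]² = begin
      a                                       ≈⟨ *-identityˡ a ⟨
      1# * a                                  ≤⟨ x≤y⇐y≈x+z _ (0≤+ (0≤+ (0≤x² 1#) (*-nonNeg 0≤1 0≤a)) (0≤x² a))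
                                                   (solve 2 (λ o a → (o :+ a) :* (o :+ a) := o :* a :+ (o :* o :+ o :* a :+ a :* a)) refl 1# a) ⟩
      (1# + a) * (1# + a)                     ∎
    supremum : ∃[ s ] IsSupremum Below s
    supremum = complete Below (0# , below-0)
      (1# + a , λ { r (_ , r²≤a) → square-cancel (proj₁ 0<1+a) (≤-trans r²≤a a≤[1+a]²) })
    s = proj₁ supremum
    s-upper : ∀ r → Below r → r ≤ s
    s-upper = proj₁ (proj₂ supremum)
    s-least : ∀ b → (∀ r → Below r → r ≤ b) → s ≤ b
    s-least = proj₂ (proj₂ supremum)
    0≤s : 0# ≤ s
    0≤s = s-upper 0# below-0
    s²≤a : s * s ≤ a
    s²≤a with em {s ≤ 0#}
    ... | yes s≤0 = ≤-trans (square-mono 0≤s s≤0) (proj₂ below-0)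
    ... | no s≰0 = +-cancelˡ-≤ (s * s) (begin
      s * s + s * s     ≈⟨ solve 1 (λ s → s :* s :+ s :* s := s :* (s :+ s)) refl s ⟩
      s * (s + s)       ≤⟨ *-monoˡ-≤ (proj₁ 0<2s) s≤t ⟩
      t * (s + s)       ≈⟨ x/y*y _ 0<2s ⟩
      s * s + a         ∎)
      where
      0<2s : 0# < s + s
      0<2s = <-≤-trans (≰⇒< s≰0) (x≤x+y s 0≤s)
      t = (s * s + a) / (s + s)
      a≤t² : a ≤ t * t
      a≤t² = ≤-square 0<2s (x/y*y _ 0<2s) (x≤y⇐y≈x+z _ (0≤x² (s * s - a))
        (solve 2 (λ s a → (s :* s :+ a) :* (s :* s :+ a) := a :* ((s :+ s) :* (s :+ s)) :+ (s :* s :- a) :* (s :* s :- a)) refl s a))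
      s≤t : s ≤ t
      s≤t = s-least t λ { r (_ , r²≤a) → square-cancel (/-nonNeg (0≤+ (0≤x² s) 0≤a) 0<2s) (≤-trans r²≤a a≤t²) }
    a≤s² : a ≤ s * s
    a≤s² with em {a ≤ 0#}
    ... | yes a≤0 = ≤-trans a≤0 (0≤x² s)
    ... | no a≰0 = +-cancelˡ-≤ a (*-cancelʳ-≤ 0<s (begin
      (a + a) * s       ≈⟨ x/y*y _ 0<D ⟨
      t * (a + s * s)   ≤⟨ *-monoˡ-≤ (proj₁ 0<D) (s-upper t below-t) ⟩
      s * (a + s * s)   ≈⟨ *-comm _ _ ⟩
      (a + s * s) * s   ∎))
      where
      0<a : 0# < a
      0<a = ≰⇒< a≰0
      -- A positive number whose square is at most a; it makes s positive, so that s can be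
      -- cancelled.
      q = a / (1# + a)
      below-q : Below q
      below-q = /-nonNeg 0≤a 0<1+a , square-≤ 0<1+a (x/y*y _ 0<1+a) (*-monoʳ-≤ 0≤a a≤[1+a]²)
      0<s : 0# < s
      0<s = <-≤-trans (0</ 0<a 0<1+a) (s-upper q below-q)
      0<D : 0# < a + s * s
      0<D = <-≤-trans 0<a (x≤x+y a (0≤x² s))
      t = (a + a) * s / (a + s * s)
      below-t : Below t
      below-t = /-nonNeg (*-nonNeg (0≤+ 0≤a 0≤a) 0≤s) 0<D , square-≤ 0<D (x/y*y _ 0<D)
        (x≤y⇐y≈x+z _ (*-nonNeg 0≤a (0≤x² (a - s * s)))
          (solve 2 (λ s a → a :* ((a :+ s :* s) :* (a :+ s :* s)) := ((a :+ a) :* s) :* ((a :+ a) :* s) :+ a :* ((a :- s :* s) :* (a :- s :* s))) refl s a))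

-- Squared distances and cubical grids.

module Geometry (em : ExcludedMiddle 0ℓ) (R : CompleteOrderedField) where
  open CompleteOrderedField R
  open AnnulusGraphs R
  open CommutativeRing commutativeRing
    using (refl; sym; trans; +-cong; *-cong; +-congˡ; +-congʳ; *-congˡ; *-congʳ; +-comm; +-identityʳ; *-identityˡ; -‿inverseʳ; zeroˡ; *-assoc)
  open Field em R
  open Solver commutativeRing
  open SumProperties semiring using (*-distribˡ-sum; ∑-distrib-+; sum-cong-≋)
  open import Relation.Binary.Reasoning.PartialOrder ≤-poset

  sum-mono : ∀ {d} {f g : Vector ℝ d} → (∀ i → f i ≤ g i) → sum f ≤ sum g
  sum-mono {zero}  f≤g = ≤-refl
  sum-mono {suc d} f≤g = +-mono-≤ (f≤g zero) (sum-mono (f≤g ∘ suc))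

  sum-nonNeg : ∀ {d} {f : Vector ℝ d} → (∀ i → 0# ≤ f i) → 0# ≤ sum f
  sum-nonNeg {zero}  0≤f = ≤-refl
  sum-nonNeg {suc d} 0≤f = 0≤+ (0≤f zero) (sum-nonNeg (0≤f ∘ suc))

  sum-1 : ∀ d → sum {d} (λ _ → 1#) ≈ fromℕ d
  sum-1 zero    = refl
  sum-1 (suc d) = +-congˡ (sum-1 d)

  fromℕ-sum : ∀ {d} (f : Fin d → ℕ) → fromℕ (Code.sum f) ≈ sum (fromℕ ∘ f)
  fromℕ-sum {zero}  f = refl
  fromℕ-sum {suc d} f = trans (fromℕ-+ (f zero) _) (+-congˡ (fromℕ-sum (f ∘ suc)))

  dist² : ∀ {d} → Vector ℝ d → Vector ℝ d → ℝ
  dist² p q = sumOfSquares (λ i → p i - q i)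

  dist²-nonNeg : ∀ {d} (p q : Vector ℝ d) → 0# ≤ dist² p q
  dist²-nonNeg p q = sum-nonNeg λ i → 0≤x² (p i - q i)

  dist²-refl : ∀ {d} (p : Vector ℝ d) → dist² p p ≤ 0#
  dist²-refl {zero}  p = ≤-refl
  dist²-refl {suc d} p = begin
    (p zero - p zero) * (p zero - p zero) + dist² (p ∘ suc) (p ∘ suc)
      ≤⟨ +-monoʳ-≤ _ (dist²-refl (p ∘ suc)) ⟩
    (p zero - p zero) * (p zero - p zero) + 0#
      ≈⟨ trans (+-identityʳ _) (trans (*-congʳ (-‿inverseʳ _)) (zeroˡ _)) ⟩
    0# ∎

  dist²-congˡ : ∀ {d} {p q : Vector ℝ d} (r : Vector ℝ d) → (∀ i → p i ≈ q i) → dist² p r ≈ dist² q r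
  dist²-congˡ {d} r p≈q = sum-cong-≋ {d} λ i → *-cong (+-congʳ (p≈q i)) (+-congʳ (p≈q i))

  dist²-sym : ∀ {d} (p q : Vector ℝ d) → dist² p q ≈ dist² q p
  dist²-sym {d} p q = sum-cong-≋ {d} λ i →
    solve 2 (λ x y → (x :- y) :* (x :- y) := (y :- x) :* (y :- x)) refl (p i) (q i)

  three : ∀ x → fromℕ 3 * x ≈ x + (x + x)
  three x = trans (*-congʳ (+-congˡ (+-congˡ (+-identityʳ 1#))))
    (trans (solve 2 (λ o x → (o :+ (o :+ o)) :* x := o :* x :+ (o :* x :+ o :* x)) refl 1# x)
           (+-cong (*-identityˡ x) (+-cong (*-identityˡ x) (*-identityˡ x))))

  -- A triangle inequality free of square roots: 3 (x² + y² + z²) - (x + y + z)² is the sum of the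
  -- squares of the three differences. Three distances of at most x still give exactly (3 x)².
  dist²-triangle : ∀ {d} (p q r s : Vector ℝ d) →
    dist² p s ≤ fromℕ 3 * (dist² p q + (dist² q r + dist² r s))
  dist²-triangle {d} p q r s = begin
    dist² p s
      ≤⟨ sum-mono coordinate ⟩
    sum (λ i → fromℕ 3 * (sq p q i + (sq q r i + sq r s i)))
      ≈⟨ *-distribˡ-sum (fromℕ 3) (λ i → sq p q i + (sq q r i + sq r s i)) ⟨
    fromℕ 3 * sum (λ i → sq p q i + (sq q r i + sq r s i))
      ≈⟨ *-congˡ (trans (∑-distrib-+ (sq p q) _) (+-congˡ (∑-distrib-+ (sq q r) (sq r s)))) ⟩
    fromℕ 3 * (dist² p q + (dist² q r + dist² r s)) ∎
    where
    sq : Vector ℝ d → Vector ℝ d → Fin d → ℝ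
    sq p q i = (p i - q i) * (p i - q i)
    coordinate : ∀ i → sq p s i ≤ fromℕ 3 * (sq p q i + (sq q r i + sq r s i))
    coordinate i = x≤y⇐y≈x+z
      ((x - y) * (x - y) + ((y - z) * (y - z) + (x - z) * (x - z)))
      (0≤+ (0≤x² _) (0≤+ (0≤x² _) (0≤x² _)))
      (trans (three _) (solve 4 (λ p q r s →
        let x = p :- q; y = q :- r; z = r :- s; t = x :* x :+ (y :* y :+ z :* z) in
        t :+ (t :+ t) :=
        (p :- s) :* (p :- s) :+ ((x :- y) :* (x :- y) :+ ((y :- z) :* (y :- z) :+ (x :- z) :* (x :- z))))
        refl (p i) (q i) (r i) (s i)))
      where
      x = p i - q i
      y = q i - r i
      z = r i - s i

  DistanceIn⇒ : ∀ {d R₁ R₂} (p q : Vector ℝ d) → 0# ≤ R₁ → DistanceIn[ R₁ , R₂ ] p q →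
                R₁ * R₁ ≤ dist² p q × dist² p q ≤ R₂ * R₂
  DistanceIn⇒ p q 0≤R₁ (r , (0≤r , r²≈) , R₁≤r , r≤R₂) =
    ≤-trans (square-mono 0≤R₁ R₁≤r) (≤-reflexive r²≈) , ≤-trans (≤-reflexive (sym r²≈)) (square-mono 0≤r r≤R₂)

  DistanceIn⇐ : ∀ {d R₁ R₂} (p q : Vector ℝ d) → 0# ≤ R₂ →
                R₁ * R₁ ≤ dist² p q → dist² p q ≤ R₂ * R₂ → DistanceIn[ R₁ , R₂ ] p q
  DistanceIn⇐ p q 0≤R₂ lower upper with r , 0≤r , r²≈ ← sqrt (dist² p q) (dist²-nonNeg p q) =
    r , (0≤r , r²≈) , square-cancel 0≤r (≤-trans lower (≤-reflexive (sym r²≈)))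
      , square-cancel 0≤R₂ (≤-trans (≤-reflexive r²≈) upper)

  -- 1 - (x - y)² is the product of 1 - (x - y) and 1 + (x - y), each written as a sum of two
  -- nonnegative differences.
  square-diff≤1 : ∀ {x y z} → z ≤ x → x ≤ 1# + z → z ≤ y → y ≤ 1# + z → (x - y) * (x - y) ≤ 1#
  square-diff≤1 {x} {y} {z} z≤x x≤ z≤y y≤ = 0≤y-x⇒x≤y (begin
    0#                                          ≤⟨ *-nonNeg (0≤+ (x≤y⇒0≤y-x x≤) (x≤y⇒0≤y-x z≤y)) (0≤+ (x≤y⇒0≤y-x y≤) (x≤y⇒0≤y-x z≤x)) ⟩
    (1# + z - x + (y - z)) * (1# + z - y + (x - z)) ≈⟨ solve 4 (λ o x y z → (o :+ z :- x :+ (y :- z)) :* (o :+ z :- y :+ (x :- z)) := o :* o :- (x :- y) :* (x :- y)) refl 1# x y z ⟩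
    1# * 1# - (x - y) * (x - y)                 ≈⟨ +-congʳ (*-identityˡ 1#) ⟩
    1# - (x - y) * (x - y)                      ∎)

  n≤n*n : ∀ n → n ℕ.≤ n ℕ.* n
  n≤n*n zero    = ℕ.z≤n
  n≤n*n (suc n) = ℕ.m≤m*n (suc n) (suc n)

  -- If the integer parts differ by e + 1, the numbers differ by at least e, and e ≤ e² for
  -- integers. This passes from Euclidean distance to the ℓ¹-norm that `Code.code-bound` measures.
  floor-diff-+ : ∀ n e {x y} → fromℕ (n ℕ.+ e) ≤ x → y ≤ 1# + fromℕ n →
                 fromℕ e ≤ 1# + (x - y) * (x - y)
  floor-diff-+ n zero    _ _ = 0≤+ 0≤1 (0≤x² _)
  floor-diff-+ n (suc e) {x} {y} n+e≤x y≤ = +-monoʳ-≤ 1# (begin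
    fromℕ e                ≤⟨ fromℕ-mono (n≤n*n e) ⟩
    fromℕ (e ℕ.* e)        ≈⟨ fromℕ-* e e ⟩
    fromℕ e * fromℕ e      ≤⟨ square-mono (0≤fromℕ e) e≤x-y ⟩
    (x - y) * (x - y)      ∎)
    where
    e≤x-y : fromℕ e ≤ x - y
    e≤x-y = +-cancelˡ-≤ y (begin
      y + fromℕ e                     ≤⟨ +-monoˡ-≤ (fromℕ e) y≤ ⟩
      1# + fromℕ n + fromℕ e          ≈⟨ solve 3 (λ o n e → o :+ n :+ e := n :+ (o :+ e)) refl 1# (fromℕ n) (fromℕ e) ⟩
      fromℕ n + (1# + fromℕ e)        ≈⟨ fromℕ-+ n (suc e) ⟨
      fromℕ (n ℕ.+ suc e)             ≤⟨ n+e≤x ⟩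
      x                               ≈⟨ solve 2 (λ x y → x := y :+ (x :- y)) refl x y ⟩
      y + (x - y)                     ∎)

  floor-diff : ∀ m n {x y} → fromℕ m ≤ x → x ≤ 1# + fromℕ m → fromℕ n ≤ y → y ≤ 1# + fromℕ n →
               fromℕ ℕ.∣ m - n ∣ ≤ 1# + (x - y) * (x - y)
  floor-diff m n {x} {y} m≤x x≤ n≤y y≤ with ℕ.≤-total n m
  ... | inj₁ n≤m = floor-diff-+ n ℕ.∣ m - n ∣
    (≤-trans (fromℕ-mono (ℕ.≤-reflexive (≡.trans (≡.cong (n ℕ.+_) (ℕ.m≤n⇒∣n-m∣≡n∸m n≤m)) (ℕ.m+[n∸m]≡n n≤m)))) m≤x) y≤
  ... | inj₂ m≤n = ≤-trans (floor-diff-+ m ℕ.∣ m - n ∣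
    (≤-trans (fromℕ-mono (ℕ.≤-reflexive (≡.trans (≡.cong (m ℕ.+_) (ℕ.m≤n⇒∣m-n∣≡n∸m m≤n)) (ℕ.m+[n∸m]≡n m≤n)))) n≤y) x≤)
    (+-monoʳ-≤ 1# (≤-reflexive (solve 2 (λ x y → (y :- x) :* (y :- x) := (x :- y) :* (x :- y)) refl x y)))

  -- `cell` names a cube absolutely, by a number without a useful bound; `code v` names it relative
  -- to the cube of v, so that the names of cubes within distance 3 a of v are bounded in terms of d
  -- alone.
  record Cells {n d} (p : Fin n → Vector ℝ d) (a : ℝ) : Set where
    field
      cell       : Fin n → ℕ
      code       : Fin n → Fin n → ℕ
      cell⇒close : ∀ u v → cell u ≡ cell v → dist² (p u) (p v) < a * a
      code⇒cell  : ∀ v u w → code v u ≡ code v w → cell u ≡ cell w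
      code-bound : ∀ v u → dist² (p v) (p u) ≤ fromℕ 9 * (a * a) → code v u ℕ.< 2 ℕ.^ (39 ℕ.* d)

  -- The cells are cubes of side a / k with d < k² ≤ 4d, in a grid translated into the positive orthant.
  cells : ∀ {n d} (p : Fin n → Vector ℝ d) {a} → 0# < a → 1 ℕ.≤ d → Cells p a
  cells {n} {d} p {a} 0<a 1≤d = record
    { cell       = λ u → Code.code (λ _ → 0) (z u)
    ; code       = λ v u → Code.code (z v) (z u)
    ; cell⇒close = λ u v e → close u v (Code.code-injective (λ _ → 0) (z u) (z v) e)
    ; code⇒cell  = λ v u w e → Code.code-cong (λ _ → 0) (Code.code-injective (z v) (z u) (z w) e)
    ; code-bound = λ v u near → ℕ.<-≤-trans (Code.code-bound (z v) (z u))
        (ℕ.^-monoʳ-≤ 2 (ℕ.≤-trans (ℕ.+-monoˡ-≤ (2 ℕ.* d) (near-cells v u near))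
          (ℕ.≤-reflexive (≡.sym (ℕ.*-distribʳ-+ d 37 2)))))
    }
    where
    k = proj₁ (Code.squareBetween d 1≤d)
    d<k² = proj₁ (proj₂ (Code.squareBetween d 1≤d))
    k²≤4d = proj₂ (proj₂ (Code.squareBetween d 1≤d))
    -- Scaling by κ turns the cubes into unit cubes, which are told apart by integer parts.
    κ = fromℕ k / a
    κa≈k : κ * a ≈ fromℕ k
    κa≈k = x/y*y (fromℕ k) 0<a
    depth : Fin n → Fin d → ℕ
    depth v i = proj₁ (archimedean (- (κ * p v i)))
    depths : ∃[ B ] (∀ v → proj₁ (Code.max (depth v)) ℕ.≤ B)
    depths = Code.max (λ v → proj₁ (Code.max (depth v)))
    B = proj₁ depths
    s : Fin n → Fin d → ℝ
    s v i = fromℕ B + κ * p v i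
    0≤s : ∀ v i → 0# ≤ s v i
    0≤s v i = begin
      0#                              ≈⟨ -‿inverseʳ _ ⟨
      κ * p v i - κ * p v i           ≈⟨ +-comm _ _ ⟩
      - (κ * p v i) + κ * p v i       ≤⟨ +-monoˡ-≤ _ (proj₂ (archimedean (- (κ * p v i)))) ⟩
      fromℕ (depth v i) + κ * p v i   ≤⟨ +-monoˡ-≤ _ (fromℕ-mono (ℕ.≤-trans (proj₂ (Code.max (depth v)) i) (proj₂ depths v))) ⟩
      fromℕ B + κ * p v i             ∎
    z : Fin n → Fin d → ℕ
    z v i = proj₁ (floor (s v i) (0≤s v i))
    z≤s : ∀ v i → fromℕ (z v i) ≤ s v i
    z≤s v i = proj₁ (proj₂ (floor (s v i) (0≤s v i)))
    s≤1+z : ∀ v i → s v i ≤ 1# + fromℕ (z v i)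
    s≤1+z v i = proj₁ (proj₂ (proj₂ (floor (s v i) (0≤s v i))))
    s-dist² : ∀ u v → dist² (s u) (s v) ≈ (κ * κ) * dist² (p u) (p v)
    s-dist² u v = trans (sum-cong-≋ {d} λ i →
      solve 4 (λ B κ x y → ((B :+ κ :* x) :- (B :+ κ :* y)) :* ((B :+ κ :* x) :- (B :+ κ :* y)) := (κ :* κ) :* ((x :- y) :* (x :- y)))
        refl (fromℕ B) κ (p u i) (p v i))
      (sym (*-distribˡ-sum (κ * κ) (λ i → (p u i - p v i) * (p u i - p v i))))
    κ²a² : (κ * κ) * (a * a) ≈ fromℕ (k ℕ.* k)
    κ²a² = trans (solve 2 (λ κ a → (κ :* κ) :* (a :* a) := (κ :* a) :* (κ :* a)) refl κ a)
             (trans (*-cong κa≈k κa≈k) (sym (fromℕ-* k k)))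
    close : ∀ u v → z u ≗ z v → dist² (p u) (p v) < a * a
    close u v zu≗zv = ≰⇒< λ a²≤D → <⇒≰ (fromℕ-<-mono d<k²) (begin
      fromℕ (k ℕ.* k)                 ≈⟨ κ²a² ⟨
      (κ * κ) * (a * a)               ≤⟨ *-monoʳ-≤ (0≤x² κ) a²≤D ⟩
      (κ * κ) * dist² (p u) (p v)     ≈⟨ s-dist² u v ⟨
      dist² (s u) (s v)               ≤⟨ sum-mono (λ i → square-diff≤1 (z≤s u i) (s≤1+z u i)
                                           (≡.subst (λ z → fromℕ z ≤ s v i) (≡.sym (zu≗zv i)) (z≤s v i))
                                           (≡.subst (λ z → s v i ≤ 1# + fromℕ z) (≡.sym (zu≗zv i)) (s≤1+z v i))) ⟩
      sum {d} (λ _ → 1#)              ≈⟨ sum-1 d ⟩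
      fromℕ d                         ∎)
    -- The distance 3 a becomes 3 k after scaling, so the ℓ¹-norm is at most d + 9 k² ≤ d + 36 d.
    -- With the two marker digits per coordinate this gives the exponent 39 d.
    near-cells : ∀ v u → dist² (p v) (p u) ≤ fromℕ 9 * (a * a) →
                 Code.sum (λ i → ℕ.∣ z u i - z v i ∣) ℕ.≤ 37 ℕ.* d
    near-cells v u near = fromℕ-cancel _ _ (begin
      fromℕ (Code.sum (λ i → ℕ.∣ z u i - z v i ∣))    ≈⟨ fromℕ-sum {d} _ ⟩
      sum (λ i → fromℕ ℕ.∣ z u i - z v i ∣)        ≤⟨ sum-mono (λ i → floor-diff (z u i) (z v i) (z≤s u i) (s≤1+z u i) (z≤s v i) (s≤1+z v i)) ⟩
      sum (λ i → 1# + (s u i - s v i) * (s u i - s v i))  ≈⟨ trans (∑-distrib-+ {d} (λ _ → 1#) _) (+-congʳ (sum-1 d)) ⟩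
      fromℕ d + dist² (s u) (s v)                  ≈⟨ +-congˡ (trans (dist²-sym (s u) (s v)) (s-dist² v u)) ⟩
      fromℕ d + (κ * κ) * dist² (p v) (p u)        ≤⟨ +-monoʳ-≤ _ (*-monoʳ-≤ (0≤x² κ) near) ⟩
      fromℕ d + (κ * κ) * (fromℕ 9 * (a * a))      ≈⟨ +-congˡ (trans (solve 3 (λ κ n a → (κ :* κ) :* (n :* (a :* a)) := n :* ((κ :* κ) :* (a :* a))) refl κ (fromℕ 9) a)
                                                        (trans (*-congˡ κ²a²) (sym (fromℕ-* 9 (k ℕ.* k))))) ⟩
      fromℕ d + fromℕ (9 ℕ.* (k ℕ.* k))            ≈⟨ fromℕ-+ d _ ⟨
      fromℕ (d ℕ.+ 9 ℕ.* (k ℕ.* k))                ≤⟨ fromℕ-mono (ℕ.+-monoʳ-≤ d (ℕ.≤-trans (ℕ.*-monoʳ-≤ 9 k²≤4d) (ℕ.≤-reflexive (≡.sym (ℕ.*-assoc 9 4 d))))) ⟩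
      fromℕ (37 ℕ.* d)                             ∎)

-- Colouring unit disc and annulus graphs.

module Upper (em : ExcludedMiddle 0ℓ) (R : CompleteOrderedField) where
  open CompleteOrderedField R
  open AnnulusGraphs R
  open FiniteSimpleGraph
  open CommutativeRing commutativeRing
    using (sym; trans; *-congˡ; *-congʳ; *-identityˡ; *-identityʳ; zeroˡ; *-assoc)
  open Field em R
  open Geometry em R
  open Counting em
  open Graphs em
  open import Relation.Binary.Reasoning.PartialOrder ≤-poset

  ≤9* : ∀ {x} → 0# ≤ x → x ≤ fromℕ 9 * x
  ≤9* {x} 0≤x = ≤-trans (≤-reflexive (trans (sym (*-identityˡ x)) (*-congʳ (sym fromℕ-1))))
                        (*-monoˡ-≤ 0≤x (fromℕ-mono {1} {9} (ℕ.s≤s ℕ.z≤n)))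

  edge⇒distance : ∀ {d R₁ R₂ G} (G∈ : 𝒜 d R₁ R₂ G) u v → Edge G u v → DistanceIn[ R₁ , R₂ ] (proj₁ G∈ u) (proj₁ G∈ v)
  edge⇒distance {G = G} (f , _ , edges) u v e = Equivalence.to (edges u v (edge⇒≢ G u v e)) e

  unitDisc-colorable : ∀ {d G ω} → 1 ℕ.≤ d → 𝒜 d 0# 1# G → IsCliqueNumber G ω → Colorable G (2 ℕ.^ (39 ℕ.* d) ℕ.* ω)
  unitDisc-colorable {d} {G} {ω} 1≤d G∈@(f , _ , edges) isω
    = colorable G (proj₁ colouring) (λ v → proj₁ (proj₂ colouring) v tt) λ u v e →
        proj₂ (proj₂ colouring) u v tt tt (edge⇒≢ G u v e) (proj₂ (DistanceIn⇒ (f u) (f v) ≤-refl (edge⇒distance {G = G} G∈ u v e)))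
    where
    open Cells (cells f 0<1 1≤d)
    near : Vertex G → Vertex G → Set
    near u v = dist² (f u) (f v) ≤ 1# * 1#
    near-refl : ∀ u → near u u
    near-refl u = ≤-trans (dist²-refl (f u)) (0≤x² 1#)
    near-sym : ∀ u v → near u v → near v u
    near-sym u v = ≤-trans (≤-reflexive (dist²-sym (f v) (f u)))
    degree : ∀ v → ⊤ → # (λ u → ⊤ × near v u) ℕ.≤ 2 ℕ.^ (39 ℕ.* d) ℕ.* ω
    degree v _ = #-fibres (code v) _ ω (λ { u (_ , D≤1) → code-bound v u (≤-trans D≤1 (≤9* (0≤x² 1#))) }) λ j →
      clique≤ω G isω (λ u → (⊤ × near v u) × code v u ≡ j) λ { u w (_ , cu) (_ , cw) u≢w →
        Equivalence.from (edges u w u≢w) (DistanceIn⇐ (f u) (f w) 0≤1 (≤-trans (≤-reflexive (zeroˡ 0#)) (dist²-nonNeg (f u) (f w)))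
          (proj₁ (cell⇒close u w (code⇒cell v u w (≡.trans cu (≡.sym cw)))))) }

    colouring = greedyColouring (λ _ → ⊤) near (2 ℕ.^ (39 ℕ.* d) ℕ.* ω) near-refl near-sym degree

  annulus-colorable : ∀ {d x G ω} → 1 ℕ.≤ d → 1# ≤ x → 𝒜 d 1# x G → IsCliqueNumber G ω →
                      Colorable G (2 ℕ.^ (39 ℕ.* d) ℕ.* (2 ℕ.^ (39 ℕ.* d) ℕ.* ω))
  annulus-colorable {d} {x} {G} {ω} 1≤d 1≤x G∈@(f , _ , edges) isω = colour
    where
    K = 2 ℕ.^ (39 ℕ.* d)
    module Small = Cells (cells f 0<1 1≤d)
    0<x : 0# < x
    0<x = <-≤-trans 0<1 1≤x
    module Big = Cells (cells f 0<x 1≤d)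
    reps = representatives Small.cell
    rep = proj₁ reps
    rep-cell = proj₁ (proj₂ reps)
    rep-cong = proj₂ (proj₂ reps)
    isRep : Vertex G → Set
    isRep u = rep u ≡ u
    rep-isRep : ∀ u → isRep (rep u)
    rep-isRep u = rep-cong (rep u) u (rep-cell u)
    rep-close : ∀ u → dist² (f u) (f (rep u)) < 1# * 1#
    rep-close u = Small.cell⇒close u (rep u) (≡.sym (rep-cell u))
    D : Vertex G → Vertex G → ℝ
    D u v = dist² (f u) (f v)

    close : Vertex G → Vertex G → Set
    close u v = D u v < 1# * 1#
    close-sym : ∀ u v → close u v → close v u
    close-sym u v = ≤-<-trans (≤-reflexive (dist²-sym (f v) (f u)))
    close-refl : ∀ u → close u u
    close-refl u = ≤-<-trans (dist²-refl (f u)) (*-pos 0<1 0<1)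
    -- A small cube contains a single representative, so each code is used at most once.
    close-degree : ∀ v → isRep v → # (λ u → isRep u × close v u) ℕ.≤ K
    close-degree v _ = ℕ.≤-trans (#-fibres (Small.code v) K 1
      (λ { u (_ , D<1) → Small.code-bound v u (≤-trans (proj₁ D<1) (≤9* (0≤x² 1#))) })
      λ j → #-unique λ { u w ((ru , _) , cu) ((rw , _) , cw) →
        ≡.trans (≡.sym ru) (≡.trans (rep-cong u w (Small.code⇒cell v u w (≡.trans cu (≡.sym cw)))) rw) })
      (ℕ.≤-reflexive (ℕ.*-identityʳ K))
    close-colouring = greedyColouring isRep close K close-refl close-sym close-degree
    c₁ = proj₁ close-colouring
    c₁<K = proj₁ (proj₂ close-colouring)
    c₁-proper = proj₂ (proj₂ close-colouring)

    far : Vertex G → Vertex G → Set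
    far u v = D u v ≤ fromℕ 9 * (x * x)
    far-refl : ∀ u → far u u
    far-refl u = ≤-trans (dist²-refl (f u)) (*-nonNeg (0≤fromℕ 9) (0≤x² x))
    far-sym : ∀ u v → far u v → far v u
    far-sym u v = ≤-trans (≤-reflexive (dist²-sym (f v) (f u)))
    far-degree : ∀ v → isRep v → # (λ u → isRep u × far v u) ℕ.≤ K ℕ.* (K ℕ.* ω)
    far-degree v _ = #-fibres (Big.code v) K (K ℕ.* ω) (λ { u (_ , D≤) → Big.code-bound v u D≤ }) λ j →
      #-fibres c₁ K ω (λ { u ((ru , _) , _) → c₁<K u ru }) λ i →
      clique≤ω G isω (λ u → ((isRep u × far v u) × Big.code v u ≡ j) × c₁ u ≡ i)
        λ { u w (((ru , _) , bu) , cu) (((rw , _) , bw) , cw) u≢w →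
          Equivalence.from (edges u w u≢w) (DistanceIn⇐ (f u) (f w) (proj₁ 0<x)
            (≮⇒≥ (λ D<1 → c₁-proper u w ru rw u≢w D<1 (≡.trans cu (≡.sym cw))))
            (proj₁ (Big.cell⇒close u w (Big.code⇒cell v u w (≡.trans bu (≡.sym bw)))))) }
    colour : Colorable G (K ℕ.* (K ℕ.* ω))
    colour = colorable G (c ∘ rep) (λ v → bound (rep v) (rep-isRep v)) λ u v e →
      proper (rep u) (rep v) (rep-isRep u) (rep-isRep v) (rep≢ u v e) (rep-far u v e)
      where
      colouring = greedyColouring isRep far (K ℕ.* (K ℕ.* ω)) far-refl far-sym far-degree
      c = proj₁ colouring
      bound = proj₁ (proj₂ colouring)
      proper = proj₂ (proj₂ colouring)
      -- Vertices of one small cube are less than 1 apart and so never adjacent; an edge therefore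
      -- leads to two different representatives.
      rep≢ : ∀ u v → Edge G u v → rep u ≢ rep v
      rep≢ u v e ru≡rv = <⇒≰
        (Small.cell⇒close u v (≡.trans (≡.sym (rep-cell u)) (≡.trans (≡.cong Small.cell ru≡rv) (rep-cell v))))
        (proj₁ (DistanceIn⇒ (f u) (f v) 0≤1 (edge⇒distance {G = G} G∈ u v e)))
      1≤x² : 1# * 1# ≤ x * x
      1≤x² = square-mono 0≤1 1≤x
      -- Passing to representatives moves each end by less than 1 ≤ x, so ends at most x apart stay
      -- within 3 x.
      rep-far : ∀ u v → Edge G u v → far (rep u) (rep v)
      rep-far u v e = begin
        D (rep u) (rep v)                                        ≤⟨ dist²-triangle (f (rep u)) (f u) (f v) (f (rep v)) ⟩
        fromℕ 3 * (D (rep u) u + (D u v + D v (rep v)))          ≤⟨ *-monoʳ-≤ (0≤fromℕ 3) (+-mono-≤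
            (≤-trans (≤-reflexive (dist²-sym (f (rep u)) (f u))) (≤-trans (proj₁ (rep-close u)) 1≤x²))
            (+-mono-≤ (proj₂ (DistanceIn⇒ (f u) (f v) 0≤1 (edge⇒distance {G = G} G∈ u v e))) (≤-trans (proj₁ (rep-close v)) 1≤x²))) ⟩
        fromℕ 3 * (x * x + (x * x + x * x))                      ≈⟨ *-congˡ (three (x * x)) ⟨
        fromℕ 3 * (fromℕ 3 * (x * x))                            ≈⟨ *-assoc _ _ _ ⟨
        fromℕ 3 * fromℕ 3 * (x * x)                              ≈⟨ *-congʳ (fromℕ-* 3 3) ⟨
        fromℕ 9 * (x * x)                                        ∎

-- Embedding integer point sets by scaling.

module Realisations (em : ExcludedMiddle 0ℓ) (R : CompleteOrderedField) where
  open CompleteOrderedField R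
  open AnnulusGraphs R
  open FiniteSimpleGraph
  open CommutativeRing commutativeRing
    using (refl; sym; trans; reflexive; *-cong; *-congˡ; *-congʳ; +-identityˡ; *-identityˡ; zeroˡ)
  open Field em R
  open Geometry em R
  open PointGraphs using (sqDist)
  open Graphs em
  open Solver commutativeRing
  open SumProperties semiring using (*-distribˡ-sum; sum-cong-≋)
  open import Relation.Binary.Reasoning.PartialOrder ≤-poset

  fromℕ-cong : ∀ {m n} → m ≡ n → fromℕ m ≈ fromℕ n
  fromℕ-cong m≡n = reflexive (≡.cong fromℕ m≡n)

  fromℕ-∣-∣² : ∀ m n → (fromℕ m - fromℕ n) * (fromℕ m - fromℕ n) ≈ fromℕ (ℕ.∣ m - n ∣ ℕ.* ℕ.∣ m - n ∣)
  fromℕ-∣-∣² zero n = trans (*-cong (+-identityˡ _) (+-identityˡ _))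
    (trans (solve 1 (λ x → (:- x) :* (:- x) := x :* x) refl (fromℕ n)) (sym (fromℕ-* n n)))
  fromℕ-∣-∣² (suc m) zero = trans
    (solve 2 (λ x y → (x :- y) :* (x :- y) := (y :- x) :* (y :- x)) refl (fromℕ (suc m)) (fromℕ 0))
    (fromℕ-∣-∣² zero (suc m))
  fromℕ-∣-∣² (suc m) (suc n) = trans
    (solve 3 (λ o x y → ((o :+ x) :- (o :+ y)) :* ((o :+ x) :- (o :+ y)) := (x :- y) :* (x :- y)) refl 1# (fromℕ m) (fromℕ n))
    (fromℕ-∣-∣² m n)

  -- The condition R₁² ≤ (a / b) s ≤ R₂² cleared of its denominator.
  InRange : ℕ → ℕ → ℝ → ℝ → ℕ → Set
  InRange a b R₁ R₂ s = R₁ * R₁ * fromℕ b ≤ fromℕ (a ℕ.* s) × fromℕ (a ℕ.* s) ≤ R₂ * R₂ * fromℕ b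

  module Realisation {d} (G : FiniteSimpleGraph) (p : Vertex G → Fin d → ℕ) (a b : ℕ) .{{_ : NonZero a}} .{{_ : NonZero b}} where
    private
      κ = fromℕ a / fromℕ b
      0<κ : 0# < κ
      0<κ = 0</ (0<fromℕ a) (0<fromℕ b)
      -- Only the square of the scale is rational in general; for the annulus cube it is 4 / (3 d).
      root : ∃[ σ ] (0# ≤ σ × σ * σ ≈ κ)
      root = sqrt κ (proj₁ 0<κ)
      σ = proj₁ root
      f : Vertex G → Vector ℝ d
      f u i = σ * fromℕ (p u i)

    κ*b : ∀ s → κ * fromℕ s * fromℕ b ≈ fromℕ (a ℕ.* s)
    κ*b s = trans (solve 3 (λ κ s b → κ :* s :* b := κ :* b :* s) refl κ (fromℕ s) (fromℕ b))
      (trans (*-congʳ (x/y*y _ (0<fromℕ b))) (sym (fromℕ-* a s)))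

    dist²-f : ∀ u v → dist² (f u) (f v) ≈ κ * fromℕ (sqDist (p u) (p v))
    dist²-f u v = trans (sum-cong-≋ {d} λ i → trans
        (solve 3 (λ σ x y → (σ :* x :- σ :* y) :* (σ :* x :- σ :* y) := (σ :* σ) :* ((x :- y) :* (x :- y))) refl σ (fromℕ (p u i)) (fromℕ (p v i)))
        (*-cong (proj₂ (proj₂ root)) (fromℕ-∣-∣² (p u i) (p v i))))
      (trans (sym (*-distribˡ-sum {d} κ _)) (*-congˡ (sym (fromℕ-sum {d} _))))

    scaled : ∀ u v → dist² (f u) (f v) * fromℕ b ≈ fromℕ (a ℕ.* sqDist (p u) (p v))
    scaled u v = trans (*-congʳ (dist²-f u v)) (κ*b (sqDist (p u) (p v)))

    0<b : 0# < fromℕ b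
    0<b = 0<fromℕ b

    0<dist² : ∀ u v → 0 ℕ.< sqDist (p u) (p v) → 0# < dist² (f u) (f v)
    0<dist² u v 0<s = <-≤-trans (*-pos 0<κ 0<s′) (≤-reflexive (sym (dist²-f u v)))
      where
      0<s′ : 0# < fromℕ (sqDist (p u) (p v))
      0<s′ = 0<fromℕ (sqDist (p u) (p v)) {{ℕ.>-nonZero 0<s}}

    injective : (∀ u v → u ≢ v → 0 ℕ.< sqDist (p u) (p v)) → ∀ u v → (∀ i → f u i ≈ f v i) → u ≡ v
    injective distinct u v fu≈fv = decidable-stable em λ u≢v → <⇒≰ (0<dist² u v (distinct u v u≢v)) coincide
      where
      coincide : dist² (f u) (f v) ≤ 0#
      coincide = ≤-trans (≤-reflexive (dist²-congˡ {p = f u} {f v} (f v) fu≈fv)) (dist²-refl (f v))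

    realise : ∀ {R₁ R₂} → 0# ≤ R₁ → 0# ≤ R₂ → (∀ u v → u ≢ v → 0 ℕ.< sqDist (p u) (p v)) →
              (∀ u v → u ≢ v → Edge G u v ⇔ InRange a b R₁ R₂ (sqDist (p u) (p v))) → 𝒜 d R₁ R₂ G
    realise {R₁} {R₂} 0≤R₁ 0≤R₂ distinct edges =
      f , (λ {u} {v} → injective distinct u v) , λ u v u≢v → mk⇔ (to u v u≢v) (from u v u≢v)
      where
      to : ∀ u v → u ≢ v → Edge G u v → DistanceIn[ R₁ , R₂ ] (f u) (f v)
      to u v u≢v e = DistanceIn⇐ (f u) (f v) 0≤R₂
        (*-cancelʳ-≤ 0<b (≤-trans (proj₁ range) (≤-reflexive (sym (scaled u v)))))
        (*-cancelʳ-≤ 0<b (≤-trans (≤-reflexive (scaled u v)) (proj₂ range)))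
        where
        range : InRange a b R₁ R₂ (sqDist (p u) (p v))
        range = Equivalence.to (edges u v u≢v) e
      from : ∀ u v → u ≢ v → DistanceIn[ R₁ , R₂ ] (f u) (f v) → Edge G u v
      from u v u≢v D = Equivalence.from (edges u v u≢v)
        ( ≤-trans (*-monoˡ-≤ (proj₁ 0<b) (proj₁ bounds)) (≤-reflexive (scaled u v))
        , ≤-trans (≤-reflexive (sym (scaled u v))) (*-monoˡ-≤ (proj₁ 0<b) (proj₂ bounds)))
        where
        bounds : R₁ * R₁ ≤ dist² (f u) (f v) × dist² (f u) (f v) ≤ R₂ * R₂
        bounds = DistanceIn⇒ (f u) (f v) 0≤R₁ D

  1*1*x : ∀ x → 1# * 1# * x ≈ x
  1*1*x x = trans (*-congʳ (*-identityˡ 1#)) (*-identityˡ x)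

  inDiscRange : ∀ a b s → a ℕ.* s ℕ.≤ b → InRange a b 0# 1# s
  inDiscRange a b s as≤b =
    ≤-trans (≤-reflexive (trans (*-congʳ (zeroˡ 0#)) (zeroˡ (fromℕ b)))) (0≤fromℕ (a ℕ.* s)) ,
    ≤-trans (fromℕ-mono as≤b) (≤-reflexive (sym (1*1*x (fromℕ b))))

  discRange⇒ : ∀ a b s → InRange a b 0# 1# s → a ℕ.* s ℕ.≤ b
  discRange⇒ a b s (_ , as≤b) = fromℕ-cancel (a ℕ.* s) b (≤-trans as≤b (≤-reflexive (1*1*x (fromℕ b))))

  inAnnulusRange : ∀ a b {x} s → b ℕ.≤ a ℕ.* s → fromℕ (a ℕ.* s) ≤ x * x * fromℕ b → InRange a b 1# x s
  inAnnulusRange a b s b≤as upper = ≤-trans (≤-reflexive (1*1*x (fromℕ b))) (fromℕ-mono b≤as) , upper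

  annulusRange⇒ : ∀ a b {x} s → InRange a b 1# x s → b ℕ.≤ a ℕ.* s
  annulusRange⇒ a b s (lower , _) = fromℕ-cancel b (a ℕ.* s) (≤-trans (≤-reflexive (sym (1*1*x (fromℕ b)))) lower)

-- Suprema, embedded examples and the final constants.

module Theorem (em : ExcludedMiddle 0ℓ) (R : CompleteOrderedField) where
  open CompleteOrderedField R
  open AnnulusGraphs R
  open FiniteSimpleGraph
  open CommutativeRing commutativeRing
    using (refl; sym; trans; *-cong; +-congˡ; *-congˡ; *-congʳ; *-comm; +-identityˡ; +-identityʳ; *-identityˡ; *-identityʳ; *-assoc)
  open Exponential
  open PointGraphs
  open Hypercube
  open OddCycles
  open Field em R
  open Geometry em R
  open Graphs em
  open Cube em
  open Upper em R
  open Realisations em R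
  open Solver commutativeRing
  open import Relation.Binary.Reasoning.PartialOrder ≤-poset

  -- Completeness requires the ratios to be bounded, so a colouring with B ω colours gives both the
  -- existence of the supremum and its bound.
  sup-exists : ∀ (𝒢 : FiniteSimpleGraph → Set) B → (∃[ G ] (𝒢 G × NonZero (order G))) →
               (∀ G ω → 𝒢 G → IsCliqueNumber G ω → Colorable G (B ℕ.* ω)) →
               ∃[ s ] (IsSup-χ/ω 𝒢 s × s ≤ fromℕ B)
  sup-exists 𝒢 B (G , G∈ , nz) colour = proj₁ supremum , proj₂ supremum , proj₂ (proj₂ supremum) (fromℕ B) bound
    where
    bound : IsUpperBound (χ/ω-Ratios 𝒢) (fromℕ B)
    bound r (G , G∈ , nz , χ , ω , (_ , minimal) , isω , r≈) = ≤-trans (≤-reflexive r≈)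
      (/-≤ (0<fromℕ ω {{0<cliqueNumber G nz isω}})
        (≤-trans (fromℕ-mono (minimal (B ℕ.* ω) (colour G ω G∈ isω))) (≤-reflexive (fromℕ-* B ω))))
    χ = chromaticNumber G
    ω = cliqueNumber G
    supremum : ∃[ s ] IsSup-χ/ω 𝒢 s
    supremum = complete (χ/ω-Ratios 𝒢)
      (fromℕ (proj₁ χ) / fromℕ (proj₁ ω) , G , G∈ , nz , proj₁ χ , proj₁ ω , proj₂ χ , proj₂ ω , refl)
      (fromℕ B , bound)

  ratio≤sup : ∀ (𝒢 : FiniteSimpleGraph → Set) G {s y} P Q → .{{NonZero Q}} → IsSup-χ/ω 𝒢 s → 𝒢 G → NonZero (order G) →
              y * fromℕ Q ≤ fromℕ P →
              (∀ χ ω → Colorable G χ → IsCliqueNumber G ω → P ℕ.* ω ℕ.≤ Q ℕ.* χ) → y ≤ s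
  ratio≤sup 𝒢 G {s} {y} P Q (upper , _) G∈ nz yQ≤P Pω≤Qχ = ≤-trans
    (≤-/ (0<fromℕ ω {{0<cliqueNumber G nz isω}}) (*-cancelʳ-≤ (0<fromℕ Q) (begin
      y * fromℕ ω * fromℕ Q    ≈⟨ solve 3 (λ y ω Q → y :* ω :* Q := y :* Q :* ω) refl y (fromℕ ω) (fromℕ Q) ⟩
      y * fromℕ Q * fromℕ ω    ≤⟨ *-monoˡ-≤ (0≤fromℕ ω) yQ≤P ⟩
      fromℕ P * fromℕ ω        ≈⟨ fromℕ-* P ω ⟨
      fromℕ (P ℕ.* ω)          ≤⟨ fromℕ-mono (Pω≤Qχ χ ω (proj₁ isχ) isω) ⟩
      fromℕ (Q ℕ.* χ)          ≈⟨ fromℕ-* Q χ ⟩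
      fromℕ Q * fromℕ χ        ≈⟨ *-comm _ _ ⟩
      fromℕ χ * fromℕ Q        ∎)))
    (upper (fromℕ χ / fromℕ ω) (G , G∈ , nz , χ , ω , isχ , isω , refl))
    where
    χ ω : ℕ
    χ = proj₁ (chromaticNumber G)
    ω = proj₁ (cliqueNumber G)
    isχ : IsChromaticNumber G χ
    isχ = proj₂ (chromaticNumber G)
    isω : IsCliqueNumber G ω
    isω = proj₂ (cliqueNumber G)

  C₅-χ : ∀ {χ} → Colorable C₅ χ → 3 ℕ.≤ χ
  C₅-χ c = 3≤χ C₅ c C₅-¬2-colorable

  C₅-ω : ∀ {ω} → IsCliqueNumber C₅ ω → ω ℕ.≤ 2
  C₅-ω isω = ω≤2 C₅ isω C₅-triangleFree

  C₅-realise : ∀ {d} (p : Fin 5 → Fin d → ℕ) a b .{{_ : NonZero a}} .{{_ : NonZero b}} {R₁ R₂} → 0# ≤ R₁ → 0# ≤ R₂ →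
    (∀ u → 0 ℕ.< sqDist (p u) (p (next u))) → (∀ u → 0 ℕ.< sqDist (p u) (p (next (next u)))) →
    (∀ u → InRange a b R₁ R₂ (sqDist (p u) (p (next u)))) → (∀ u → ¬ InRange a b R₁ R₂ (sqDist (p u) (p (next (next u))))) →
    𝒜 d R₁ R₂ C₅
  C₅-realise p a b {R₁} {R₂} 0≤R₁ 0≤R₂ near-pos far-pos near far = Realisation.realise C₅ p a b 0≤R₁ 0≤R₂
    (C₅-pairs (λ u v → 0 ℕ.< sqDist (p u) (p v)) (λ u v → ≡.subst (0 ℕ.<_) (sqDist-sym (p u) (p v))) near-pos far-pos)
    (C₅-edges (λ u v → InRange a b R₁ R₂ (sqDist (p u) (p v)))
      (λ u v → ≡.subst (InRange a b R₁ R₂) (sqDist-sym (p u) (p v))) near far)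

  pad : ∀ {d} → (Fin 2 → ℕ) → Fin (2 ℕ.+ d) → ℕ
  pad p 0F            = p 0F
  pad p 1F            = p 1F
  pad p (suc (suc _)) = 0

  sqDist-pad : ∀ {d} p q → sqDist {2 ℕ.+ d} (pad p) (pad q) ≡ sqDist p q
  sqDist-pad {d} p q = ≡.cong (λ s → ℕ.∣ p 0F - q 0F ∣ ℕ.* ℕ.∣ p 0F - q 0F ∣ ℕ.+ (ℕ.∣ p 1F - q 1F ∣ ℕ.* ℕ.∣ p 1F - q 1F ∣ ℕ.+ s))
    (sqDist-refl {d} (λ _ → 0))

  C₅-realise-pad : ∀ {d} (p : Fin 5 → Fin 2 → ℕ) a b .{{_ : NonZero a}} .{{_ : NonZero b}} {R₁ R₂} → 0# ≤ R₁ → 0# ≤ R₂ →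
    (∀ u → 0 ℕ.< sqDist (p u) (p (next u))) → (∀ u → 0 ℕ.< sqDist (p u) (p (next (next u)))) →
    (∀ u → InRange a b R₁ R₂ (sqDist (p u) (p (next u)))) → (∀ u → ¬ InRange a b R₁ R₂ (sqDist (p u) (p (next (next u))))) →
    𝒜 (2 ℕ.+ d) R₁ R₂ C₅
  C₅-realise-pad {d} p a b {R₁} {R₂} 0≤R₁ 0≤R₂ near-pos far-pos near far = C₅-realise (λ u → pad (p u)) a b 0≤R₁ 0≤R₂
    (λ u → ≡.subst (0 ℕ.<_) (padded u (next u)) (near-pos u))
    (λ u → ≡.subst (0 ℕ.<_) (padded u (next (next u))) (far-pos u))
    (λ u → ≡.subst (InRange a b R₁ R₂) (padded u (next u)) (near u))
    (λ u → far u ∘ ≡.subst (InRange a b R₁ R₂) (≡.sym (padded u (next (next u)))))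
    where
    padded : ∀ u v → sqDist (p u) (p v) ≡ sqDist {2 ℕ.+ d} (pad (p u)) (pad (p v))
    padded u v = ≡.sym (sqDist-pad {d} (p u) (p v))

  0<1*s : ∀ {s} → 0 ℕ.< 1 ℕ.* s → 0 ℕ.< s
  0<1*s {s} = ≡.subst (0 ℕ.<_) (ℕ.*-identityˡ s)

  pentagon-disc : ∀ d → 𝒜 (2 ℕ.+ d) 0# 1# C₅
  pentagon-disc d = C₅-realise-pad pentagon 1 25 ≤-refl 0≤1
    (λ u → proj₁ (side u)) (λ u → 0<1*s (ℕ.≤-trans (ℕ.s≤s ℕ.z≤n) (diagonal u)))
    (λ u → inDiscRange 1 25 (sqDist (pentagon u) (pentagon (next u))) (proj₂ (side u)))
    (λ u r → ℕ.<⇒≱ (diagonal u) (discRange⇒ 1 25 (sqDist (pentagon u) (pentagon (next (next u)))) r))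
    where
    side : ∀ u → 0 ℕ.< sqDist (pentagon u) (pentagon (next u)) × 1 ℕ.* sqDist (pentagon u) (pentagon (next u)) ℕ.≤ 25
    side = toWitness {a? = Fin.all? λ u → 0 ℕ.<? sqDist (pentagon u) (pentagon (next u)) ×-dec
                                          1 ℕ.* sqDist (pentagon u) (pentagon (next u)) ℕ.≤? 25} tt
    diagonal : ∀ u → 25 ℕ.< 1 ℕ.* sqDist (pentagon u) (pentagon (next (next u)))
    diagonal = toWitness {a? = Fin.all? λ u → 25 ℕ.<? 1 ℕ.* sqDist (pentagon u) (pentagon (next (next u)))} tt

  module Wide {x} (6/5≤x : fromℕ 6 / fromℕ 5 ≤ x) where

    0≤x : 0# ≤ x
    0≤x = ≤-trans (/-nonNeg (0≤fromℕ 6) (0<fromℕ 5)) 6/5≤x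

    6≤5x : fromℕ 6 ≤ x * fromℕ 5
    6≤5x = ≤-trans (≤-reflexive (sym (x/y*y (fromℕ 6) (0<fromℕ 5)))) (*-monoˡ-≤ (0≤fromℕ 5) 6/5≤x)

    ≤x²b : ∀ m b → 25 ℕ.* m ℕ.≤ 36 ℕ.* b → fromℕ m ≤ x * x * fromℕ b
    ≤x²b m b 25m≤36b = *-cancelʳ-≤ (0<fromℕ 25) (begin
      fromℕ m * fromℕ 25                        ≈⟨ trans (*-comm _ _) (sym (fromℕ-* 25 m)) ⟩
      fromℕ (25 ℕ.* m)                          ≤⟨ fromℕ-mono 25m≤36b ⟩
      fromℕ (36 ℕ.* b)                          ≈⟨ trans (fromℕ-* 36 b) (*-congʳ (fromℕ-* 6 6)) ⟩
      fromℕ 6 * fromℕ 6 * fromℕ b               ≤⟨ *-monoˡ-≤ (0≤fromℕ b) (square-mono (0≤fromℕ 6) 6≤5x) ⟩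
      (x * fromℕ 5) * (x * fromℕ 5) * fromℕ b   ≈⟨ solve 3 (λ x f b → (x :* f) :* (x :* f) :* b := x :* x :* b :* (f :* f)) refl x (fromℕ 5) (fromℕ b) ⟩
      x * x * fromℕ b * (fromℕ 5 * fromℕ 5)     ≈⟨ *-congˡ (fromℕ-* 5 5) ⟨
      x * x * fromℕ b * fromℕ 25                ∎)

    -- Following the diagonals of `pentagon` exchanges sides and diagonals. The longest diagonal has
    -- squared length 36, which on the scale 1 / 5 is exactly 6 / 5.
    pentagram : Fin 5 → Fin 2 → ℕ
    pentagram 0F = pentagon 0F
    pentagram 1F = pentagon 2F
    pentagram 2F = pentagon 4F
    pentagram 3F = pentagon 1F
    pentagram 4F = pentagon 3F

    pentagram-annulus : ∀ d → 𝒜 (2 ℕ.+ d) 1# x C₅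
    pentagram-annulus d = C₅-realise-pad pentagram 1 25 0≤1 0≤x
      (λ u → 0<1*s (ℕ.≤-trans (ℕ.s≤s ℕ.z≤n) (proj₁ (diagonal u)))) (λ u → proj₁ (side u))
      (λ u → inAnnulusRange 1 25 (sqDist (pentagram u) (pentagram (next u))) (proj₁ (diagonal u))
               (≤x²b (1 ℕ.* sqDist (pentagram u) (pentagram (next u))) 25 (proj₂ (diagonal u))))
      (λ u r → ℕ.<⇒≱ (proj₂ (side u)) (annulusRange⇒ 1 25 (sqDist (pentagram u) (pentagram (next (next u)))) r))
      where
      side : ∀ u → 0 ℕ.< sqDist (pentagram u) (pentagram (next (next u))) × 1 ℕ.* sqDist (pentagram u) (pentagram (next (next u))) ℕ.< 25
      side = toWitness {a? = Fin.all? λ u → 0 ℕ.<? sqDist (pentagram u) (pentagram (next (next u))) ×-dec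
                                            1 ℕ.* sqDist (pentagram u) (pentagram (next (next u))) ℕ.<? 25} tt
      diagonal : ∀ u → 25 ℕ.≤ 1 ℕ.* sqDist (pentagram u) (pentagram (next u)) ×
                       25 ℕ.* (1 ℕ.* sqDist (pentagram u) (pentagram (next u))) ℕ.≤ 36 ℕ.* 25
      diagonal = toWitness {a? = Fin.all? λ u → 25 ℕ.≤? 1 ℕ.* sqDist (pentagram u) (pentagram (next u)) ×-dec
                                                25 ℕ.* (1 ℕ.* sqDist (pentagram u) (pentagram (next u))) ℕ.≤? 36 ℕ.* 25} tt

    annulusCube-annulus : ∀ {d} (1≤d : 1 ℕ.≤ d) → 𝒜 d 1# x (annulusCube d 1≤d)
    annulusCube-annulus {d} 1≤d = Realisation.realise (annulusCube d 1≤d) (word d) 4 (3 ℕ.* d) {{_}} {{3d≢0}} 0≤1 0≤x (hamming-pos d)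
      λ u v u≢v → mk⇔
        (λ e → inAnnulusRange 4 (3 ℕ.* d) (hamming {d} u v) (annulus-far 1≤d u v e) (≤x²b (4 ℕ.* hamming {d} u v) (3 ℕ.* d) (bounded u v)))
        (λ r → ℕ.≤⇒≤ᵇ (annulusRange⇒ 4 (3 ℕ.* d) (hamming {d} u v) r))
      where
      3d≢0 : NonZero (3 ℕ.* d)
      3d≢0 = ℕ.m*n≢0 3 d {{_}} {{ℕ.>-nonZero 1≤d}}
      -- The largest squared distance is 4 / 3, and 4 / 3 ≤ 36 / 25 is the comparison of 100 with
      -- 108.
      bounded : ∀ u v → 25 ℕ.* (4 ℕ.* hamming {d} u v) ℕ.≤ 36 ℕ.* (3 ℕ.* d)
      bounded u v = ℕ.≤-trans (ℕ.≤-reflexive (≡.sym (ℕ.*-assoc 25 4 (hamming {d} u v))))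
        (ℕ.≤-trans (ℕ.*-mono-≤ (ℕ.m≤m+n 100 8) (hamming≤d d u v)) (ℕ.≤-reflexive (ℕ.*-assoc 36 3 d)))

  discCube-disc : ∀ d → 𝒜 (suc d) 0# 1# (discCube (suc d))
  discCube-disc d = Realisation.realise (discCube (suc d)) (word (suc d)) 4 b ≤-refl 0≤1 (hamming-pos (suc d))
    λ u v u≢v → mk⇔
      (λ e → inDiscRange 4 b (hamming {suc d} u v) (ℕ.≤-pred (≡.subst (4 ℕ.* hamming {suc d} u v ℕ.<_) 3d≡1+b (disc-near (ℕ.s≤s ℕ.z≤n) u v e))))
      (λ r → Equivalence.from T-∧ (ℕ.<⇒<ᵇ (hamming-pos (suc d) u v u≢v) ,
        ℕ.<⇒<ᵇ (≡.subst (4 ℕ.* hamming {suc d} u v ℕ.<_) (≡.sym 3d≡1+b) (ℕ.s≤s (discRange⇒ 4 b (hamming {suc d} u v) r)))))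
    where
    -- One less than three times the dimension `suc d`: the strict condition on `4 * hamming`
    -- becomes a weak one, which pushes pairs at the threshold just outside the unit distance.
    b = 2 ℕ.+ 3 ℕ.* d
    3d≡1+b : 3 ℕ.* suc d ≡ suc b
    3d≡1+b = ℕ.*-suc 3 d

  cube-nonZero : ∀ d → NonZero (2^′ d)
  cube-nonZero d = ≡.subst NonZero (≡.sym (2^′≡2^ d)) (ℕ.m^n≢0 2 d)

  -- P / Q ≤ χ / ω multiplied out in ℕ. Asking it for every number of colours that suffices spares
  -- the computation of chromatic numbers.
  HasLargeRatio : (FiniteSimpleGraph → Set) → ℕ → ℕ → Set
  HasLargeRatio 𝒢 P Q = ∃[ G ] (𝒢 G × NonZero (order G) ×
    (∀ χ ω → Colorable G χ → IsCliqueNumber G ω → P ℕ.* ω ℕ.≤ Q ℕ.* χ))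

  disc-ratio : ∀ d → 2 ℕ.≤ d → HasLargeRatio (𝒜 d 0# 1#) (101 ℕ.^ d) (100 ℕ.^ d)
  disc-ratio (suc zero) (ℕ.s≤s ())
  disc-ratio (suc (suc d)) _ with ℕ.≤-total 40 (2 ℕ.+ d)
  ... | inj₁ 40≤d = discCube (2 ℕ.+ d) , discCube-disc (suc d) , cube-nonZero (2 ℕ.+ d)
                  , λ χ ω → discCube-ratio {2 ℕ.+ d} (ℕ.s≤s ℕ.z≤n) 40≤d {χ} {ω}
  ... | inj₂ d≤40 = C₅ , pentagon-disc d , _
                  , λ χ ω c isω → small-dimension {2 ℕ.+ d} d≤40 (C₅-χ c) (C₅-ω isω)

  annulus-ratio : ∀ d → 2 ℕ.≤ d → ∀ {x} → fromℕ 6 / fromℕ 5 ≤ x → HasLargeRatio (𝒜 d 1# x) (101 ℕ.^ d) (100 ℕ.^ d)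
  annulus-ratio (suc zero) (ℕ.s≤s ())
  annulus-ratio (suc (suc d)) _ 6/5≤x with ℕ.≤-total 40 (2 ℕ.+ d)
  ... | inj₁ 40≤d = annulusCube (2 ℕ.+ d) 1≤d , Wide.annulusCube-annulus 6/5≤x 1≤d , cube-nonZero (2 ℕ.+ d)
                  , λ χ ω → annulusCube-ratio {2 ℕ.+ d} 1≤d 40≤d {χ} {ω}
    where
    1≤d : 1 ℕ.≤ 2 ℕ.+ d
    1≤d = ℕ.s≤s ℕ.z≤n
  ... | inj₂ d≤40 = C₅ , Wide.pentagram-annulus 6/5≤x d , _
                  , λ χ ω c isω → small-dimension {2 ℕ.+ d} d≤40 (C₅-χ c) (C₅-ω isω)

  -- With N the integer part of x k, an integer t has 1 ≤ t / k ≤ x exactly when k ≤ t ≤ N. The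
  -- `+ 0` in the squared distances below is the empty rest of a sum over one coordinate.
  module _ {x k N} (0≤x : 0# ≤ x) (N≤kx : fromℕ N ≤ x * fromℕ k) (kx<1+N : x * fromℕ k < fromℕ (suc N)) where

    0≤xk : 0# ≤ x * fromℕ k
    0≤xk = *-nonNeg 0≤x (0≤fromℕ k)

    [xk]² : (x * fromℕ k) * (x * fromℕ k) ≈ x * x * fromℕ (k ℕ.* k)
    [xk]² = trans (solve 2 (λ x k → (x :* k) :* (x :* k) := x :* x :* (k :* k)) refl x (fromℕ k)) (*-congˡ (sym (fromℕ-* k k)))

    1*[t*t+0] : ∀ t → 1 ℕ.* (t ℕ.* t ℕ.+ 0) ≡ t ℕ.* t
    1*[t*t+0] t = ≡.trans (ℕ.*-identityˡ _) (ℕ.+-identityʳ _)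

    inLineRange : ∀ t → k ℕ.≤ t → t ℕ.≤ N → InRange 1 (k ℕ.* k) 1# x (t ℕ.* t ℕ.+ 0)
    inLineRange t k≤t t≤N = inAnnulusRange 1 (k ℕ.* k) (t ℕ.* t ℕ.+ 0)
      (ℕ.≤-trans (ℕ.*-mono-≤ k≤t k≤t) (ℕ.≤-reflexive (≡.sym (1*[t*t+0] t))))
      (begin
        fromℕ (1 ℕ.* (t ℕ.* t ℕ.+ 0))         ≈⟨ trans (fromℕ-cong (1*[t*t+0] t)) (fromℕ-* t t) ⟩
        fromℕ t * fromℕ t                     ≤⟨ square-mono (0≤fromℕ t) (≤-trans (fromℕ-mono t≤N) N≤kx) ⟩
        (x * fromℕ k) * (x * fromℕ k)         ≈⟨ [xk]² ⟩
        x * x * fromℕ (k ℕ.* k)               ∎)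

    lineRange⇒ : ∀ t → InRange 1 (k ℕ.* k) 1# x (t ℕ.* t ℕ.+ 0) → k ℕ.≤ t × t ℕ.≤ N
    lineRange⇒ t r =
      square-cancel-≤ (≡.subst (k ℕ.* k ℕ.≤_) (1*[t*t+0] t) (annulusRange⇒ 1 (k ℕ.* k) (t ℕ.* t ℕ.+ 0) r)) ,
      ℕ.≤-pred (fromℕ-<-cancel t (suc N) (≤-<-trans (square-cancel 0≤xk (begin
        fromℕ t * fromℕ t                     ≈⟨ trans (fromℕ-cong (1*[t*t+0] t)) (fromℕ-* t t) ⟨
        fromℕ (1 ℕ.* (t ℕ.* t ℕ.+ 0))         ≤⟨ proj₂ r ⟩
        x * x * fromℕ (k ℕ.* k)               ≈⟨ [xk]² ⟨
        (x * fromℕ k) * (x * fromℕ k)         ∎)) kx<1+N))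

  module WideRealisation {x n} (0≤x : 0# ≤ x) (N≤2x : fromℕ (3 ℕ.+ n) ≤ x * fromℕ 2) (2x<1+N : x * fromℕ 2 < fromℕ (4 ℕ.+ n)) where
    open WideLine n

    step far-step : Fin 5 → ℕ
    step u = ℕ.∣ wide u - wide (next u) ∣
    far-step u = ℕ.∣ wide u - wide (next (next u)) ∣

    square-pos : ∀ {t} → 0 ℕ.< t → 0 ℕ.< t ℕ.* t ℕ.+ 0
    square-pos {suc t} _ = ℕ.s≤s ℕ.z≤n

    outside : ∀ {t} → t ℕ.< 2 ⊎ 3 ℕ.+ n ℕ.< t → ¬ (2 ℕ.≤ t × t ℕ.≤ 3 ℕ.+ n)
    outside (inj₁ t<2) (2≤t , _) = ℕ.<⇒≱ t<2 2≤t
    outside (inj₂ N<t) (_ , t≤N) = ℕ.<⇒≱ N<t t≤N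

    wide-annulus : 𝒜 1 1# x C₅
    wide-annulus = C₅-realise (linePoint wide) 1 4 0≤1 0≤x
      (λ u → square-pos {step u} (ℕ.≤-trans (ℕ.s≤s ℕ.z≤n) (proj₁ (wide-near u))))
      (λ u → square-pos {far-step u} (proj₁ (wide-far u)))
      (λ u → inLineRange 0≤x N≤2x 2x<1+N (step u) (proj₁ (wide-near u)) (proj₂ (wide-near u)))
      (λ u r → outside (proj₂ (wide-far u)) (lineRange⇒ 0≤x N≤2x 2x<1+N (far-step u) r))

  module LineRealisation {x k N} (0≤x : 0# ≤ x) (N≤kx : fromℕ N ≤ x * fromℕ k) (kx<1+N : x * fromℕ k < fromℕ (suc N))
                         (1≤k : 1 ℕ.≤ k) (k<N : k ℕ.< N) (N<2k : N ℕ.< k ℕ.+ k) where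
    open Line k N 1≤k k<N N<2k

    k*k≢0 : NonZero (k ℕ.* k)
    k*k≢0 = ℕ.>-nonZero (ℕ.*-mono-≤ 1≤k 1≤k)

    diff : ∀ u v → ℕ
    diff u v = ℕ.∣ toℕ {suc (k ℕ.+ k)} u - toℕ {suc (k ℕ.+ k)} v ∣

    distinct : ∀ u v → u ≢ v → 0 ℕ.< sqDist (linePoint {suc (k ℕ.+ k)} toℕ u) (linePoint toℕ v)
    distinct u v u≢v with ℕ.∣ toℕ u - toℕ v ∣ in eq
    ... | zero  = contradiction (Fin.toℕ-injective (ℕ.∣m-n∣≡0⇒m≡n eq)) u≢v
    ... | suc _ = ℕ.s≤s ℕ.z≤n

    line-annulus : 𝒜 1 1# x line
    line-annulus = Realisation.realise line (linePoint toℕ) 1 (k ℕ.* k) {{_}} {{k*k≢0}} 0≤1 0≤x distinct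
      λ u v u≢v → mk⇔ (to u v) (from u v)
      where
      to : ∀ u v → Edge line u v → InRange 1 (k ℕ.* k) 1# x (diff u v ℕ.* diff u v ℕ.+ 0)
      to u v e = inLineRange 0≤x N≤kx kx<1+N (diff u v) (proj₁ (Equivalence.to (edge⇔ u v) e)) (proj₂ (Equivalence.to (edge⇔ u v) e))
      from : ∀ u v → InRange 1 (k ℕ.* k) 1# x (diff u v ℕ.* diff u v ℕ.+ 0) → Edge line u v
      from u v r = Equivalence.from (edge⇔ u v) (lineRange⇒ 0≤x N≤kx kx<1+N (diff u v) r)

    line-ratio : ∀ χ ω → Colorable line χ → IsCliqueNumber line ω → 3 ℕ.* ω ℕ.≤ 2 ℕ.* χ
    line-ratio χ ω c isω = ℕ.≤-trans (ℕ.*-monoʳ-≤ 3 (ω≤2 line isω line-triangleFree)) (ℕ.*-monoʳ-≤ 2 (3≤χ line c line-¬2-colorable))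

  wide-ratio : ∀ {x} N → 3 ℕ.≤ N → 0# ≤ x → fromℕ N ≤ x * fromℕ 2 → x * fromℕ 2 < fromℕ (suc N) → HasLargeRatio (𝒜 1 1# x) 3 2
  wide-ratio (suc (suc (suc n))) (ℕ.s≤s (ℕ.s≤s (ℕ.s≤s _))) 0≤x N≤2x 2x<1+N =
    C₅ , WideRealisation.wide-annulus {n = n} 0≤x N≤2x 2x<1+N , _ ,
    λ χ ω c isω → ℕ.≤-trans (ℕ.*-monoʳ-≤ 3 (C₅-ω isω)) (ℕ.*-monoʳ-≤ 2 (C₅-χ c))

  -- k is taken so large that 1 / k ≤ x - 1, hence k + 1 ≤ x k and k < N; x ≤ 3 / 2 gives N ≤ 3 k /
  -- 2 < 2 k.
  narrow-ratio : ∀ {x} → 1# < x → x * fromℕ 2 ≤ fromℕ 3 → HasLargeRatio (𝒜 1 1# x) 3 2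
  narrow-ratio {x} 1<x 2x≤3 = Line.line k N 1≤k k<N N<2k , line-annulus , _ , line-ratio
    where
    0≤x : 0# ≤ x
    0≤x = ≤-trans 0≤1 (proj₁ 1<x)
    0<x-1 : 0# < x - 1#
    0<x-1 = ≰⇒< λ x-1≤0 → <⇒≰ 1<x (0≤y-x⇒x≤y (begin
      0#              ≤⟨ x≤y⇒0≤y-x x-1≤0 ⟩
      0# - (x - 1#)   ≈⟨ trans (+-identityˡ _) (solve 2 (λ x o → :- (x :- o) := o :- x) refl x 1#) ⟩
      1# - x          ∎))
    j k N : ℕ
    j = proj₁ (archimedean ((x - 1#) ⁻¹))
    k = suc j
    1≤k : 1 ℕ.≤ k
    1≤k = ℕ.s≤s ℕ.z≤n
    1≤[x-1]k : 1# ≤ (x - 1#) * fromℕ k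
    1≤[x-1]k = begin
      1#                           ≈⟨ x*x⁻¹ 0<x-1 ⟨
      (x - 1#) * (x - 1#) ⁻¹       ≤⟨ *-monoʳ-≤ (proj₁ 0<x-1) (≤-trans (proj₂ (archimedean ((x - 1#) ⁻¹))) (fromℕ-mono {j} {k} (ℕ.n≤1+n j))) ⟩
      (x - 1#) * fromℕ k           ∎
    1+k≤kx : fromℕ (suc k) ≤ x * fromℕ k
    1+k≤kx = begin
      1# + fromℕ k                     ≤⟨ +-monoˡ-≤ (fromℕ k) 1≤[x-1]k ⟩
      (x - 1#) * fromℕ k + fromℕ k     ≈⟨ +-congˡ (*-identityˡ (fromℕ k)) ⟨
      (x - 1#) * fromℕ k + 1# * fromℕ k ≈⟨ solve 3 (λ x o k → (x :- o) :* k :+ o :* k := x :* k) refl x 1# (fromℕ k) ⟩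
      x * fromℕ k                      ∎
    floored : ∃[ n ] (fromℕ n ≤ x * fromℕ k × x * fromℕ k < fromℕ (suc n))
    floored = floor (x * fromℕ k) (*-nonNeg 0≤x (0≤fromℕ k))
    N = proj₁ floored
    N≤kx : fromℕ N ≤ x * fromℕ k
    N≤kx = proj₁ (proj₂ floored)
    kx<1+N : x * fromℕ k < fromℕ (suc N)
    kx<1+N = proj₂ (proj₂ floored)
    k<N : k ℕ.< N
    k<N = ℕ.≤-pred (fromℕ-<-cancel (suc k) (suc N) (≤-<-trans 1+k≤kx kx<1+N))
    2N≤3k : 2 ℕ.* N ℕ.≤ 3 ℕ.* k
    2N≤3k = fromℕ-cancel (2 ℕ.* N) (3 ℕ.* k) (begin
      fromℕ (2 ℕ.* N)            ≈⟨ fromℕ-* 2 N ⟩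
      fromℕ 2 * fromℕ N          ≤⟨ *-monoʳ-≤ (0≤fromℕ 2) N≤kx ⟩
      fromℕ 2 * (x * fromℕ k)    ≈⟨ solve 3 (λ t x k → t :* (x :* k) := x :* t :* k) refl (fromℕ 2) x (fromℕ k) ⟩
      x * fromℕ 2 * fromℕ k      ≤⟨ *-monoˡ-≤ (0≤fromℕ k) 2x≤3 ⟩
      fromℕ 3 * fromℕ k          ≈⟨ fromℕ-* 3 k ⟨
      fromℕ (3 ℕ.* k)            ∎)
    N<2k : N ℕ.< k ℕ.+ k
    N<2k = ℕ.*-cancelˡ-< 2 N (k ℕ.+ k) (ℕ.≤-<-trans 2N≤3k (ℕ.<-≤-trans (ℕ.*-monoˡ-< k {3} {4} ℕ.≤-refl)
      (ℕ.≤-reflexive (≡.trans (ℕ.*-assoc 2 2 k) (≡.cong (λ j → 2 ℕ.* (k ℕ.+ j)) (ℕ.+-identityʳ k))))))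
    open LineRealisation {x} {k} {N} 0≤x N≤kx kx<1+N 1≤k k<N N<2k

  -- At x = 3 / 2 the integer part of 2 x reaches the 3 that `WideLine` requires; below, N < 2 k is
  -- ensured for `Line`.
  one-dimensional-ratio : ∀ x → 1# < x → HasLargeRatio (𝒜 1 1# x) 3 2
  one-dimensional-ratio x 1<x with em {fromℕ 3 ≤ x * fromℕ 2}
  ... | no x<3/2 = narrow-ratio 1<x (≰⇒≥ x<3/2)
  ... | yes 3/2≤x = wide-ratio N 3≤N 0≤x (proj₁ (proj₂ floored)) (proj₂ (proj₂ floored))
    where
    0≤x : 0# ≤ x
    0≤x = ≤-trans 0≤1 (proj₁ 1<x)
    floored : ∃[ n ] (fromℕ n ≤ x * fromℕ 2 × x * fromℕ 2 < fromℕ (suc n))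
    floored = floor (x * fromℕ 2) (*-nonNeg 0≤x (0≤fromℕ 2))
    N = proj₁ floored
    3≤N : 3 ℕ.≤ N
    3≤N = ℕ.≤-pred (fromℕ-<-cancel 3 (suc N) (≤-<-trans 3/2≤x (proj₂ (proj₂ floored))))

  point-𝒜 : ∀ {d R₁ R₂} → ∃[ G ] (𝒜 d R₁ R₂ G × NonZero (order G))
  point-𝒜 = record { order = 1 ; adjacent = λ _ _ → false ; symmetric = λ _ _ → ≡.refl ; irreflexive = λ _ () }
    , ((λ _ _ → 0#) , (λ { {0F} {0F} _ → ≡.refl }) , λ { 0F 0F 0≢0 → contradiction ≡.refl 0≢0 }) , _

  fromℕ-^ : ∀ b d → fromℕ (b ℕ.^ d) ≈ fromℕ b ^ d
  fromℕ-^ b zero    = fromℕ-1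
  fromℕ-^ b (suc d) = trans (fromℕ-* b (b ℕ.^ d)) (*-congˡ (fromℕ-^ b d))

  [p/q]^d : ∀ p q d → .{{NonZero q}} → (fromℕ p / fromℕ q) ^ d * fromℕ (q ℕ.^ d) ≈ fromℕ (p ℕ.^ d)
  [p/q]^d p q zero    = *-identityˡ _
  [p/q]^d p q (suc d) = trans (*-congˡ (fromℕ-* q (q ℕ.^ d)))
    (trans (solve 4 (λ r y q z → r :* y :* (q :* z) := (r :* q) :* (y :* z)) refl
             (fromℕ p / fromℕ q) ((fromℕ p / fromℕ q) ^ d) (fromℕ q) (fromℕ (q ℕ.^ d)))
      (trans (*-cong (x/y*y (fromℕ p) (0<fromℕ q)) ([p/q]^d p q d)) (sym (fromℕ-* p (p ℕ.^ d)))))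

  colorable-mono : ∀ G {j k} → j ℕ.≤ k → Colorable G j → Colorable G k
  colorable-mono G j≤k (c , proper) = (λ v → inject≤ (c v) j≤k) , λ u v e eq → proper u v e (Fin.inject≤-injective j≤k j≤k _ _ eq)

  K : ℕ
  K = 2 ℕ.^ 39

  K^d : ∀ d → 2 ℕ.^ (39 ℕ.* d) ≡ K ℕ.^ d
  K^d d = ≡.sym (ℕ.^-*-assoc 2 39 d)

  -- `annulus-colorable` pays Kᵈ twice: for the large cubes near a vertex, and for the first
  -- colouring, which splits each of them into cliques.
  M : ℕ
  M = K ℕ.* K

  M^d : ∀ d ω → 2 ℕ.^ (39 ℕ.* d) ℕ.* (2 ℕ.^ (39 ℕ.* d) ℕ.* ω) ≡ M ℕ.^ d ℕ.* ω
  M^d d ω = ≡.trans (≡.cong (λ x → x ℕ.* (x ℕ.* ω)) (K^d d))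
    (≡.trans (≡.sym (ℕ.*-assoc (K ℕ.^ d) (K ℕ.^ d) ω)) (≡.cong (ℕ._* ω) (≡.sym (^-distribʳ-* d K K))))

  annulus-sup : ∀ d → 1 ℕ.≤ d → ∀ x → 1# ≤ x → ∃[ s ] (IsSup-χ/ω (𝒜 d 1# x) s × s ≤ fromℕ (M ℕ.^ d))
  annulus-sup d 1≤d x 1≤x = sup-exists (𝒜 d 1# x) (M ℕ.^ d) point-𝒜 λ G ω G∈ isω →
    ≡.subst (Colorable G) (M^d d ω) (annulus-colorable {G = G} 1≤d 1≤x G∈ isω)

  disc-sup : ∀ d → 1 ℕ.≤ d → ∃[ s ] (IsSup-χ/ω (𝒜 d 0# 1#) s × s ≤ fromℕ (M ℕ.^ d))
  disc-sup d 1≤d = sup-exists (𝒜 d 0# 1#) (M ℕ.^ d) point-𝒜 λ G ω G∈ isω →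
    ≡.subst (Colorable G) (M^d d ω) (colorable-mono G
      (ℕ.m≤n*m (2 ℕ.^ (39 ℕ.* d) ℕ.* ω) (2 ℕ.^ (39 ℕ.* d)) {{ℕ.m^n≢0 2 (39 ℕ.* d)}})
      (unitDisc-colorable {G = G} 1≤d G∈ isω))

  m : ℝ
  m = fromℕ 101 / fromℕ 100

  large-ratio≤sup : ∀ {𝒢 y s} P Q → .{{NonZero Q}} → HasLargeRatio 𝒢 P Q → IsSup-χ/ω 𝒢 s → y * fromℕ Q ≤ fromℕ P → y ≤ s
  large-ratio≤sup {𝒢} P Q (G , G∈ , nz , large) isSup yQ≤P = ratio≤sup 𝒢 G P Q isSup G∈ nz yQ≤P large

  m^d≤ : ∀ {𝒢 s} d → HasLargeRatio 𝒢 (101 ℕ.^ d) (100 ℕ.^ d) → IsSup-χ/ω 𝒢 s → m ^ d ≤ s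
  m^d≤ d large isSup = large-ratio≤sup (101 ℕ.^ d) (100 ℕ.^ d) {{ℕ.m^n≢0 100 d}} large isSup (≤-reflexive ([p/q]^d 101 100 d))

  1<fromℕ : ∀ {n} → 1 ℕ.< n → 1# < fromℕ n
  1<fromℕ 1<n = ≤-<-trans (≤-reflexive (sym fromℕ-1)) (fromℕ-<-mono 1<n)

  1<m : 1# < m
  1<m = ≰⇒< λ m≤1 → ℕ.<⇒≱ {100} {101} ℕ.≤-refl (fromℕ-cancel 101 100 (begin
    fromℕ 101         ≈⟨ x/y*y (fromℕ 101) (0<fromℕ 100) ⟨
    m * fromℕ 100     ≤⟨ *-monoˡ-≤ (0≤fromℕ 100) m≤1 ⟩
    1# * fromℕ 100    ≈⟨ *-identityˡ _ ⟩
    fromℕ 100         ∎))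

  6/5≤x⇒1≤x : ∀ {x} → fromℕ 6 / fromℕ 5 ≤ x → 1# ≤ x
  6/5≤x⇒1≤x = ≤-trans (≤-/ (0<fromℕ 5) (≤-trans (≤-reflexive (*-identityˡ (fromℕ 5))) (fromℕ-mono {5} {6} (ℕ.n≤1+n 5))))

theorem1p2 : ExcludedMiddle 0ℓ → (R : CompleteOrderedField) →
  let open CompleteOrderedField R
      open AnnulusGraphs R
  in
  ∃[ M ] ∃[ m ] (1# < M × 1# < m ×
    (∀ (d : ℕ) → 2 ≤ℕ d →
      (∀ (x : ℝ) → 1# ≤ x →
        ∃[ s ] (IsSup-χ/ω (𝒜 d 1# x) s × s ≤ M ^ d)) ×
      (∀ (x : ℝ) → fromℕ 6 / fromℕ 5 ≤ x →
        ∃[ s ] (IsSup-χ/ω (𝒜 d 1# x) s × m ^ d ≤ s)) ×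
      (∃[ s ] (IsSup-χ/ω (𝒜 d 0# 1#) s × m ^ d ≤ s × s ≤ M ^ d))) ×
    (∀ (x : ℝ) → 1# < x →
      ∃[ s ] (IsSup-χ/ω (𝒜 1 1# x) s × fromℕ 3 / fromℕ 2 ≤ s × s ≤ M)))
theorem1p2 em R = fromℕ M , m , 1<fromℕ (ℕ.≤ᵇ⇒≤ 2 M tt) , 1<m , high , line
  where
  open CompleteOrderedField R
  open AnnulusGraphs R
  open Theorem em R
  open Field em R
  open CommutativeRing commutativeRing using (*-identityʳ)
  ≤M^d : ∀ {s} d → s ≤ fromℕ (M ℕ.^ d) → s ≤ fromℕ M ^ d
  ≤M^d d s≤ = ≤-trans s≤ (≤-reflexive (fromℕ-^ M d))
  high : ∀ d → 2 ℕ.≤ d →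
    (∀ x → 1# ≤ x → ∃[ s ] (IsSup-χ/ω (𝒜 d 1# x) s × s ≤ fromℕ M ^ d)) ×
    (∀ x → fromℕ 6 / fromℕ 5 ≤ x → ∃[ s ] (IsSup-χ/ω (𝒜 d 1# x) s × m ^ d ≤ s)) ×
    (∃[ s ] (IsSup-χ/ω (𝒜 d 0# 1#) s × m ^ d ≤ s × s ≤ fromℕ M ^ d))
  high d 2≤d = upper , lower , disc
    where
    1≤d = ℕ.<⇒≤ 2≤d
    upper : ∀ x → 1# ≤ x → ∃[ s ] (IsSup-χ/ω (𝒜 d 1# x) s × s ≤ fromℕ M ^ d)
    upper x 1≤x = let s , isSup , s≤ = annulus-sup d 1≤d x 1≤x in s , isSup , ≤M^d d s≤
    lower : ∀ x → fromℕ 6 / fromℕ 5 ≤ x → ∃[ s ] (IsSup-χ/ω (𝒜 d 1# x) s × m ^ d ≤ s)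
    lower x 6/5≤x = let s , isSup , _ = annulus-sup d 1≤d x (6/5≤x⇒1≤x 6/5≤x) in
      s , isSup , m^d≤ d (annulus-ratio d 2≤d 6/5≤x) isSup
    disc : ∃[ s ] (IsSup-χ/ω (𝒜 d 0# 1#) s × m ^ d ≤ s × s ≤ fromℕ M ^ d)
    disc = let s , isSup , s≤ = disc-sup d 1≤d in s , isSup , m^d≤ d (disc-ratio d 2≤d) isSup , ≤M^d d s≤
  line : ∀ x → 1# < x → ∃[ s ] (IsSup-χ/ω (𝒜 1 1# x) s × fromℕ 3 / fromℕ 2 ≤ s × s ≤ fromℕ M)
  line x 1<x = let s , isSup , s≤ = annulus-sup 1 ℕ.≤-refl x (proj₁ 1<x) in
    s , isSup , large-ratio≤sup 3 2 (one-dimensional-ratio x 1<x) isSup (≤-reflexive (x/y*y (fromℕ 3) (0<fromℕ 2))) ,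
    ≤-trans (≤M^d 1 s≤) (≤-reflexive (*-identityʳ (fromℕ M)))
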